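{- There are absolute constants $0<c\le C$ such that the following holds. Let $G$ be a strongly regular graph with $n$ vertices and degree $d$, where $1\le d\le 0.99n$, and suppose $G$ has exactly $d^3/6+s$ triangles. (i) If $s<-nd^{3/2}$, then $c\,|s|/d\le \mathrm{sp}(G)\le C\,|s|/d$. (ii) If $-nd^{3/2}\le s\le nd^{3/2}$, then $c\, nd^{1/2}\le \mathrm{sp}(G)\le C\, nd^{1/2}$. (iii) If $s>nd^{3/2}$, then $c\, n^2d^2/s\le \mathrm{sp}(G)\le C\, n^2d^2/s$.
   Context: All graphs are finite and simple. A graph is strongly regular if it is $d$-regular for some $d$ and there exist numbers $\eta,\mu$ such that any two adjacent vertices have exactly $\eta$ common neighbours and any two distinct non-adjacent vertices have exactly $\mu$ common neighbours. $\mathrm{mc}(G)$ denotes the maximum number of edges crossing a partition of $V(G)$ into two parts, and $\mathrm{sp}(G)=\mathrm{mc}(G)-e(G)/2$. -}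

module Defs where

open import Data.Bool using (Bool; true; false; if_then_else_; _∧_; _xor_)
open import Data.Nat as ℕ using (ℕ; zero; suc; _⊔_; _<ᵇ_)
open import Data.Fin using (Fin; toℕ)
open import Data.List using (List; []; _∷_; map; allFin; foldr; _++_)
open import Data.Nat.ListAction using (sum)
open import Data.Vec using (Vec; []; _∷_; lookup)
open import Data.Product using (Σ; _×_; _,_)
open import Data.Integer as ℤ using (ℤ)
open import Data.Rational as ℚ using (ℚ; _/_)
open import Relation.Binary.PropositionalEquality using (_≡_; _≢_)

record Graph (n : ℕ) : Set where
  field
    adj   : Fin n → Fin n → Bool
    sym   : ∀ i j → adj i j ≡ adj j i
    irrefl : ∀ i → adj i i ≡ false
open Graph public

Σ[_] : {n : ℕ} → (Fin n → ℕ) → ℕ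
Σ[_] {n} f = sum (map f (allFin n))

b2n : Bool → ℕ
b2n true = 1
b2n false = 0

_<F_ : {n : ℕ} → Fin n → Fin n → Bool
i <F j = toℕ i <ᵇ toℕ j

degree : {n : ℕ} → Graph n → Fin n → ℕ
degree G i = Σ[ (λ j → b2n (adj G i j)) ]

commonNbrs : {n : ℕ} → Graph n → Fin n → Fin n → ℕ
commonNbrs G i j = Σ[ (λ k → b2n (adj G i k ∧ adj G j k)) ]

edges : {n : ℕ} → Graph n → ℕ
edges G = Σ[ (λ i → Σ[ (λ j → b2n ((i <F j) ∧ adj G i j)) ]) ]

triangles : {n : ℕ} → Graph n → ℕ
triangles G = Σ[ (λ i → Σ[ (λ j → Σ[ (λ k →
  b2n ((i <F j) ∧ (j <F k) ∧ adj G i j ∧ adj G j k ∧ adj G i k)) ]) ]) ]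

Regular : {n : ℕ} → Graph n → ℕ → Set
Regular G d = ∀ i → degree G i ≡ d

StronglyRegular : {n : ℕ} → Graph n → ℕ → Set
StronglyRegular {n} G d =
  Regular G d ×
  Σ ℕ (λ η → Σ ℕ (λ μ →
    (∀ i j → i ≢ j → adj G i j ≡ true → commonNbrs G i j ≡ η) ×
    (∀ i j → i ≢ j → adj G i j ≡ false → commonNbrs G i j ≡ μ)))

-- all bipartitions (V₀,V₁) of Fin n, encoded by the side of each vertex
allSides : (n : ℕ) → List (Vec Bool n)
allSides zero = [] ∷ []
allSides (suc n) = map (true ∷_) (allSides n) ++ map (false ∷_) (allSides n)

cut : {n : ℕ} → Graph n → Vec Bool n → ℕ
cut G S = Σ[ (λ i → Σ[ (λ j →
  b2n ((i <F j) ∧ adj G i j ∧ (lookup S i xor lookup S j))) ]) ]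

mc : {n : ℕ} → Graph n → ℕ
mc {n} G = foldr _⊔_ 0 (map (cut G) (allSides n))

ℕ→ℚ : ℕ → ℚ
ℕ→ℚ m = ℤ.+ m / 1

sp : {n : ℕ} → Graph n → ℚ
sp G = ℕ→ℚ (mc G) ℚ.- (ℤ.+ edges G / 2)

surplus : {n : ℕ} → Graph n → ℕ → ℚ
surplus G d = ℕ→ℚ (triangles G) ℚ.- (ℤ.+ (d ℕ.^ 3) / 6)

{-# OPTIONS --safe #-}

-- For a sign vector x with sides S one has xᵀAx = 2 e(G) - 4 cut(S), so 4 sp(G) is the maximum of -xᵀAx over
-- sign vectors, equivalently over the box [-1,1]ⁿ.
--
-- Upper bound.  Since A² = (η-μ)A + (d-μ)I + μJ, the inequality ‖(A + aI)y‖² ≥ 0 for y ⟂ 1 gives -yᵀAy ≤ a‖y‖²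
-- as soon as a² + (η-μ)a ≥ d - μ, that is, as soon as -a lies below the least eigenvalue.
--
-- Lower bound.  Apply A - αI to a vector of random signs, truncate its coordinates at R ≈ √(α² + d), and project the
-- result x onto the complement of 1.  The joint law of (xᵢ, xⱼ) only depends on whether i ~ j: it comes from a planar
-- random walk.  Replacing a step (a, b) of this walk by two independent steps (a, 0) and (0, b) decreases E[xᵢxⱼ] by
-- ab, up to a small relative error.  Turning the walk of an edge into the walk of a non-edge in this way shows that
-- E[xᵢxⱼ] is smaller on edges than on non-edges by the order of α + (μ-η)⁺, provided that α ≥ η - μ; the large common
-- part of the two walks never enters.
--
-- Both bounds are then expressed through T = nη - d² = 6s/d, with α = 0 in (i), α ≈ √d in (ii) and α = η - μ in (iii).
module Submission where

open import Defs renaming (sym to adj-sym)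
open import Data.Bool using (Bool; true; false; if_then_else_; _∧_; _xor_)
import Data.Bool.Properties as Bool
open import Data.Empty using (⊥-elim)
open import Data.Fin using (Fin; zero; suc; toℕ)
import Data.Fin.Properties as Fin
open import Data.Integer as ℤ using (ℤ; +_; -[1+_]; 0ℤ; 1ℤ; -1ℤ; +≤+; +<+)
import Data.Integer.Properties as ℤ
open import Data.Integer.Tactic.RingSolver using (solve-∀)
open import Data.List as List using (List; []; _∷_; _++_; map; foldr; replicate; length; tabulate; allFin)
open import Data.List.Membership.Propositional using (_∈_)
open import Data.List.Membership.Propositional.Properties using (∈-map⁺; ∈-++⁺ˡ; ∈-++⁺ʳ; ∈-allFin; ∈-∃++)
open import Data.List.Properties using (map-tabulate; length-tabulate; length-++; length-replicate; ++-identityʳ)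
open import Data.List.Relation.Binary.Permutation.Propositional as Perm using (_↭_; prep; swap; ↭⇒↭ₛ)
open import Data.List.Relation.Binary.Permutation.Propositional.Properties using (shift; shifts; ++⁺ˡ; ∈-resp-↭; map⁺; ↭-length)
import Data.List.Relation.Binary.Permutation.Setoid.Properties as Setoid
open import Data.List.Relation.Unary.Any using (here; there)
open import Data.List.Relation.Unary.Unique.Propositional.Properties using (allFin⁺)
open import Data.Nat as ℕ using (ℕ; zero; suc; z≤n; s≤s)
import Data.Nat.ListAction as ℕL
import Data.Nat.ListAction.Properties as ℕL
import Data.Nat.Properties as ℕ
import Data.Nat.Tactic.RingSolver as ℕ-Solver
open import Data.Product using (Σ; _×_; _,_; proj₁; proj₂; ∃-syntax)
open import Data.Rational as ℚ using (ℚ; 0ℚ; _/_; toℚᵘ)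
import Data.Rational.Properties as ℚ
open import Data.Rational.Unnormalised as ℚᵘ using (mkℚᵘ; *≡*; *≤*; *<*)
import Data.Rational.Unnormalised.Properties as ℚᵘ
open import Data.Sum using (_⊎_; inj₁; inj₂)
open import Data.Vec as Vec using (Vec; []; _∷_; lookup)
open import Function using (_∘_; id)
open import Relation.Binary.Definitions using (tri<; tri≈; tri>)
open import Relation.Binary.PropositionalEquality using (_≡_; _≢_; refl; sym; trans; cong; cong₂; subst; subst₂; setoid; module ≡-Reasoning)
open import Relation.Nullary using (¬_; does; yes; no; contradiction; ofʸ; ofⁿ)

-- The difficulty of the lower bound is its margin. The two coordinates of a walk share up to d
-- steps, so E[xᵢxⱼ] may far exceed the difference between edges and non-edges, and separate
-- estimates of the two would lose it. Moreover gain and loss have the same order when α = η - μ >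
-- 0: the entries -α and 1 at the two ends of an edge gain twice α, while the η - μ extra common
-- neighbours of an edge lose η - μ. Truncation may therefore cost only a fixed fraction of a gain:
-- R² ≥ 16 (α² + d) preserves three quarters of it, and 2 · 3 α still exceeds 4 (η - μ).
--
-- Complete graphs have no non-edges to compare with. The bound d ≤ 0.99 n leaves only those on at
-- most 100 vertices, and for all other graphs it makes n at most 200 times the number n - 1 - d of
-- non-neighbours of a vertex.
--
-- To stay within the integers, expectations become sums over all sign vectors, projections are
-- multiplied by n, √d is replaced by an integer r with d ≤ r² ≤ 4 d, and an eigenvalue bound a by a
-- fraction p / q.

module Integral where

  -- Inequalities and finite sums over the integers

  open import Data.Integer using (_+_; _*_; _-_; -_; _^_; _≤_; _<_)
  open import Algebra.Properties.Semiring.Sum ℤ.+-*-semiring using (sum; sum-cong-≗; ∑-distrib-+; ∑-comm; *-distribˡ-sum)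

  -- The format of nearly all inequalities below: a ring identity writes the difference of the two
  -- sides as a sum of products of quantities known to be nonnegative.
  ≤-by : ∀ {a b e} → b - a ≡ e → 0ℤ ≤ e → a ≤ b
  ≤-by refl p = ℤ.0≤i-j⇒j≤i p

  0≤+ : ∀ {a b} → 0ℤ ≤ a → 0ℤ ≤ b → 0ℤ ≤ a + b
  0≤+ p q = ℤ.+-mono-≤ p q

  0≤* : ∀ {a b} → 0ℤ ≤ a → 0ℤ ≤ b → 0ℤ ≤ a * b
  0≤* {+ m} {+ n} _ _ = subst (0ℤ ≤_) (ℤ.pos-* m n) (+≤+ z≤n)

  0≤² : ∀ a → 0ℤ ≤ a * a
  0≤² (+ n) = 0≤* {+ n} {+ n} (+≤+ z≤n) (+≤+ z≤n)
  0≤² -[1+ n ] = +≤+ z≤n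

  0≤n : ∀ {n} → 0ℤ ≤ + n
  0≤n = +≤+ z≤n

  0≤- : ∀ {a b} → a ≤ b → 0ℤ ≤ b - a
  0≤- = ℤ.i≤j⇒0≤j-i

  sum-0≤ : ∀ {n} {f : Fin n → ℤ} → (∀ i → 0ℤ ≤ f i) → 0ℤ ≤ sum f
  sum-0≤ {zero} p = ℤ.≤-refl
  sum-0≤ {suc n} p = 0≤+ (p zero) (sum-0≤ (p ∘ suc))

  sum-const : ∀ {n} c → sum {n} (λ _ → c) ≡ + n * c
  sum-const {zero} c = refl
  sum-const {suc n} c = trans (cong (λ t → c + t) (sum-const {n} c)) (sym (ℤ.suc-* (+ n) c))

  sum-*ˡ : ∀ {n} c (f : Fin n → ℤ) → sum (λ i → c * f i) ≡ c * sum f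
  sum-*ˡ c f = sym (*-distribˡ-sum c f)

  sum-linear : ∀ {n} a b (f g : Fin n → ℤ) → sum (λ i → a * f i + b * g i) ≡ a * sum f + b * sum g
  sum-linear a b f g = trans (∑-distrib-+ (λ i → a * f i) (λ i → b * g i)) (cong₂ _+_ (sum-*ˡ a f) (sum-*ˡ b g))

  Σ[]≡sum : ∀ {n} (f : Fin n → ℕ) → + Σ[ f ] ≡ sum (λ i → + f i)
  Σ[]≡sum f = trans (cong (λ l → + ℕL.sum l) (map-tabulate id f)) (go f)
    where
    go : ∀ {n} (f : Fin n → ℕ) → + ℕL.sum (tabulate f) ≡ sum (λ i → + f i)
    go {zero} f = refl
    go {suc n} f = cong (λ t → + f zero + t) (go (f ∘ suc))

  sum₂ : ∀ {n} → (Fin n → Fin n → ℤ) → ℤ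
  sum₂ f = sum (λ i → sum (f i))

  sum₂-cong : ∀ {n} {f g : Fin n → Fin n → ℤ} → (∀ i j → f i j ≡ g i j) → sum₂ f ≡ sum₂ g
  sum₂-cong e = sum-cong-≗ (λ i → sum-cong-≗ (e i))

  sum₂-+ : ∀ {n} (f g : Fin n → Fin n → ℤ) → sum₂ (λ i j → f i j + g i j) ≡ sum₂ f + sum₂ g
  sum₂-+ f g = trans (sum-cong-≗ (λ i → ∑-distrib-+ (f i) (g i))) (∑-distrib-+ (sum ∘ f) (sum ∘ g))

  sum₂-*ˡ : ∀ {n} c (f : Fin n → Fin n → ℤ) → sum₂ (λ i j → c * f i j) ≡ c * sum₂ f
  sum₂-*ˡ c f = trans (sum-cong-≗ (λ i → sum-*ˡ c (f i))) (sum-*ˡ c (sum ∘ f))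

  sum₂-linear : ∀ {n} a b (f g : Fin n → Fin n → ℤ) →
    sum₂ (λ i j → a * f i j + b * g i j) ≡ a * sum₂ f + b * sum₂ g
  sum₂-linear a b f g =
    trans (sum₂-+ (λ i j → a * f i j) (λ i j → b * g i j)) (cong₂ _+_ (sum₂-*ˡ a f) (sum₂-*ˡ b g))

  sum-sum : ∀ {n} (x y : Fin n → ℤ) → sum₂ (λ i j → x i * y j) ≡ sum x * sum y
  sum-sum x y = trans (sum-cong-≗ (λ i → sum-*ˡ (x i) y))
    (trans (sum-cong-≗ (λ i → ℤ.*-comm (x i) (sum y))) (trans (sum-*ˡ (sum y) x) (ℤ.*-comm (sum y) (sum x))))

  Σ[]₂≡sum₂ : ∀ {n} (f : Fin n → Fin n → ℕ) → + Σ[ (λ i → Σ[ f i ]) ] ≡ sum₂ (λ i j → + f i j)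
  Σ[]₂≡sum₂ f = trans (Σ[]≡sum (λ i → Σ[ f i ])) (sum-cong-≗ (λ i → Σ[]≡sum (f i)))

  -- Quadratic functions on a box

  -- The constant and linear terms are carried along because fixing one coordinate of a quadratic
  -- form creates them; with them the class is closed under restriction, which the induction on the
  -- dimension needs.
  quadratic : ∀ {n} → ℤ → (Fin n → ℤ) → (Fin n → Fin n → ℤ) → (Fin n → ℤ) → ℤ
  quadratic c b a x = c + sum (λ i → b i * x i) + sum₂ (λ i j → a i j * (x i * x j))

  sgn : ∀ {n} → Vec Bool n → Fin n → ℤ
  sgn S i = if lookup S i then 1ℤ else -1ℤ

  module _ {n} (c : ℤ) (b : Fin (suc n) → ℤ) (a : Fin (suc n) → Fin (suc n) → ℤ) where

    restrict : ℤ → (Fin n → ℤ) → ℤ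
    restrict v = quadratic (c + b zero * v) (λ j → b (suc j) + v * (a zero (suc j) + a (suc j) zero))
      (λ i j → a (suc i) (suc j))

    slope : (Fin n → ℤ) → ℤ
    slope y = b zero + sum (λ j → (a zero (suc j) + a (suc j) zero) * y j)

    restrict-affine : ∀ v y → restrict v y ≡ restrict 0ℤ y + v * slope y
    restrict-affine v y = trans
      (cong (λ s → c + b zero * v + s + Q) (trans (sum-cong-≗ (λ j → l₁ (b (suc j)) v (D j) (y j)))
        (trans (∑-distrib-+ (λ j → b (suc j) * y j) (λ j → v * (D j * y j)))
               (cong (λ t → sum (λ j → b (suc j) * y j) + t) (sum-*ˡ v (λ j → D j * y j))))))
      (trans (l₂ c (b zero) v _ _ Q)
        (sym (cong (λ s → c + b zero * 0ℤ + s + Q + v * slope y) (sum-cong-≗ (λ j → l₃ (b (suc j)) (D j) (y j))))))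
      where
      Q = sum₂ (λ i j → a (suc i) (suc j) * (y i * y j))
      D : Fin n → ℤ
      D j = a zero (suc j) + a (suc j) zero
      l₁ : ∀ b v d y → (b + v * d) * y ≡ b * y + v * (d * y)
      l₁ = solve-∀
      l₂ : ∀ c b v s t q → c + b * v + (s + v * t) + q ≡ c + b * 0ℤ + s + q + v * (b + t)
      l₂ = solve-∀
      l₃ : ∀ b d y → (b + 0ℤ * d) * y ≡ b * y
      l₃ = solve-∀

    quadratic-restrict : a zero zero ≡ 0ℤ → ∀ x → quadratic c b a x ≡ restrict (x zero) (x ∘ suc)
    quadratic-restrict a₀₀ x = begin
      c + (b zero * v + sB) + ((a zero zero * (v * v) + sum (λ j → a zero (suc j) * (v * y j)))
        + sum (λ i → a (suc i) zero * (y i * v) + sum (λ j → a (suc i) (suc j) * (y i * y j))))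
        ≡⟨ cong₂ (λ s t → c + (b zero * v + sB) + (s + t))
             (cong₂ _+_ (cong (_* (v * v)) a₀₀) (trans (sum-cong-≗ (λ j → l₁ (a zero (suc j)) v (y j))) (sum-*ˡ v (λ j → a zero (suc j) * y j))))
             (trans (∑-distrib-+ (λ i → a (suc i) zero * (y i * v)) _)
               (cong (_+ Q) (trans (sum-cong-≗ (λ j → l₂ (a (suc j) zero) v (y j))) (sum-*ˡ v (λ j → a (suc j) zero * y j))))) ⟩
      c + (b zero * v + sB) + ((0ℤ * (v * v) + v * s₁) + (v * s₂ + Q))
        ≡⟨ l₃ c (b zero) v sB s₁ s₂ Q ⟩
      c + b zero * v + (sB + v * (s₁ + s₂)) + Q
        ≡⟨ cong (λ s → c + b zero * v + s + Q) (sym (trans (sum-cong-≗ (λ j → l₄ (b (suc j)) v (a zero (suc j)) (a (suc j) zero) (y j)))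
             (trans (∑-distrib-+ (λ j → b (suc j) * y j) _)
             (cong (λ t → sB + t) (trans (sum-*ˡ v (λ j → a zero (suc j) * y j + a (suc j) zero * y j))
                (cong (v *_) (∑-distrib-+ (λ j → a zero (suc j) * y j) (λ j → a (suc j) zero * y j)))))))) ⟩
      restrict v y ∎
      where
      open ≡-Reasoning
      v = x zero
      y = x ∘ suc
      sB = sum (λ j → b (suc j) * y j)
      s₁ = sum (λ j → a zero (suc j) * y j)
      s₂ = sum (λ j → a (suc j) zero * y j)
      Q = sum₂ (λ i j → a (suc i) (suc j) * (y i * y j))
      l₁ : ∀ a v y → a * (v * y) ≡ v * (a * y)
      l₁ = solve-∀
      l₂ : ∀ a v y → a * (y * v) ≡ v * (a * y)
      l₂ = solve-∀
      l₃ : ∀ c b v s t u q → c + (b * v + s) + ((0ℤ * (v * v) + v * t) + (v * u + q)) ≡ c + b * v + (s + v * (t + u)) + q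
      l₃ = solve-∀
      l₄ : ∀ b v d e y → (b + v * (d + e)) * y ≡ b * y + v * (d * y + e * y)
      l₄ = solve-∀

  -- Multiplication by `2 * B` clears the denominators of v as a convex combination of the two end
  -- points. These are written `B * 1ℤ` and `B * -1ℤ` to match the vertices `B * sgn S i`.
  affine-min : ∀ B P Q v m → 0ℤ < B → - B ≤ v → v ≤ B →
    m ≤ P + (B * 1ℤ) * Q → m ≤ P + (B * -1ℤ) * Q → m ≤ P + v * Q
  affine-min (+ suc k) P Q v m _ l u p q = ℤ.*-cancelˡ-≤-pos m (P + v * Q) (+ 2 * + suc k)
    (≤-by (e (+ suc k) P Q v m) (0≤+ (0≤* (0≤- l) (0≤- p)) (0≤* (0≤- u) (0≤- q))))
    where
    e : ∀ B P Q v m → + 2 * B * (P + v * Q) - + 2 * B * m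
      ≡ (v - - B) * (P + (B * 1ℤ) * Q - m) + (B - v) * (P + (B * -1ℤ) * Q - m)
    e = solve-∀
  affine-min (+ 0) _ _ _ _ (+<+ ())

  -- A zero diagonal makes the function affine in each coordinate separately, so each coordinate in
  -- turn can be pushed to an end point without raising the value.
  quadratic-box-min : ∀ {n} B c b (a : Fin n → Fin n → ℤ) m → 0ℤ < B → (∀ i → a i i ≡ 0ℤ) →
    (∀ S → m ≤ quadratic c b a (λ i → B * sgn S i)) →
    ∀ x → (∀ i → - B ≤ x i × x i ≤ B) → m ≤ quadratic c b a x
  quadratic-box-min {zero} B c b a m 0<B dg h x box = h []
  quadratic-box-min {suc n} B c b a m 0<B dg h x box =
    subst (m ≤_) (sym (trans (quadratic-restrict c b a (dg zero) x) (restrict-affine c b a (x zero) y)))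
      (affine-min B (restrict c b a 0ℤ y) (slope c b a y) (x zero) m 0<B (proj₁ (box zero)) (proj₂ (box zero))
        (vertex true) (vertex false))
    where
    y = x ∘ suc
    vertex : ∀ s → m ≤ restrict c b a 0ℤ y + (B * (if s then 1ℤ else -1ℤ)) * slope c b a y
    vertex s = subst (m ≤_) (restrict-affine c b a v y)
      (quadratic-box-min B (c + b zero * v) (λ j → b (suc j) + v * (a zero (suc j) + a (suc j) zero))
        (λ i j → a (suc i) (suc j)) m 0<B (dg ∘ suc)
        (λ S → subst (m ≤_) (quadratic-restrict c b a (dg zero) (λ i → B * sgn (s ∷ S) i)) (h (s ∷ S)))
        y (box ∘ suc))
      where v = B * (if s then 1ℤ else -1ℤ)

  -- Counting edges, cuts and triangles

  𝟙 : Bool → ℤ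
  𝟙 b = + b2n b

  𝟙-∧ : ∀ x y → 𝟙 (x ∧ y) ≡ 𝟙 x * 𝟙 y
  𝟙-∧ true true = refl
  𝟙-∧ true false = refl
  𝟙-∧ false true = refl
  𝟙-∧ false false = refl

  𝟙² : ∀ x → 𝟙 x * 𝟙 x ≡ 𝟙 x
  𝟙² true = refl
  𝟙² false = refl

  module _ {n : ℕ} where

    L : Fin n → Fin n → ℤ
    L i j = 𝟙 (i <F j)

    L-< : ∀ i j → toℕ i ℕ.< toℕ j → L i j ≡ 1ℤ
    L-< i j p with toℕ i ℕ.<ᵇ toℕ j | ℕ.<ᵇ-reflects-< (toℕ i) (toℕ j)
    ... | true  | _ = refl
    ... | false | ofⁿ ¬p = contradiction p ¬p

    L-≮ : ∀ i j → ¬ toℕ i ℕ.< toℕ j → L i j ≡ 0ℤ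
    L-≮ i j ¬p with toℕ i ℕ.<ᵇ toℕ j | ℕ.<ᵇ-reflects-< (toℕ i) (toℕ j)
    ... | true  | ofʸ p = contradiction p ¬p
    ... | false | _ = refl

    L-flip : ∀ {i j} → i ≢ j → L j i ≡ 1ℤ - L i j
    L-flip {i} {j} i≢j with ℕ.<-cmp (toℕ i) (toℕ j)
    ... | tri< p _ ¬q rewrite L-< i j p | L-≮ j i ¬q = refl
    ... | tri≈ _ p _ = contradiction (Fin.toℕ-injective p) i≢j
    ... | tri> ¬p _ q rewrite L-≮ i j ¬p | L-< j i q = refl

    -- {i, j, k} is never cyclically ordered.
    L-transitive : ∀ {i j k} → i ≢ k → (L i j - L i k) * (L j k - L i k) ≡ 0ℤ
    L-transitive {i} {j} {k} i≢k with ℕ.<-cmp (toℕ i) (toℕ k) | toℕ i ℕ.<? toℕ j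
    ... | tri≈ _ p _ | _ = contradiction (Fin.toℕ-injective p) i≢k
    ... | tri< p _ _ | yes q = cong (_* (L j k - L i k)) (ℤ.i≡j⇒i-j≡0 (trans (L-< i j q) (sym (L-< i k p))))
    ... | tri< p _ _ | no ¬q = trans (cong ((L i j - L i k) *_) (ℤ.i≡j⇒i-j≡0 (trans (L-< j k (ℕ.≤-<-trans (ℕ.≮⇒≥ ¬q) p)) (sym (L-< i k p)))))
      (ℤ.*-zeroʳ (L i j - L i k))
    ... | tri> ¬p _ p | no ¬q = cong (_* (L j k - L i k)) (ℤ.i≡j⇒i-j≡0 (trans (L-≮ i j ¬q) (sym (L-≮ i k ¬p))))
    ... | tri> ¬p _ p | yes q = trans (cong ((L i j - L i k) *_) (ℤ.i≡j⇒i-j≡0 (trans (L-≮ j k (ℕ.<-asym (ℕ.<-trans p q))) (sym (L-≮ i k ¬p)))))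
      (ℤ.*-zeroʳ (L i j - L i k))

    sum₃ : (Fin n → Fin n → Fin n → ℤ) → ℤ
    sum₃ f = sum (λ i → sum₂ (f i))

    sum₃-cong : ∀ {f g} → (∀ i j k → f i j k ≡ g i j k) → sum₃ f ≡ sum₃ g
    sum₃-cong e = sum-cong-≗ (λ i → sum₂-cong (e i))

    sum₃-+ : ∀ f g → sum₃ (λ i j k → f i j k + g i j k) ≡ sum₃ f + sum₃ g
    sum₃-+ f g = trans (sum-cong-≗ (λ i → sum₂-+ (f i) (g i))) (∑-distrib-+ (λ i → sum₂ (f i)) (λ i → sum₂ (g i)))

    sum₃-swap₁₂ : ∀ f → sum₃ (λ i j k → f j i k) ≡ sum₃ f
    sum₃-swap₁₂ f = ∑-comm (λ i j → sum (f j i))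

    sum₃-swap₂₃ : ∀ f → sum₃ (λ i j k → f i k j) ≡ sum₃ f
    sum₃-swap₂₃ f = sum-cong-≗ (λ i → ∑-comm (λ j k → f i k j))

  module GraphFacts {n : ℕ} (G : Graph n) where

    A : Fin n → Fin n → ℤ
    A i j = 𝟙 (adj G i j)

    A-sym : ∀ i j → A i j ≡ A j i
    A-sym i j = cong 𝟙 (adj-sym G i j)

    A-irrefl : ∀ i → A i i ≡ 0ℤ
    A-irrefl i = cong 𝟙 (irrefl G i)

    form : (Fin n → ℤ) → ℤ
    form x = sum₂ (λ i j → A i j * (x i * x j))

    sum-over-edges : ∀ (f : Fin n → Fin n → ℤ) → (∀ i j → f i j ≡ f j i) →
      sum₂ (λ i j → A i j * f i j) ≡ + 2 * sum₂ (λ i j → L i j * (A i j * f i j))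
    sum-over-edges f f-sym = begin
      sum₂ (λ i j → A i j * f i j)                                       ≡⟨ sum₂-cong pointwise ⟩
      sum₂ (λ i j → g i j + g j i)                                       ≡⟨ sum₂-+ g (λ i j → g j i) ⟩
      sum₂ g + sum₂ (λ i j → g j i)                                      ≡⟨ cong (λ t → sum₂ g + t) (∑-comm (λ i j → g j i)) ⟩
      sum₂ g + sum₂ g                                                    ≡⟨ double (sum₂ g) ⟩
      + 2 * sum₂ g ∎
      where
      open ≡-Reasoning
      g : Fin n → Fin n → ℤ
      g i j = L i j * (A i j * f i j)
      double : ∀ x → x + x ≡ + 2 * x
      double = solve-∀
      ring : ∀ l a f → a * f ≡ l * (a * f) + (1ℤ - l) * (a * f)
      ring = solve-∀
      split : ∀ {l l′ a a′ f f′} → l′ ≡ 1ℤ - l → a′ ≡ a → f′ ≡ f → a * f ≡ l * (a * f) + l′ * (a′ * f′)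
      split {l} {a = a} {f = f} refl refl refl = ring l a f
      vanish : ∀ {l a f} → a ≡ 0ℤ → a * f ≡ l * (a * f) + l * (a * f)
      vanish {l} refl = sym (cong₂ _+_ (ℤ.*-zeroʳ l) (ℤ.*-zeroʳ l))
      pointwise : ∀ i j → A i j * f i j ≡ g i j + g j i
      pointwise i j with i Fin.≟ j
      ... | yes refl = vanish {L i i} {A i i} {f i i} (A-irrefl i)
      ... | no i≢j = split {L i j} {L j i} {A i j} {A j i} {f i j} {f j i} (L-flip i≢j) (A-sym j i) (f-sym j i)

    sum-adj : sum₂ A ≡ + 2 * + edges G
    sum-adj = trans (sum₂-cong (λ i j → sym (ℤ.*-identityʳ (A i j))))
      (trans (sum-over-edges (λ _ _ → 1ℤ) (λ _ _ → refl))
      (cong (+ 2 *_) (trans (sum₂-cong (λ i j → trans (cong (L i j *_) (ℤ.*-identityʳ (A i j))) (sym (𝟙-∧ (i <F j) _))))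
        (sym (Σ[]₂≡sum₂ (λ i j → b2n ((i <F j) ∧ adj G i j)))))))

    form-sgn : ∀ S → form (sgn S) ≡ + 2 * + edges G - + 4 * + cut G S
    form-sgn S = begin
      form (sgn S)
        ≡⟨ sum₂-cong (λ i j → trans (cong (A i j *_) (sgn-xor (lookup S i) (lookup S j))) (expand (A i j) (X i j))) ⟩
      sum₂ (λ i j → 1ℤ * A i j + - (+ 2) * (A i j * X i j))
        ≡⟨ sum₂-linear 1ℤ (- (+ 2)) A (λ i j → A i j * X i j) ⟩
      1ℤ * sum₂ A + - (+ 2) * sum₂ (λ i j → A i j * X i j)
        ≡⟨ cong₂ (λ s t → 1ℤ * s + - (+ 2) * t) sum-adj (trans (sum-over-edges X (λ i j → cong 𝟙 (xor-comm (lookup S i) (lookup S j))))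
             (cong (+ 2 *_) (trans (sum₂-cong (λ i j → sym (trans (𝟙-∧ (i <F j) _) (cong (L i j *_) (𝟙-∧ (adj G i j) _)))))
               (sym (Σ[]₂≡sum₂ (λ i j → b2n ((i <F j) ∧ adj G i j ∧ (lookup S i xor lookup S j)))))))) ⟩
      1ℤ * (+ 2 * + edges G) + - (+ 2) * (+ 2 * + cut G S)
        ≡⟨ collect (+ edges G) (+ cut G S) ⟩
      + 2 * + edges G - + 4 * + cut G S ∎
      where
      open ≡-Reasoning
      X : Fin n → Fin n → ℤ
      X i j = 𝟙 (lookup S i xor lookup S j)
      sgn-xor : ∀ s t → (if s then 1ℤ else -1ℤ) * (if t then 1ℤ else -1ℤ) ≡ 1ℤ - + 2 * 𝟙 (s xor t)
      sgn-xor true true = refl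
      sgn-xor true false = refl
      sgn-xor false true = refl
      sgn-xor false false = refl
      xor-comm : ∀ s t → s xor t ≡ t xor s
      xor-comm true true = refl
      xor-comm true false = refl
      xor-comm false true = refl
      xor-comm false false = refl
      expand : ∀ a x → a * (1ℤ - + 2 * x) ≡ 1ℤ * a + - (+ 2) * (a * x)
      expand = solve-∀
      collect : ∀ e c → 1ℤ * (+ 2 * e) + - (+ 2) * (+ 2 * c) ≡ + 2 * e - + 4 * c
      collect = solve-∀

    six-triangles : sum₃ (λ i j k → A i j * A j k * A i k) ≡ + 6 * + triangles G
    six-triangles = begin
      sum₃ (λ i j k → A i j * A j k * A i k)
        ≡⟨ sum₃-cong pointwise ⟩
      sum₃ (λ i j k → t i j k + (t i k j + (t j i k + (t k i j + (t j k i + t k j i)))))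
        ≡⟨ trans (sum₃-+ t _) (cong (λ s → τ + s) (trans (sum₃-+ t₁ _) (cong (λ s → sum₃ t₁ + s)
             (trans (sum₃-+ t₂ _) (cong (λ s → sum₃ t₂ + s) (trans (sum₃-+ t₃ _) (cong (λ s → sum₃ t₃ + s) (sum₃-+ t₄ t₅)))))))) ⟩
      τ + (sum₃ t₁ + (sum₃ t₂ + (sum₃ t₃ + (sum₃ t₄ + sum₃ t₅))))
        ≡⟨ cong₂ (λ a b → τ + (a + b)) e₁ (cong₂ _+_ e₂ (cong₂ _+_ e₃ (cong₂ _+_ e₄ e₅))) ⟩
      τ + (τ + (τ + (τ + (τ + τ))))
        ≡⟨ six τ ⟩
      + 6 * τ
        ≡⟨ cong (+ 6 *_) (trans (sum₃-cong t-def) (sym (trans (Σ[]≡sum (λ i → Σ[ (λ j → Σ[ T i j ]) ])) (sum-cong-≗ (λ i → Σ[]₂≡sum₂ (T i)))))) ⟩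
      + 6 * + triangles G ∎
      where
      open ≡-Reasoning
      T : Fin n → Fin n → Fin n → ℕ
      T i j k = b2n ((i <F j) ∧ (j <F k) ∧ adj G i j ∧ adj G j k ∧ adj G i k)
      t t₁ t₂ t₃ t₄ t₅ : Fin n → Fin n → Fin n → ℤ
      t i j k = L i j * L j k * (A i j * A j k * A i k)
      t₁ i j k = t i k j
      t₂ i j k = t j i k
      t₃ i j k = t k i j
      t₄ i j k = t j k i
      t₅ i j k = t k j i
      τ = sum₃ t
      e₁ : sum₃ t₁ ≡ τ
      e₁ = sum₃-swap₂₃ t
      e₂ : sum₃ t₂ ≡ τ
      e₂ = sum₃-swap₁₂ t
      e₃ : sum₃ t₃ ≡ τ
      e₃ = trans (sum₃-swap₂₃ (λ i j k → t j i k)) e₂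
      e₄ : sum₃ t₄ ≡ τ
      e₄ = trans (sum₃-swap₁₂ (λ i j k → t i k j)) e₁
      e₅ : sum₃ t₅ ≡ τ
      e₅ = trans (sum₃-swap₁₂ (λ i j k → t k i j)) e₃
      six : ∀ x → x + (x + (x + (x + (x + x)))) ≡ + 6 * x
      six = solve-∀
      t-def : ∀ i j k → t i j k ≡ + T i j k
      t-def i j k = trans (assoc (L i j) (L j k) (A i j) (A j k) (A i k)) (sym
        (trans (𝟙-∧ (i <F j) _) (cong (L i j *_) (trans (𝟙-∧ (j <F k) _) (cong (L j k *_)
          (trans (𝟙-∧ (adj G i j) _) (cong (A i j *_) (𝟙-∧ (adj G j k) (adj G i k)))))))))
        where
        assoc : ∀ a b c d e → a * b * (c * d * e) ≡ a * (b * (c * (d * e)))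
        assoc = solve-∀
      ring : ∀ a b c d e f p q r →
        a * b * (p * q * r) + (c * d * (r * q * p) + (e * c * (p * r * q) + (f * a * (r * p * q) + (b * f * (q * r * p) + d * e * (q * p * r)))))
        ≡ p * q * r * (a * b + c * d + e * c + f * a + b * f + d * e)
      ring = solve-∀
      -- Three distinct vertices are in exactly one of the six orders. With a, b, c for `L i j`,
      -- `L j k`, `L i k`, the indicators of the six orders sum to 1 plus two corrections: the first
      -- vanishes by transitivity, the second because `c * c ≡ c`.
      orders : ∀ a b c →
        a * b + c * (1ℤ - b) + (1ℤ - a) * c + (1ℤ - c) * a + b * (1ℤ - c) + (1ℤ - b) * (1ℤ - a)
        ≡ 1ℤ + + 2 * ((a - c) * (b - c) + (c - c * c))
      orders = solve-∀
      one-order : ∀ {a b c d e f} → d ≡ 1ℤ - b → e ≡ 1ℤ - a → f ≡ 1ℤ - c → (a - c) * (b - c) ≡ 0ℤ → c * c ≡ c →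
        a * b + c * d + e * c + f * a + b * f + d * e ≡ 1ℤ
      one-order {a} {b} {c} refl refl refl p q =
        trans (orders a b c) (cong₂ (λ s t → 1ℤ + + 2 * (s + t)) p (ℤ.i≡j⇒i-j≡0 (sym q)))
      sixfold : ∀ {a b c d e f p q r q′ r′ p′} → q′ ≡ q → r′ ≡ r → p′ ≡ p →
        p * q * r ≡ 0ℤ ⊎ a * b + c * d + e * c + f * a + b * f + d * e ≡ 1ℤ →
        p * q * r ≡ a * b * (p * q * r) + (c * d * (r * q′ * p) + (e * c * (p′ * r * q) + (f * a * (r′ * p * q′) + (b * f * (q * r′ * p′) + d * e * (q′ * p′ * r′)))))
      sixfold {a} {b} {c} {d} {e} {f} {p} {q} {r} refl refl refl (inj₁ z) =
        trans z (sym (trans (ring a b c d e f p q r) (cong (_* (a * b + c * d + e * c + f * a + b * f + d * e)) z)))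
      sixfold {a} {b} {c} {d} {e} {f} {p} {q} {r} refl refl refl (inj₂ o) =
        sym (trans (ring a b c d e f p q r) (trans (cong (p * q * r *_) o) (ℤ.*-identityʳ (p * q * r))))
      zero-or-ordered : ∀ i j k → A i j * A j k * A i k ≡ 0ℤ ⊎
        L i j * L j k + L i k * L k j + L j i * L i k + L k i * L i j + L j k * L k i + L k j * L j i ≡ 1ℤ
      zero-or-ordered i j k with i Fin.≟ j | j Fin.≟ k | i Fin.≟ k
      ... | yes refl | _ | _ = inj₁ (cong (λ z → z * A j k * A i k) (A-irrefl i))
      ... | no _ | yes refl | _ = inj₁ (trans (cong (λ z → A i j * z * A i k) (A-irrefl j)) (cong (_* A i k) (ℤ.*-zeroʳ (A i j))))
      ... | no _ | no _ | yes refl = inj₁ (trans (cong (λ z → A i j * A j k * z) (A-irrefl i)) (ℤ.*-zeroʳ (A i j * A j k)))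
      ... | no i≢j | no j≢k | no i≢k = inj₂ (one-order {L i j} {L j k} {L i k} (L-flip j≢k) (L-flip i≢j) (L-flip i≢k) (L-transitive {i = i} {j} {k} i≢k) (𝟙² (i <F k)))
      pointwise : ∀ i j k → A i j * A j k * A i k ≡ t i j k + (t i k j + (t j i k + (t k i j + (t j k i + t k j i))))
      pointwise i j k = sixfold {L i j} {L j k} {L i k} {L k j} {L j i} {L k i} {A i j} {A j k} {A i k}
        (A-sym k j) (A-sym k i) (A-sym j i) (zero-or-ordered i j k)

  ∈-allSides : ∀ {n} (S : Vec Bool n) → S ∈ allSides n
  ∈-allSides [] = here refl
  ∈-allSides (true ∷ S) = ∈-++⁺ˡ (∈-map⁺ (true ∷_) (∈-allSides S))
  ∈-allSides {suc n} (false ∷ S) = ∈-++⁺ʳ (map (true ∷_) (allSides n)) (∈-map⁺ (false ∷_) (∈-allSides S))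

  foldr-⊔-upper : ∀ {m} {ms : List ℕ} → m ∈ ms → m ℕ.≤ foldr ℕ._⊔_ 0 ms
  foldr-⊔-upper (here refl) = ℕ.m≤m⊔n _ _
  foldr-⊔-upper {ms = k ∷ _} (there m∈) = ℕ.≤-trans (foldr-⊔-upper m∈) (ℕ.m≤n⊔m k _)

  cut≤mc : ∀ {n} (G : Graph n) S → cut G S ℕ.≤ mc G
  cut≤mc G S = foldr-⊔-upper (∈-map⁺ (cut G) (∈-allSides S))

  -- The membership argument of `go` only records that the list of sides is nonempty; over an empty
  -- list the maximum would be the default 0, attained by no cut.
  mc-attained : ∀ {n} (G : Graph n) → ∃[ S ] cut G S ≡ mc G
  mc-attained {n} G = go (allSides n) (∈-allSides (Vec.replicate n true))
    where
    go : ∀ {S₀} Ss → S₀ ∈ Ss → ∃[ S ] cut G S ≡ foldr ℕ._⊔_ 0 (map (cut G) Ss)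
    go (S ∷ []) _ = S , sym (ℕ.⊔-identityʳ (cut G S))
    go (S ∷ S′ ∷ Ss) _ with go (S′ ∷ Ss) (here refl) | ℕ.⊔-sel (cut G S) (foldr ℕ._⊔_ 0 (map (cut G) (S′ ∷ Ss)))
    ... | _ | inj₁ e = S , sym e
    ... | S″ , e′ | inj₂ e = S″ , trans e′ (sym e)

  -- Signed walks in the plane and truncation

  Step : Set
  Step = ℤ × ℤ

  Plane : Set
  Plane = ℤ → ℤ → ℤ

  infix 4 _≗₂_
  _≗₂_ : Plane → Plane → Set
  Φ ≗₂ Ψ = ∀ u v → Φ u v ≡ Ψ u v

  walk : Step → Plane → Plane
  walk (a , b) Φ u v = Φ (u + a) (v + b) + Φ (u - a) (v - b)

  -- The sum of Φ over the end points of all 2^|l| signed walks with steps ± l from the origin.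
  E : List Step → Plane → ℤ
  E [] Φ = Φ 0ℤ 0ℤ
  E (s ∷ l) Φ = E l (walk s Φ)

  E-cong : ∀ l {Φ Ψ} → Φ ≗₂ Ψ → E l Φ ≡ E l Ψ
  E-cong [] e = e 0ℤ 0ℤ
  E-cong ((a , b) ∷ l) e = E-cong l (λ u v → cong₂ _+_ (e (u + a) (v + b)) (e (u - a) (v - b)))

  E-mono : ∀ l {Φ Ψ} → (∀ u v → Φ u v ≤ Ψ u v) → E l Φ ≤ E l Ψ
  E-mono [] e = e 0ℤ 0ℤ
  E-mono ((a , b) ∷ l) e = E-mono l (λ u v → ℤ.+-mono-≤ (e (u + a) (v + b)) (e (u - a) (v - b)))

  E-linear : ∀ l p q Φ Ψ → E l (λ u v → p * Φ u v + q * Ψ u v) ≡ p * E l Φ + q * E l Ψ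
  E-linear [] p q Φ Ψ = refl
  E-linear ((a , b) ∷ l) p q Φ Ψ = trans
    (E-cong l (λ u v → ring p q (Φ (u + a) (v + b)) (Φ (u - a) (v - b)) (Ψ (u + a) (v + b)) (Ψ (u - a) (v - b))))
    (E-linear l p q (walk (a , b) Φ) (walk (a , b) Ψ))
    where
    ring : ∀ p q x y z w → p * x + q * z + (p * y + q * w) ≡ p * (x + y) + q * (z + w)
    ring = solve-∀

  E-const : ∀ l c → E l (λ _ _ → c) ≡ (+ 2) ^ length l * c
  E-const [] c = sym (ℤ.*-identityˡ c)
  E-const (s ∷ l) c = trans (E-const l (c + c)) (ring ((+ 2) ^ length l) c)
    where
    ring : ∀ t c → t * (c + c) ≡ + 2 * t * c
    ring = solve-∀

  -- The operators `walk s` commute. Hence only the multiset of steps matters, and steps may be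
  -- brought to the front where they are to be modified.
  E-↭ : ∀ {l l′} → l ↭ l′ → ∀ Φ → E l Φ ≡ E l′ Φ
  E-↭ Perm.refl Φ = refl
  E-↭ (prep s p) Φ = E-↭ p (walk s Φ)
  E-↭ {_ ∷ _ ∷ l} (swap (a , b) (c , d) p) Φ = trans (E-cong l commute) (E-↭ p (walk (a , b) (walk (c , d) Φ)))
    where
    pp : ∀ u a c → u + c + a ≡ u + a + c
    pp = solve-∀
    mp : ∀ u a c → u - c + a ≡ u + a - c
    mp = solve-∀
    pm : ∀ u a c → u + c - a ≡ u - a + c
    pm = solve-∀
    mm : ∀ u a c → u - c - a ≡ u - a - c
    mm = solve-∀
    interchange : ∀ x y z w → x + y + (z + w) ≡ x + z + (y + w)
    interchange = solve-∀
    commute : walk (c , d) (walk (a , b) Φ) ≗₂ walk (a , b) (walk (c , d) Φ)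
    commute u v = trans
      (cong₂ _+_ (cong₂ _+_ (cong₂ Φ (pp u a c) (pp v b d)) (cong₂ Φ (pm u a c) (pm v b d)))
                 (cong₂ _+_ (cong₂ Φ (mp u a c) (mp v b d)) (cong₂ Φ (mm u a c) (mm v b d))))
      (interchange (Φ (u + a + c) (v + b + d)) (Φ (u - a + c) (v - b + d)) (Φ (u + a - c) (v + b - d)) (Φ (u - a - c) (v - b - d)))
  E-↭ (Perm.trans p q) Φ = trans (E-↭ p Φ) (E-↭ q Φ)

  -- `E` is not normalised, so an idle step is not neutral: it doubles the number of walks. Idle
  -- steps are what makes walks of different lengths comparable.
  E-zero : ∀ l Φ → E ((0ℤ , 0ℤ) ∷ l) Φ ≡ + 2 * E l Φ
  E-zero l Φ = trans (E-cong l (λ u v → trans (cong₂ _+_ (cong₂ Φ (ℤ.+-identityʳ u) (ℤ.+-identityʳ v)) (cong₂ Φ (ℤ.+-identityʳ u) (ℤ.+-identityʳ v)))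
      (ring (Φ u v)))) (trans (E-linear l (+ 2) 0ℤ Φ Φ) (ℤ.+-identityʳ (+ 2 * E l Φ)))
    where
    ring : ∀ x → x + x ≡ + 2 * x + 0ℤ * x
    ring = solve-∀

  -- The variance of the linear functional with coefficients p and q at the end of the walk; (1, 0)
  -- and (0, 1) give the variances of the two coordinates.
  energy : ℤ → ℤ → List Step → ℤ
  energy p q [] = 0ℤ
  energy p q ((a , b) ∷ l) = (p * a + q * b) * (p * a + q * b) + energy p q l

  square : ℤ → ℤ → Plane
  square p q u v = (p * u + q * v) * (p * u + q * v)

  E-square : ∀ p q l → E l (square p q) ≡ (+ 2) ^ length l * energy p q l
  E-square p q [] = ring p q
    where
    ring : ∀ p q → (p * 0ℤ + q * 0ℤ) * (p * 0ℤ + q * 0ℤ) ≡ 0ℤ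
    ring = solve-∀
  E-square p q ((a , b) ∷ l) = trans (E-cong l (λ u v → ring p q a b u v))
    (trans (E-linear l (+ 2) (+ 2) (square p q) (λ _ _ → s))
    (trans (cong₂ (λ x y → + 2 * x + + 2 * y) (E-square p q l) (E-const l s)) (collect ((+ 2) ^ length l) (energy p q l) s)))
    where
    s = (p * a + q * b) * (p * a + q * b)
    ring : ∀ p q a b u v →
      (p * (u + a) + q * (v + b)) * (p * (u + a) + q * (v + b)) + (p * (u - a) + q * (v - b)) * (p * (u - a) + q * (v - b))
      ≡ + 2 * ((p * u + q * v) * (p * u + q * v)) + + 2 * ((p * a + q * b) * (p * a + q * b))
    ring = solve-∀
    collect : ∀ t e s → + 2 * (t * e) + + 2 * (t * s) ≡ + 2 * t * (s + e)
    collect = solve-∀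

  clip : ℤ → ℤ → ℤ
  clip R y with y ℤ.≤? - R | R ℤ.≤? y
  ... | yes _ | _     = - R
  ... | no _  | yes _ = R
  ... | no _  | no _  = y

  data Clipped (R y : ℤ) : ℤ → Set where
    low  : y ≤ - R → Clipped R y (- R)
    high : R ≤ y → Clipped R y R
    mid  : - R ≤ y → y ≤ R → Clipped R y y

  clipped : ∀ R y → Clipped R y (clip R y)
  clipped R y with y ℤ.≤? - R | R ℤ.≤? y
  ... | yes p | _     = low p
  ... | no _  | yes q = high q
  ... | no p  | no q  = mid (ℤ.<⇒≤ (ℤ.≰⇒> p)) (ℤ.<⇒≤ (ℤ.≰⇒> q))

  module _ {R : ℤ} (0≤R : 0ℤ ≤ R) where

    private
      -R≤R : - R ≤ R
      -R≤R = ≤-by (ring R) (0≤+ 0≤R 0≤R)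
        where
        ring : ∀ R → R - - R ≡ R + R
        ring = solve-∀

    clip-bounds : ∀ y → - R ≤ clip R y × clip R y ≤ R
    clip-bounds y with clip R y | clipped R y
    ... | _ | low _   = ℤ.≤-refl , -R≤R
    ... | _ | high _  = -R≤R , ℤ.≤-refl
    ... | _ | mid p q = p , q

    clipped-mono : ∀ {x y s t} → x ≤ y → Clipped R x s → Clipped R y t → s ≤ t
    clipped-mono x≤y (low _)   (low _)   = ℤ.≤-refl
    clipped-mono x≤y (low _)   (high _)  = -R≤R
    clipped-mono x≤y (low _)   (mid q _) = q
    clipped-mono x≤y (high p)  (low q)   = ℤ.≤-trans p (ℤ.≤-trans x≤y q)
    clipped-mono x≤y (high _)  (high _)  = ℤ.≤-refl
    clipped-mono x≤y (high p)  (mid _ _) = ℤ.≤-trans p x≤y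
    clipped-mono x≤y (mid _ _) (low q)   = ℤ.≤-trans x≤y q
    clipped-mono x≤y (mid _ p) (high _)  = p
    clipped-mono x≤y (mid _ _) (mid _ _) = x≤y

    clipped-contracts : ∀ {x y s t} → x ≤ y → Clipped R x s → Clipped R y t → t - s ≤ y - x
    clipped-contracts x≤y (low _)   (low _)   = subst (_≤ _) (sym (ℤ.+-inverseʳ (- R))) (0≤- x≤y)
    clipped-contracts x≤y (low p)   (high q)  = ℤ.+-mono-≤ q (ℤ.neg-mono-≤ p)
    clipped-contracts {y = y} x≤y (low p)   (mid _ _) = ℤ.+-monoʳ-≤ y (ℤ.neg-mono-≤ p)
    clipped-contracts x≤y (high p)  (low q)   = ℤ.≤-trans (ℤ.+-mono-≤ -R≤R (ℤ.≤-refl {x = - R}))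
      (subst (_≤ _) (sym (ℤ.+-inverseʳ R)) (0≤- x≤y))
    clipped-contracts x≤y (high _)  (high _)  = subst (_≤ _) (sym (ℤ.+-inverseʳ R)) (0≤- x≤y)
    clipped-contracts {y = y} x≤y (high _)  (mid _ q) = ℤ.+-monoʳ-≤ y (ℤ.neg-mono-≤ (ℤ.≤-trans x≤y q))
    clipped-contracts {x} x≤y (mid p _) (low q)   = ℤ.+-monoˡ-≤ (- x) (ℤ.≤-trans p x≤y)
    clipped-contracts {x} x≤y (mid _ _) (high q)  = ℤ.+-monoˡ-≤ (- x) q
    clipped-contracts x≤y (mid _ _) (mid _ _) = ℤ.≤-refl

    -- The deterministic half of Chebyshev's inequality: whatever truncation changes can be charged
    -- to a square, and `E-square` knows the mean of squares.
    unclipped-or-large : ∀ {x s} → Clipped R x s → s ≡ x ⊎ R * R ≤ x * x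
    unclipped-or-large {x} (low p)  = inj₂ (≤-by (ring R x) (0≤+ (0≤² (- R - x)) (0≤* (0≤+ 0≤R 0≤R) (0≤- p))))
      where
      ring : ∀ R x → x * x - R * R ≡ (- R - x) * (- R - x) + (R + R) * (- R - x)
      ring = solve-∀
    unclipped-or-large {x} (high p) = inj₂ (≤-by (ring R x) (0≤+ (0≤² (x - R)) (0≤* (0≤+ 0≤R 0≤R) (0≤- p))))
      where
      ring : ∀ R x → x * x - R * R ≡ (x - R) * (x - R) + (R + R) * (x - R)
      ring = solve-∀
    unclipped-or-large (mid _ _) = inj₁ refl

    Δ : ℤ → ℤ → ℤ
    Δ a u = clip R (u + a) - clip R (u - a)

    module _ {a : ℤ} (0≤a : 0ℤ ≤ a) (u : ℤ) where

      private
        u-a≤u+a : u - a ≤ u + a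
        u-a≤u+a = ≤-by (ring u a) (0≤+ 0≤a 0≤a)
          where
          ring : ∀ u a → u + a - (u - a) ≡ a + a
          ring = solve-∀

        width : u + a - (u - a) ≡ + 2 * a
        width = ring u a
          where
          ring : ∀ u a → u + a - (u - a) ≡ + 2 * a
          ring = solve-∀

      0≤Δ : 0ℤ ≤ Δ a u
      0≤Δ = 0≤- (clipped-mono u-a≤u+a (clipped R (u - a)) (clipped R (u + a)))

      Δ≤ : Δ a u ≤ + 2 * a
      Δ≤ = subst (Δ a u ≤_) width (clipped-contracts u-a≤u+a (clipped R (u - a)) (clipped R (u + a)))

      private
        large : R * R ≤ (u + a) * (u + a) + (u - a) * (u - a) →
          R * R * (+ 2 * a - Δ a u) ≤ + 2 * a * ((u + a) * (u + a) + (u - a) * (u - a))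
        large h = ≤-by (ring (R * R) (+ 2 * a) (Δ a u) ((u + a) * (u + a) + (u - a) * (u - a)))
          (0≤+ (0≤* (0≤* {+ 2} 0≤n 0≤a) (0≤- h)) (0≤* (0≤² R) 0≤Δ))
          where
          ring : ∀ r b d e → b * e - r * (b - d) ≡ b * (e - r) + r * d
          ring = solve-∀

      -- Without truncation the increment is exactly `2 * a`. If truncation acts at one of the two
      -- ends, the square of that end is at least `R * R`, and the defect is at most `2 * a` because
      -- `Δ` is nonnegative.
      Δ-defect : R * R * (+ 2 * a - Δ a u) ≤ + 2 * a * ((u + a) * (u + a) + (u - a) * (u - a))
      Δ-defect with unclipped-or-large (clipped R (u - a)) | unclipped-or-large (clipped R (u + a))
      ... | inj₁ p | inj₁ q = subst (_≤ _) (sym (trans (cong (λ t → R * R * (+ 2 * a - t)) (trans (cong₂ _-_ q p) width))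
        (trans (cong (R * R *_) (ℤ.+-inverseʳ (+ 2 * a))) (ℤ.*-zeroʳ (R * R)))))
        (0≤* (0≤* {+ 2} 0≤n 0≤a) (0≤+ (0≤² (u + a)) (0≤² (u - a))))
      ... | inj₂ p | _      = large (ℤ.≤-trans p (ℤ.≤-trans (ℤ.≤-reflexive (sym (ℤ.+-identityˡ _))) (ℤ.+-monoˡ-≤ ((u - a) * (u - a)) (0≤² (u + a)))))
      ... | inj₁ _ | inj₂ q = large (ℤ.≤-trans q (ℤ.≤-trans (ℤ.≤-reflexive (sym (ℤ.+-identityʳ _))) (ℤ.+-monoʳ-≤ ((u + a) * (u + a)) (0≤² (u - a)))))

  *-cancelˡ-≤ : ∀ {a b} c → 0ℤ < c → c * a ≤ c * b → a ≤ b
  *-cancelˡ-≤ {a} {b} c 0<c = ℤ.*-cancelˡ-≤-pos a b c {{ℤ.positive 0<c}}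

  E-+ : ∀ l Φ Ψ → E l (λ u v → Φ u v + Ψ u v) ≡ E l Φ + E l Ψ
  E-+ l Φ Ψ = trans (E-cong l (λ u v → ring (Φ u v) (Ψ u v))) (trans (E-linear l 1ℤ 1ℤ Φ Ψ) (sym (ring (E l Φ) (E l Ψ))))
    where
    ring : ∀ x y → x + y ≡ 1ℤ * x + 1ℤ * y
    ring = solve-∀

  E-*ˡ : ∀ l c Φ → E l (λ u v → c * Φ u v) ≡ c * E l Φ
  E-*ˡ l c Φ = trans (E-cong l (λ u v → ring c (Φ u v))) (trans (E-linear l c 0ℤ Φ Φ) (sym (ring c (E l Φ))))
    where
    ring : ∀ c x → c * x ≡ c * x + 0ℤ * x
    ring = solve-∀

  0≤2^ : ∀ k → 0ℤ ≤ (+ 2) ^ k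
  0≤2^ zero = 0≤n
  0≤2^ (suc k) = 0≤* {+ 2} 0≤n (0≤2^ k)

  0<* : ∀ {x y} → 0ℤ < x → 0ℤ < y → 0ℤ < x * y
  0<* {+ suc x} {+ suc y} _ _ = +<+ (s≤s z≤n)
  0<* {+ 0} (+<+ ())
  0<* {+ suc _} {+ 0} _ (+<+ ())

  0<2^ : ∀ k → 0ℤ < (+ 2) ^ k
  0<2^ zero = +<+ (s≤s z≤n)
  0<2^ (suc k) = 0<* {+ 2} (+<+ (s≤s z≤n)) (0<2^ k)

  -- Correlation of truncated coordinates when a step is decoupled

  module Correlation {R : ℤ} (0≤R : 0ℤ ≤ R) where

    clip² : Plane
    clip² u v = clip R u * clip R v

    gap : List Step → ℤ → ℤ → ℤ
    gap l a b = E l (λ u v → Δ 0≤R a u * Δ 0≤R b v)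

    -- Writing p, m and p′, m′ for the truncated values at the two ends of the step in each
    -- coordinate, this is `2(pp′ + mm′) = (p + m)(p′ + m′) + (p - m)(p′ - m′)`. The factor 2 on the
    -- left makes up for the extra step on the right.
    decouple : ∀ a b l → + 2 * E ((a , b) ∷ l) clip² ≡ E ((a , 0ℤ) ∷ (0ℤ , b) ∷ l) clip² + gap l a b
    decouple a b l = trans (sym (E-*ˡ l (+ 2) (walk (a , b) clip²))) (trans (E-cong l pointwise)
        (E-+ l (walk (0ℤ , b) (walk (a , 0ℤ) clip²)) (λ u v → Δ 0≤R a u * Δ 0≤R b v)))
      where
      r₁ : ∀ u a → u + a ≡ u + 0ℤ + a
      r₁ = solve-∀
      r₂ : ∀ u a → u - a ≡ u + 0ℤ - a
      r₂ = solve-∀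
      r₃ : ∀ u a → u + a ≡ u - 0ℤ + a
      r₃ = solve-∀
      r₄ : ∀ u a → u - a ≡ u - 0ℤ - a
      r₄ = solve-∀
      r₅ : ∀ x → x ≡ x + 0ℤ
      r₅ = solve-∀
      r₆ : ∀ x → x ≡ x - 0ℤ
      r₆ = solve-∀
      ring : ∀ p m p′ m′ → + 2 * (p * p′ + m * m′) ≡ p * p′ + m * p′ + (p * m′ + m * m′) + (p - m) * (p′ - m′)
      ring = solve-∀
      pointwise : ∀ u v → + 2 * walk (a , b) clip² u v ≡ walk (0ℤ , b) (walk (a , 0ℤ) clip²) u v + Δ 0≤R a u * Δ 0≤R b v
      pointwise u v = trans (ring (clip R (u + a)) (clip R (u - a)) (clip R (v + b)) (clip R (v - b)))
        (cong (_+ Δ 0≤R a u * Δ 0≤R b v)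
          (cong₂ _+_ (cong₂ _+_ (cong₂ clip² (r₁ u a) (r₅ (v + b))) (cong₂ clip² (r₂ u a) (r₆ (v + b))))
                     (cong₂ _+_ (cong₂ clip² (r₃ u a) (r₅ (v - b))) (cong₂ clip² (r₄ u a) (r₆ (v - b))))))

    Δ-neg : ∀ a u → Δ 0≤R (- a) u ≡ - Δ 0≤R a u
    Δ-neg a u = trans (cong (λ t → clip R (u - a) - clip R (u + t)) (ℤ.neg-involutive a)) (ring (clip R (u - a)) (clip R (u + a)))
      where
      ring : ∀ x y → x - y ≡ - (y - x)
      ring = solve-∀

    -- The diagonal entries of A - αI are negative. Oddness in each step length reduces them to the
    -- nonnegative lengths for which `gap` is estimated.
    gap-negˡ : ∀ l a b → gap l (- a) b ≡ - gap l a b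
    gap-negˡ l a b = trans (E-cong l (λ u v → trans (cong (_* Δ 0≤R b v) (Δ-neg a u)) (ring (Δ 0≤R a u) (Δ 0≤R b v))))
        (trans (E-*ˡ l -1ℤ (λ u v → Δ 0≤R a u * Δ 0≤R b v)) (ℤ.-1*i≡-i (gap l a b)))
      where
      ring : ∀ x y → - x * y ≡ -1ℤ * (x * y)
      ring = solve-∀

    gap-negʳ : ∀ l a b → gap l a (- b) ≡ - gap l a b
    gap-negʳ l a b = trans (E-cong l (λ u v → trans (cong (Δ 0≤R a u *_) (Δ-neg b v)) (ring (Δ 0≤R a u) (Δ 0≤R b v))))
        (trans (E-*ˡ l -1ℤ (λ u v → Δ 0≤R a u * Δ 0≤R b v)) (ℤ.-1*i≡-i (gap l a b)))
      where
      ring : ∀ x y → x * - y ≡ -1ℤ * (x * y)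
      ring = solve-∀

    module _ (l : List Step) {a b : ℤ} (0≤a : 0ℤ ≤ a) (0≤b : 0ℤ ≤ b) where

      gap-upper : gap l a b ≤ (+ 2) ^ length l * (+ 4 * (a * b))
      gap-upper = subst (gap l a b ≤_) (E-const l (+ 4 * (a * b))) (E-mono l (λ u v →
        ≤-by (ring a b (Δ 0≤R a u) (Δ 0≤R b v))
          (0≤+ (0≤* (0≤- (Δ≤ 0≤R 0≤a u)) (0≤* {+ 2} 0≤n 0≤b)) (0≤* (0≤Δ 0≤R 0≤a u) (0≤- (Δ≤ 0≤R 0≤b v))))))
        where
        ring : ∀ a b x y → + 4 * (a * b) - x * y ≡ (+ 2 * a - x) * (+ 2 * b) + x * (+ 2 * b - y)
        ring = solve-∀

      -- The slope of clip is 1 except where |u| or |v| exceeds R, which Chebyshev's inequality makes unlikely.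
      gap-lower : 0ℤ < R → + 16 * (a * a + energy 1ℤ 0ℤ l) ≤ R * R → + 16 * (b * b + energy 0ℤ 1ℤ l) ≤ R * R →
        (+ 2) ^ length l * (+ 3 * (a * b)) ≤ gap l a b
      gap-lower 0<R small₁ small₂ = *-cancelˡ-≤ (+ 2 * (R * R)) 0<2R²
        -- Per walk, the error `8ab(V₁ + V₂)` is at most `ab R²` since V₁ and V₂ are at most R²/16.
        -- This is a quarter of the main term `4ab R²`, which leaves the constant 3.
        (≤-by (ring₁ (R * R) (gap l a b) a b t V₁ V₂)
          (0≤+ (0≤* {+ 2} 0≤n (0≤- chebyshev)) (0≤* (0≤* (0≤2^ (length l)) (0≤* 0≤a 0≤b)) (0≤+ (0≤- small₁) (0≤- small₂)))))
        where
        t = (+ 2) ^ length l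
        V₁ = a * a + energy 1ℤ 0ℤ l
        V₂ = b * b + energy 0ℤ 1ℤ l
        0<2R² : 0ℤ < + 2 * (R * R)
        0<2R² = positive-product R 0<R
          where
          positive-product : ∀ r → 0ℤ < r → 0ℤ < + 2 * (r * r)
          positive-product (+ suc k) _ = +<+ (s≤s z≤n)
          positive-product (+ 0) (+<+ ())
        s₁ s₂ : Plane
        s₁ = walk (a , b) (square 1ℤ 0ℤ)
        s₂ = walk (a , b) (square 0ℤ 1ℤ)
        lower upper : Plane
        -- For x ≤ 2a and y ≤ 2b, `(2a - x)(2b - y) ≥ 0` gives `xy ≥ 4ab - 2b(2a - x) - 2a(2b - y)`,
        -- and `Δ-defect` bounds each of the two defects by the squares at the two ends of the step.
        lower u v = 1ℤ * (+ 4 * (a * b) * (R * R)) + - (+ 4 * (a * b)) * (s₁ u v + s₂ u v)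
        upper u v = R * R * (Δ 0≤R a u * Δ 0≤R b v)
        ring₁ : ∀ ρ g a b t V₁ V₂ → + 2 * ρ * g - + 2 * ρ * (t * (+ 3 * (a * b)))
          ≡ + 2 * (ρ * g - (1ℤ * (t * (+ 4 * (a * b) * ρ)) + - (+ 4 * (a * b)) * (+ 2 * t * V₁ + + 2 * t * V₂)))
            + t * (a * b) * ((ρ - + 16 * V₁) + (ρ - + 16 * V₂))
        ring₁ = solve-∀
        ring₂ : ∀ ρ a b u v x y → ρ * (x * y) - (1ℤ * (+ 4 * (a * b) * ρ) + - (+ 4 * (a * b)) *
            (((1ℤ * (u + a) + 0ℤ * (v + b)) * (1ℤ * (u + a) + 0ℤ * (v + b)) + (1ℤ * (u - a) + 0ℤ * (v - b)) * (1ℤ * (u - a) + 0ℤ * (v - b)))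
            + ((0ℤ * (u + a) + 1ℤ * (v + b)) * (0ℤ * (u + a) + 1ℤ * (v + b)) + (0ℤ * (u - a) + 1ℤ * (v - b)) * (0ℤ * (u - a) + 1ℤ * (v - b)))))
          ≡ + 2 * b * (+ 2 * a * ((u + a) * (u + a) + (u - a) * (u - a)) - ρ * (+ 2 * a - x))
            + (+ 2 * a * (+ 2 * b * ((v + b) * (v + b) + (v - b) * (v - b)) - ρ * (+ 2 * b - y))
            + ρ * ((+ 2 * a - x) * (+ 2 * b - y)))
        ring₂ = solve-∀
        pointwise : ∀ u v → lower u v ≤ upper u v
        pointwise u v = ≤-by (ring₂ (R * R) a b u v (Δ 0≤R a u) (Δ 0≤R b v))
          (0≤+ (0≤* (0≤* {+ 2} 0≤n 0≤b) (0≤- (Δ-defect 0≤R 0≤a u)))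
          (0≤+ (0≤* (0≤* {+ 2} 0≤n 0≤a) (0≤- (Δ-defect 0≤R 0≤b v)))
               (0≤* (0≤² R) (0≤* (0≤- (Δ≤ 0≤R 0≤a u)) (0≤- (Δ≤ 0≤R 0≤b v))))))
        V₁-eq : energy 1ℤ 0ℤ ((a , b) ∷ l) ≡ V₁
        V₁-eq = cong (_+ energy 1ℤ 0ℤ l) (ring a b)
          where
          ring : ∀ a b → (1ℤ * a + 0ℤ * b) * (1ℤ * a + 0ℤ * b) ≡ a * a
          ring = solve-∀
        V₂-eq : energy 0ℤ 1ℤ ((a , b) ∷ l) ≡ V₂
        V₂-eq = cong (_+ energy 0ℤ 1ℤ l) (ring a b)
          where
          ring : ∀ a b → (0ℤ * a + 1ℤ * b) * (0ℤ * a + 1ℤ * b) ≡ b * b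
          ring = solve-∀
        E-lower : E l lower ≡ 1ℤ * (t * (+ 4 * (a * b) * (R * R))) + - (+ 4 * (a * b)) * (+ 2 * t * V₁ + + 2 * t * V₂)
        E-lower = trans (E-linear l 1ℤ (- (+ 4 * (a * b))) (λ _ _ → + 4 * (a * b) * (R * R)) (λ u v → s₁ u v + s₂ u v))
          (cong₂ (λ x y → 1ℤ * x + - (+ 4 * (a * b)) * y) (E-const l _)
            (trans (E-+ l s₁ s₂) (cong₂ _+_ (trans (E-square 1ℤ 0ℤ ((a , b) ∷ l)) (cong (+ 2 * t *_) V₁-eq))
                                            (trans (E-square 0ℤ 1ℤ ((a , b) ∷ l)) (cong (+ 2 * t *_) V₂-eq)))))
        chebyshev : 1ℤ * (t * (+ 4 * (a * b) * (R * R))) + - (+ 4 * (a * b)) * (+ 2 * t * V₁ + + 2 * t * V₂) ≤ R * R * gap l a b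
        chebyshev = subst₂ _≤_ E-lower (E-*ˡ l (R * R) (λ u v → Δ 0≤R a u * Δ 0≤R b v)) (E-mono l pointwise)

  -- Walks of pairs of vertices in sorted form

  both first second neither : Step
  both = 1ℤ , 1ℤ
  first = 1ℤ , 0ℤ
  second = 0ℤ , 1ℤ
  neither = 0ℤ , 0ℤ

  -- One step per vertex outside the pair: p common neighbours, q and r private neighbours of the
  -- two vertices, z vertices adjacent to neither.
  steps : (p q r z : ℕ) → List Step
  steps p q r z = replicate p both ++ replicate q first ++ replicate r second ++ replicate z neither

  steps-first : ∀ p q r z → steps p (suc q) r z ↭ first ∷ steps p q r z
  steps-first p q r z = shift first (replicate p both) _

  steps-second : ∀ p q r z → steps p q (suc r) z ↭ second ∷ steps p q r z
  steps-second p q r z = Perm.↭-trans (++⁺ˡ (replicate p both) (shift second (replicate q first) _)) (shift second (replicate p both) _)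

  steps-neither : ∀ p q r z → steps p q r (suc z) ↭ neither ∷ steps p q r z
  steps-neither p q r z = Perm.↭-trans
    (++⁺ˡ (replicate p both) (Perm.↭-trans (++⁺ˡ (replicate q first) (shift neither (replicate r second) _)) (shift neither (replicate q first) _)))
    (shift neither (replicate p both) _)

  length-steps : ∀ p q r z → length (steps p q r z) ≡ p ℕ.+ (q ℕ.+ (r ℕ.+ z))
  length-steps p q r z = trans (length-++ (replicate p both)) (cong₂ ℕ._+_ (length-replicate p)
    (trans (length-++ (replicate q first)) (cong₂ ℕ._+_ (length-replicate q)
    (trans (length-++ (replicate r second)) (cong₂ ℕ._+_ (length-replicate r) (length-replicate z))))))

  energy-replicate : ∀ x y k a b l →
    energy x y (replicate k (a , b) ++ l) ≡ + k * ((x * a + y * b) * (x * a + y * b)) + energy x y l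
  energy-replicate x y zero a b l = sym (trans (cong (_+ energy x y l) (ℤ.*-zeroˡ ((x * a + y * b) * (x * a + y * b)))) (ℤ.+-identityˡ _))
  energy-replicate x y (suc k) a b l = trans (cong (λ t → s + t) (energy-replicate x y k a b l)) (ring (+ k) s (energy x y l))
    where
    s = (x * a + y * b) * (x * a + y * b)
    ring : ∀ k s e → s + (k * s + e) ≡ (1ℤ + k) * s + e
    ring = solve-∀

  energy-steps : ∀ x y p q r z → energy x y (steps p q r z) ≡ + p * ((x + y) * (x + y)) + + q * (x * x) + + r * (y * y)
  energy-steps x y p q r z = trans (energy-replicate x y p 1ℤ 1ℤ _) (trans (cong (λ t → + p * s₁ + t)
    (trans (energy-replicate x y q 1ℤ 0ℤ _) (cong (λ t → + q * s₂ + t)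
    (trans (energy-replicate x y r 0ℤ 1ℤ _) (cong (λ t → + r * s₃ + t) (trans (cong (energy x y) (sym (++-identityʳ (replicate z neither))))
       (energy-replicate x y z 0ℤ 0ℤ [])))))))
    (ring (+ p) (+ q) (+ r) (+ z) x y))
    where
    s₁ = (x * 1ℤ + y * 1ℤ) * (x * 1ℤ + y * 1ℤ)
    s₂ = (x * 1ℤ + y * 0ℤ) * (x * 1ℤ + y * 0ℤ)
    s₃ = (x * 0ℤ + y * 1ℤ) * (x * 0ℤ + y * 1ℤ)
    ring : ∀ p q r z x y → p * ((x * 1ℤ + y * 1ℤ) * (x * 1ℤ + y * 1ℤ)) + (q * ((x * 1ℤ + y * 0ℤ) * (x * 1ℤ + y * 0ℤ))
      + (r * ((x * 0ℤ + y * 1ℤ) * (x * 0ℤ + y * 1ℤ)) + (z * ((x * 0ℤ + y * 0ℤ) * (x * 0ℤ + y * 0ℤ)) + 0ℤ)))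
      ≡ p * ((x + y) * (x + y)) + q * (x * x) + r * (y * y)
    ring = solve-∀

  -- Comparison of the walk of an edge with the walk of a non-edge

  module Comparison (α d : ℕ) {R : ℤ} (0<R : 0ℤ < R) (wide : + 16 * (+ α * + α + + d) ≤ R * R) where

    open Correlation (ℤ.<⇒≤ 0<R)

    private
      a : ℤ
      a = + α

    κ : List Step → ℤ
    κ l = E l clip²

    -- The two leading steps are those of the signs at the two vertices themselves: each vertex has
    -- the diagonal entry -α in its own row and the adjacency entry in the row of the other.
    adjacent nonadjacent : (p q z : ℕ) → List Step
    adjacent p q z = (- a , 1ℤ) ∷ (1ℤ , - a) ∷ steps p q q z
    nonadjacent p q z = (- a , 0ℤ) ∷ (0ℤ , - a) ∷ steps p q q z

    length-nonadjacent : ∀ p q z → length (nonadjacent p q z) ≡ 2 ℕ.+ (p ℕ.+ (q ℕ.+ (q ℕ.+ z)))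
    length-nonadjacent p q z = cong (2 ℕ.+_) (length-steps p q q z)

    -- A common neighbour and a vertex adjacent to neither are traded for one private neighbour on
    -- each side. This preserves the number of vertices and both degrees, so it is the elementary
    -- move between pairs with different numbers of common neighbours.
    exchange : ∀ p q z → κ (nonadjacent (suc p) q (suc z)) ≡ κ (nonadjacent p (suc q) z) + gap (nonadjacent p q z) 1ℤ 1ℤ
    exchange p q z = begin
      κ (nonadjacent (suc p) q (suc z))                                   ≡⟨ E-↭ rearrange clip² ⟩
      κ (neither ∷ both ∷ nonadjacent p q z)                              ≡⟨ E-zero (both ∷ nonadjacent p q z) clip² ⟩
      + 2 * κ (both ∷ nonadjacent p q z)                                  ≡⟨ decouple 1ℤ 1ℤ (nonadjacent p q z) ⟩
      κ (first ∷ second ∷ nonadjacent p q z) + gap (nonadjacent p q z) 1ℤ 1ℤ ≡⟨ cong (_+ gap (nonadjacent p q z) 1ℤ 1ℤ) (E-↭ rearrange′ clip²) ⟨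
      κ (nonadjacent p (suc q) z) + gap (nonadjacent p q z) 1ℤ 1ℤ ∎
      where
      open ≡-Reasoning
      pull : ∀ {s t X Y} → X ↭ s ∷ t ∷ Y → (- a , 0ℤ) ∷ (0ℤ , - a) ∷ X ↭ s ∷ t ∷ (- a , 0ℤ) ∷ (0ℤ , - a) ∷ Y
      pull {s} {t} e = Perm.↭-trans (prep _ (prep _ e)) (shifts ((- a , 0ℤ) ∷ (0ℤ , - a) ∷ []) (s ∷ t ∷ []))
      rearrange : nonadjacent (suc p) q (suc z) ↭ neither ∷ both ∷ nonadjacent p q z
      rearrange = pull (Perm.↭-trans (prep both (steps-neither p q q z)) (swap both neither Perm.refl))
      rearrange′ : nonadjacent p (suc q) z ↭ first ∷ second ∷ nonadjacent p q z
      rearrange′ = pull (Perm.↭-trans (steps-first p q (suc q) z) (prep first (steps-second p q q z)))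

    -- Each exchange contributes one `gap` with both step lengths 1, hence between 3 and 4 times
    -- `2 ^ M`. Here M is two less than the length of the walk, since the two exchanged steps are
    -- set aside in a gap. Degrees are preserved, so `wide` controls the variances at every stage.
    exchange-many : ∀ M p q z k → p ℕ.+ k ℕ.+ q ≡ d → 2 ℕ.+ M ≡ 2 ℕ.+ (p ℕ.+ (q ℕ.+ (q ℕ.+ z))) ℕ.+ (k ℕ.+ k) →
      κ (nonadjacent p (k ℕ.+ q) z) + (+ 2) ^ M * (+ 3 * + k) ≤ κ (nonadjacent (k ℕ.+ p) q (k ℕ.+ z))
      × κ (nonadjacent (k ℕ.+ p) q (k ℕ.+ z)) ≤ κ (nonadjacent p (k ℕ.+ q) z) + (+ 2) ^ M * (+ 4 * + k)
    exchange-many M p q z zero _ _ =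
        ℤ.≤-reflexive (ring (κ (nonadjacent p q z)) ((+ 2) ^ M) (+ 3))
      , ℤ.≤-reflexive (sym (ring (κ (nonadjacent p q z)) ((+ 2) ^ M) (+ 4)))
      where
      ring : ∀ x t c → x + t * (c * 0ℤ) ≡ x
      ring = solve-∀
    exchange-many M p q z (suc k) d≡ M≡ =
        subst₂ _≤_ (cong (λ m → κ (nonadjacent p m z) + (+ 2) ^ M * (+ 3 * + suc k)) (ℕ.+-suc k q)) (sym swapped)
          (≤-by (ring₁ (κ (nonadjacent p (k ℕ.+ suc q) z)) (κ (nonadjacent (k ℕ.+ p) (suc q) (k ℕ.+ z))) g t (+ 3) (+ k)) (0≤+ (0≤- (proj₁ IH)) (0≤- lower)))
      , subst₂ _≤_ (sym swapped) (cong (λ m → κ (nonadjacent p m z) + (+ 2) ^ M * (+ 4 * + suc k)) (ℕ.+-suc k q))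
          (≤-by (ring₂ (κ (nonadjacent p (k ℕ.+ suc q) z)) (κ (nonadjacent (k ℕ.+ p) (suc q) (k ℕ.+ z))) g t (+ 4) (+ k)) (0≤+ (0≤- (proj₂ IH)) (0≤- upper)))
      where
      l = nonadjacent (k ℕ.+ p) q (k ℕ.+ z)
      g = gap l 1ℤ 1ℤ
      t = (+ 2) ^ M
      length-l : length l ≡ M
      length-l = trans (length-nonadjacent (k ℕ.+ p) q (k ℕ.+ z))
        (ℕ.+-cancelˡ-≡ 2 _ _ (trans (arith k p q z) (sym M≡)))
        where
        arith : ∀ k p q z → 2 ℕ.+ (2 ℕ.+ (k ℕ.+ p ℕ.+ (q ℕ.+ (q ℕ.+ (k ℕ.+ z))))) ≡ 2 ℕ.+ (p ℕ.+ (q ℕ.+ (q ℕ.+ z))) ℕ.+ (suc k ℕ.+ suc k)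
        arith = ℕ-Solver.solve-∀
      swapped : κ (nonadjacent (suc k ℕ.+ p) q (suc k ℕ.+ z)) ≡ κ (nonadjacent (k ℕ.+ p) (suc q) (k ℕ.+ z)) + g
      swapped = exchange (k ℕ.+ p) q (k ℕ.+ z)
      IH = exchange-many M p (suc q) z k (trans (arith₁ p k q) d≡) (trans M≡ (arith₂ k p q z))
        where
        arith₁ : ∀ p k q → p ℕ.+ k ℕ.+ suc q ≡ p ℕ.+ suc k ℕ.+ q
        arith₁ = ℕ-Solver.solve-∀
        arith₂ : ∀ k p q z → 2 ℕ.+ (p ℕ.+ (q ℕ.+ (q ℕ.+ z))) ℕ.+ (suc k ℕ.+ suc k) ≡ 2 ℕ.+ (p ℕ.+ (suc q ℕ.+ (suc q ℕ.+ z))) ℕ.+ (k ℕ.+ k)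
        arith₂ = ℕ-Solver.solve-∀
      d-eq : 1ℤ + (+ k + + p) + + q ≡ + d
      d-eq = trans (cong (λ m → m + + q) (cong (λ m → 1ℤ + m) (ℤ.+-comm (+ k) (+ p)))) (cong +_ (trans (arith p k q) d≡))
        where
        arith : ∀ p k q → 1 ℕ.+ (p ℕ.+ k) ℕ.+ q ≡ p ℕ.+ suc k ℕ.+ q
        arith = ℕ-Solver.solve-∀
      small : ∀ {e} → e ≡ a * a + (1ℤ + (+ k + + p) + + q) → + 16 * e ≤ R * R
      small e-eq = subst (_≤ R * R) (cong (+ 16 *_) (sym (trans e-eq (cong (λ t → a * a + t) d-eq)))) wide
      energy₁ : 1ℤ * 1ℤ + energy 1ℤ 0ℤ l ≡ a * a + (1ℤ + (+ k + + p) + + q)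
      energy₁ = trans (cong (λ e → 1ℤ * 1ℤ + (s₁ + (s₂ + e))) (energy-steps 1ℤ 0ℤ (k ℕ.+ p) q q (k ℕ.+ z))) (ring a (+ k + + p) (+ q))
        where
        s₁ = (1ℤ * - a + 0ℤ * 0ℤ) * (1ℤ * - a + 0ℤ * 0ℤ)
        s₂ = (1ℤ * 0ℤ + 0ℤ * - a) * (1ℤ * 0ℤ + 0ℤ * - a)
        ring : ∀ a p q → 1ℤ * 1ℤ + ((1ℤ * - a + 0ℤ * 0ℤ) * (1ℤ * - a + 0ℤ * 0ℤ) + ((1ℤ * 0ℤ + 0ℤ * - a) * (1ℤ * 0ℤ + 0ℤ * - a)
          + (p * ((1ℤ + 0ℤ) * (1ℤ + 0ℤ)) + q * (1ℤ * 1ℤ) + q * (0ℤ * 0ℤ)))) ≡ a * a + (1ℤ + p + q)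
        ring = solve-∀
      energy₂ : 1ℤ * 1ℤ + energy 0ℤ 1ℤ l ≡ a * a + (1ℤ + (+ k + + p) + + q)
      energy₂ = trans (cong (λ e → 1ℤ * 1ℤ + (s₁ + (s₂ + e))) (energy-steps 0ℤ 1ℤ (k ℕ.+ p) q q (k ℕ.+ z))) (ring a (+ k + + p) (+ q))
        where
        s₁ = (0ℤ * - a + 1ℤ * 0ℤ) * (0ℤ * - a + 1ℤ * 0ℤ)
        s₂ = (0ℤ * 0ℤ + 1ℤ * - a) * (0ℤ * 0ℤ + 1ℤ * - a)
        ring : ∀ a p q → 1ℤ * 1ℤ + ((0ℤ * - a + 1ℤ * 0ℤ) * (0ℤ * - a + 1ℤ * 0ℤ) + ((0ℤ * 0ℤ + 1ℤ * - a) * (0ℤ * 0ℤ + 1ℤ * - a)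
          + (p * ((0ℤ + 1ℤ) * (0ℤ + 1ℤ)) + q * (0ℤ * 0ℤ) + q * (1ℤ * 1ℤ)))) ≡ a * a + (1ℤ + p + q)
        ring = solve-∀
      lower : t * (+ 3 * 1ℤ) ≤ g
      lower = subst (λ m → (+ 2) ^ m * (+ 3 * 1ℤ) ≤ g) length-l (gap-lower l {1ℤ} {1ℤ} 0≤n 0≤n 0<R (small energy₁) (small energy₂))
      upper : g ≤ t * (+ 4 * 1ℤ)
      upper = subst (λ m → g ≤ (+ 2) ^ m * (+ 4 * 1ℤ)) length-l (gap-upper l {1ℤ} {1ℤ} 0≤n 0≤n)
      ring₁ : ∀ x y g t c k → y + g - (x + t * (c * (1ℤ + k))) ≡ (y - (x + t * (c * k))) + (g - t * (c * 1ℤ))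
      ring₁ = solve-∀
      ring₂ : ∀ x y g t c k → x + t * (c * (1ℤ + k)) - (y + g) ≡ (x + t * (c * k) - y) + (t * (c * 1ℤ) - g)
      ring₂ = solve-∀

    -- Only the two leading steps are decoupled. Their coordinates have opposite signs, so each
    -- decoupling raises the correlation, and the freed unit steps become one private neighbour on
    -- each side of a non-adjacent pair. The new walk is two steps longer, hence the factor 4; the
    -- first gap counts twice because a second decoupling follows it.
    adjacent-bound : ∀ p q z → p ℕ.+ suc q ≡ d →
      + 4 * κ (adjacent p q z) + (+ 2) ^ length (adjacent p q z) * (+ 6 * a) ≤ κ (nonadjacent p (suc q) z)
    adjacent-bound p q z d≡ =
      ≤-by (trans (cong (_- (+ 4 * x + + 2 * (+ 2 * s) * (+ 6 * a))) w-eq) (ring x G₁ G₂ s a))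
        (0≤+ (0≤* {+ 2} 0≤n (0≤- G₁-lower)) (0≤- G₂-lower))
      where
      C = steps p q q z
      l₁ = (1ℤ , - a) ∷ C
      l₂ = (- a , 0ℤ) ∷ (0ℤ , 1ℤ) ∷ C
      s = (+ 2) ^ length C
      x = κ (adjacent p q z)
      w = κ (nonadjacent p (suc q) z)
      G₁ = gap l₁ a 1ℤ
      G₂ = gap l₂ 1ℤ a
      rearrange : (- a , 0ℤ) ∷ (0ℤ , 1ℤ) ∷ l₁ ↭ (1ℤ , - a) ∷ l₂
      rearrange = shift (1ℤ , - a) ((- a , 0ℤ) ∷ (0ℤ , 1ℤ) ∷ []) C
      rearrange′ : first ∷ (0ℤ , - a) ∷ l₂ ↭ nonadjacent p (suc q) z
      rearrange′ = Perm.↭-trans (prep first (swap _ _ Perm.refl))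
        (Perm.↭-trans (Perm.↭-sym (shifts ((- a , 0ℤ) ∷ (0ℤ , - a) ∷ []) (first ∷ []) {second ∷ C}))
          (prep _ (prep _ (Perm.↭-sym (Perm.↭-trans (steps-first p q (suc q) z) (prep first (steps-second p q q z)))))))
      half₁ : + 2 * x ≡ κ ((1ℤ , - a) ∷ l₂) + - G₁
      half₁ = trans (decouple (- a) 1ℤ l₁) (cong₂ _+_ (E-↭ rearrange clip²) (gap-negˡ l₁ a 1ℤ))
      half₂ : + 2 * κ ((1ℤ , - a) ∷ l₂) ≡ w + - G₂
      half₂ = trans (decouple 1ℤ (- a) l₂) (cong₂ _+_ (E-↭ rearrange′ clip²) (gap-negʳ l₂ 1ℤ a))
      w-eq : w ≡ + 2 * (+ 2 * x + G₁) + G₂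
      w-eq = solve-chain half₁ half₂
        where
        r₁ : ∀ w g → w ≡ w + - g + g
        r₁ = solve-∀
        solve-chain : ∀ {x y w g₁ g₂} → + 2 * x ≡ y + - g₁ → + 2 * y ≡ w + - g₂ → w ≡ + 2 * (+ 2 * x + g₁) + g₂
        solve-chain {x} {y} {w} {g₁} {g₂} p q = trans (r₁ w g₂) (cong (_+ g₂) (trans (sym q)
          (cong (+ 2 *_) (trans (r₁ y g₁) (cong (_+ g₁) (sym p))))))
      ring : ∀ x g₁ g₂ s a → + 2 * (+ 2 * x + g₁) + g₂ - (+ 4 * x + + 2 * (+ 2 * s) * (+ 6 * a))
        ≡ + 2 * (g₁ - + 2 * s * (+ 3 * (a * 1ℤ))) + (g₂ - + 2 * (+ 2 * s) * (+ 3 * (1ℤ * a)))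
      ring = solve-∀
      small : ∀ {e} → e ≡ a * a + (+ p + (1ℤ + + q)) → + 16 * e ≤ R * R
      small e-eq = subst (_≤ R * R) (cong (+ 16 *_) (sym (trans e-eq (cong (λ m → a * a + + m) d≡)))) wide
      G₁-lower : + 2 * s * (+ 3 * (a * 1ℤ)) ≤ G₁
      G₁-lower = gap-lower l₁ {a} {1ℤ} 0≤n 0≤n 0<R
        (small (trans (cong (λ e → a * a + ((1ℤ * 1ℤ + 0ℤ * - a) * (1ℤ * 1ℤ + 0ℤ * - a) + e)) (energy-steps 1ℤ 0ℤ p q q z)) (ring₁ a (+ p) (+ q))))
        (small (trans (cong (λ e → 1ℤ * 1ℤ + ((0ℤ * 1ℤ + 1ℤ * - a) * (0ℤ * 1ℤ + 1ℤ * - a) + e)) (energy-steps 0ℤ 1ℤ p q q z)) (ring₂ a (+ p) (+ q))))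
        where
        ring₁ : ∀ a p q → a * a + ((1ℤ * 1ℤ + 0ℤ * - a) * (1ℤ * 1ℤ + 0ℤ * - a)
          + (p * ((1ℤ + 0ℤ) * (1ℤ + 0ℤ)) + q * (1ℤ * 1ℤ) + q * (0ℤ * 0ℤ))) ≡ a * a + (p + (1ℤ + q))
        ring₁ = solve-∀
        ring₂ : ∀ a p q → 1ℤ * 1ℤ + ((0ℤ * 1ℤ + 1ℤ * - a) * (0ℤ * 1ℤ + 1ℤ * - a)
          + (p * ((0ℤ + 1ℤ) * (0ℤ + 1ℤ)) + q * (0ℤ * 0ℤ) + q * (1ℤ * 1ℤ))) ≡ a * a + (p + (1ℤ + q))
        ring₂ = solve-∀
      G₂-lower : + 2 * (+ 2 * s) * (+ 3 * (1ℤ * a)) ≤ G₂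
      G₂-lower = gap-lower l₂ {1ℤ} {a} 0≤n 0≤n 0<R
        (small (trans (cong (λ e → 1ℤ * 1ℤ + ((1ℤ * - a + 0ℤ * 0ℤ) * (1ℤ * - a + 0ℤ * 0ℤ) + ((1ℤ * 0ℤ + 0ℤ * 1ℤ) * (1ℤ * 0ℤ + 0ℤ * 1ℤ) + e)))
          (energy-steps 1ℤ 0ℤ p q q z)) (ring₁ a (+ p) (+ q))))
        (small (trans (cong (λ e → a * a + ((0ℤ * - a + 1ℤ * 0ℤ) * (0ℤ * - a + 1ℤ * 0ℤ) + ((0ℤ * 0ℤ + 1ℤ * 1ℤ) * (0ℤ * 0ℤ + 1ℤ * 1ℤ) + e)))
          (energy-steps 0ℤ 1ℤ p q q z)) (ring₂ a (+ p) (+ q))))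
        where
        ring₁ : ∀ a p q → 1ℤ * 1ℤ + ((1ℤ * - a + 0ℤ * 0ℤ) * (1ℤ * - a + 0ℤ * 0ℤ) + ((1ℤ * 0ℤ + 0ℤ * 1ℤ) * (1ℤ * 0ℤ + 0ℤ * 1ℤ)
          + (p * ((1ℤ + 0ℤ) * (1ℤ + 0ℤ)) + q * (1ℤ * 1ℤ) + q * (0ℤ * 0ℤ)))) ≡ a * a + (p + (1ℤ + q))
        ring₁ = solve-∀
        ring₂ : ∀ a p q → a * a + ((0ℤ * - a + 1ℤ * 0ℤ) * (0ℤ * - a + 1ℤ * 0ℤ) + ((0ℤ * 0ℤ + 1ℤ * 1ℤ) * (0ℤ * 0ℤ + 1ℤ * 1ℤ)
          + (p * ((0ℤ + 1ℤ) * (0ℤ + 1ℤ)) + q * (0ℤ * 0ℤ) + q * (1ℤ * 1ℤ)))) ≡ a * a + (p + (1ℤ + q))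
        ring₂ = solve-∀

    nonadjacent-pad : ∀ p q z → κ (nonadjacent p q (2 ℕ.+ z)) ≡ + 4 * κ (nonadjacent p q z)
    nonadjacent-pad p q z = trans (pad (suc z)) (trans (cong (+ 2 *_) (pad z)) (ring (κ (nonadjacent p q z))))
      where
      ring : ∀ x → + 2 * (+ 2 * x) ≡ + 4 * x
      ring = solve-∀
      pad : ∀ z → κ (nonadjacent p q (suc z)) ≡ + 2 * κ (nonadjacent p q z)
      pad z = trans (E-↭ (Perm.↭-trans (prep _ (prep _ (steps-neither p q q z))) (shift neither ((- a , 0ℤ) ∷ (0ℤ , - a) ∷ []) _)) clip²)
        (E-zero (nonadjacent p q z) clip²)

    -- η and μ are the numbers of steps shared by the two walks.
    correlation-gap : ∀ n {η q z μ q′ z′} → η ℕ.+ suc q ≡ d → μ ℕ.+ q′ ≡ d →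
      2 ℕ.+ (η ℕ.+ (q ℕ.+ (q ℕ.+ z))) ≡ n → 2 ℕ.+ (μ ℕ.+ (q′ ℕ.+ (q′ ℕ.+ z′))) ≡ n →
      + 4 * κ (adjacent η q z) + (+ 2) ^ n * (+ 6 * a + + 3 * + (μ ℕ.∸ η)) ≤ + 4 * κ (nonadjacent μ q′ z′) + (+ 2) ^ n * (+ 4 * + (η ℕ.∸ μ))
    correlation-gap n {η} {q} {z} {μ} {q′} {z′} d₁ d₂ n₁ n₂ = by-cases (ℕ.≤-total μ η)
      where
      t = (+ 2) ^ n
      bound : + 4 * κ (adjacent η q z) + t * (+ 6 * a) ≤ κ (nonadjacent η (suc q) z)
      bound = subst (λ m → + 4 * κ (adjacent η q z) + (+ 2) ^ m * (+ 6 * a) ≤ κ (nonadjacent η (suc q) z))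
        (trans (cong (2 ℕ.+_) (length-steps η q q z)) n₁) (adjacent-bound η q z d₁)
      arith : ∀ p q z k → 2 ℕ.+ (p ℕ.+ (k ℕ.+ q ℕ.+ (k ℕ.+ q ℕ.+ z))) ≡ 2 ℕ.+ (p ℕ.+ (q ℕ.+ (q ℕ.+ z))) ℕ.+ (k ℕ.+ k)
      arith = ℕ-Solver.solve-∀
      arith′ : ∀ p q k → p ℕ.+ k ℕ.+ q ≡ p ℕ.+ (k ℕ.+ q)
      arith′ = ℕ-Solver.solve-∀
      by-cases : μ ℕ.≤ η ⊎ η ℕ.≤ μ → + 4 * κ (adjacent η q z) + t * (+ 6 * a + + 3 * + (μ ℕ.∸ η))
        ≤ + 4 * κ (nonadjacent μ q′ z′) + t * (+ 4 * + (η ℕ.∸ μ))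
      -- The decoupled walk of the edge has η common steps and is two steps longer than that of the
      -- non-edge, which is therefore padded by two idle steps. Extra common neighbours on edges
      -- work against the bound, so each exchange is charged the upper estimate 4.
      by-cases (inj₁ μ≤η) = subst (λ m → + 4 * κ (adjacent η q z) + t * (+ 6 * a + + 3 * + m) ≤ + 4 * κ (nonadjacent μ q′ z′) + t * (+ 4 * + k))
        (sym (ℕ.m≤n⇒m∸n≡0 μ≤η)) (≤-by (ring (κ (adjacent η q z)) (κ (nonadjacent η (suc q) z)) (κ (nonadjacent μ q′ z′)) t a (+ k))
          (0≤+ (0≤- bound) (0≤- above)))
        where
        k = η ℕ.∸ μ
        k+μ : k ℕ.+ μ ≡ η
        k+μ = ℕ.m∸n+n≡m μ≤η
        k+q : k ℕ.+ suc q ≡ q′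
        k+q = ℕ.+-cancelˡ-≡ μ _ _ (trans (rearrange μ k (suc q)) (trans (cong (ℕ._+ suc q) k+μ) (trans d₁ (sym d₂))))
          where
          rearrange : ∀ m k q → m ℕ.+ (k ℕ.+ q) ≡ k ℕ.+ m ℕ.+ q
          rearrange = ℕ-Solver.solve-∀
        k+z : k ℕ.+ (2 ℕ.+ z′) ≡ z
        k+z = ℕ.+-cancelˡ-≡ (η ℕ.+ (q ℕ.+ q)) _ _ (trans (cong (λ m → m ℕ.+ (q ℕ.+ q) ℕ.+ (k ℕ.+ (2 ℕ.+ z′))) (sym k+μ)) (trans (rearrange k μ q z′)
          (trans (cong (λ m → μ ℕ.+ (m ℕ.+ (m ℕ.+ z′))) k+q) (trans (ℕ.+-cancelˡ-≡ 2 _ _ (trans n₂ (sym n₁))) (rearrange′ η q z)))))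
          where
          rearrange : ∀ k m q z → k ℕ.+ m ℕ.+ (q ℕ.+ q) ℕ.+ (k ℕ.+ (2 ℕ.+ z)) ≡ m ℕ.+ (k ℕ.+ suc q ℕ.+ (k ℕ.+ suc q ℕ.+ z))
          rearrange = ℕ-Solver.solve-∀
          rearrange′ : ∀ m q z → m ℕ.+ (q ℕ.+ (q ℕ.+ z)) ≡ m ℕ.+ (q ℕ.+ q) ℕ.+ z
          rearrange′ = ℕ-Solver.solve-∀
        above : κ (nonadjacent η (suc q) z) ≤ + 4 * κ (nonadjacent μ q′ z′) + t * (+ 4 * + k)
        above = subst₂ (λ x y → x ≤ y + t * (+ 4 * + k))
          (cong₂ (λ m j → κ (nonadjacent m (suc q) j)) k+μ k+z)
          (trans (cong (λ m → κ (nonadjacent μ m (2 ℕ.+ z′))) k+q) (nonadjacent-pad μ q′ z′))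
          (proj₂ (exchange-many n μ (suc q) (2 ℕ.+ z′) k (trans (arith′ μ (suc q) k) (trans (cong (μ ℕ.+_) k+q) d₂))
            (trans (cong (2 ℕ.+_) (sym n₂)) (trans (cong (λ m → 4 ℕ.+ (μ ℕ.+ (m ℕ.+ (m ℕ.+ z′)))) (sym k+q)) (rearrange μ (suc q) z′ k)))))
          where
          rearrange : ∀ p q z k → 4 ℕ.+ (p ℕ.+ (k ℕ.+ q ℕ.+ (k ℕ.+ q ℕ.+ z))) ≡ 2 ℕ.+ (p ℕ.+ (q ℕ.+ (q ℕ.+ (2 ℕ.+ z)))) ℕ.+ (k ℕ.+ k)
          rearrange = ℕ-Solver.solve-∀
        ring : ∀ x y w t a k → + 4 * w + t * (+ 4 * k) - (+ 4 * x + t * (+ 6 * a + + 3 * 0ℤ))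
          ≡ (y - (+ 4 * x + t * (+ 6 * a))) + (+ 4 * w + t * (+ 4 * k) - y)
        ring = solve-∀
      -- Now the exchanges help, so each is credited with the lower estimate 3.
      by-cases (inj₂ η≤μ) = subst (λ m → + 4 * κ (adjacent η q z) + t * (+ 6 * a + + 3 * + k) ≤ + 4 * κ (nonadjacent μ q′ z′) + t * (+ 4 * + m))
        (sym (ℕ.m≤n⇒m∸n≡0 η≤μ)) (≤-by (ring (κ (adjacent η q z)) (κ (nonadjacent η (suc q) z)) (κ (nonadjacent μ q′ z′)) t a (+ k))
          (0≤+ (0≤- bound) (0≤- below)))
        where
        k = μ ℕ.∸ η
        k+η : k ℕ.+ η ≡ μ
        k+η = ℕ.m∸n+n≡m η≤μ
        k+q : k ℕ.+ q′ ≡ suc q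
        k+q = ℕ.+-cancelˡ-≡ η _ _ (trans (rearrange η k q′) (trans (cong (ℕ._+ q′) k+η) (trans d₂ (sym d₁))))
          where
          rearrange : ∀ m k q → m ℕ.+ (k ℕ.+ q) ≡ k ℕ.+ m ℕ.+ q
          rearrange = ℕ-Solver.solve-∀
        k+z : k ℕ.+ z ≡ 2 ℕ.+ z′
        k+z = ℕ.+-cancelˡ-≡ (η ℕ.+ k ℕ.+ (q′ ℕ.+ q′)) _ _ (trans (rearrange η k q′ z)
          (trans (cong (λ m → η ℕ.+ (m ℕ.+ (m ℕ.+ z))) k+q) (trans (rearrange′ η q z) (trans n₁ (trans (sym n₂)
          (trans (cong (λ m → 2 ℕ.+ (m ℕ.+ (q′ ℕ.+ (q′ ℕ.+ z′)))) (sym k+η)) (rearrange″ k η q′ z′)))))))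
          where
          rearrange : ∀ e k q z → e ℕ.+ k ℕ.+ (q ℕ.+ q) ℕ.+ (k ℕ.+ z) ≡ e ℕ.+ (k ℕ.+ q ℕ.+ (k ℕ.+ q ℕ.+ z))
          rearrange = ℕ-Solver.solve-∀
          rearrange′ : ∀ e q z → e ℕ.+ (suc q ℕ.+ (suc q ℕ.+ z)) ≡ 2 ℕ.+ (e ℕ.+ (q ℕ.+ (q ℕ.+ z)))
          rearrange′ = ℕ-Solver.solve-∀
          rearrange″ : ∀ k e q z → 2 ℕ.+ (k ℕ.+ e ℕ.+ (q ℕ.+ (q ℕ.+ z))) ≡ e ℕ.+ k ℕ.+ (q ℕ.+ q) ℕ.+ (2 ℕ.+ z)
          rearrange″ = ℕ-Solver.solve-∀
        below : κ (nonadjacent η (suc q) z) + t * (+ 3 * + k) ≤ + 4 * κ (nonadjacent μ q′ z′)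
        below = subst₂ (λ x y → x + t * (+ 3 * + k) ≤ y)
          (cong (λ m → κ (nonadjacent η m z)) k+q)
          (trans (cong₂ (λ m j → κ (nonadjacent m q′ j)) k+η k+z) (nonadjacent-pad μ q′ z′))
          (proj₁ (exchange-many n η q′ z k (trans (arith′ η q′ k) (trans (cong (η ℕ.+_) k+q) d₁))
            (trans (cong (2 ℕ.+_) (sym n₁)) (trans (rearrange η q z) (trans (cong (λ m → 2 ℕ.+ (η ℕ.+ (m ℕ.+ (m ℕ.+ z)))) (sym k+q)) (arith η q′ z k))))))
          where
          rearrange : ∀ e q z → 4 ℕ.+ (e ℕ.+ (q ℕ.+ (q ℕ.+ z))) ≡ 2 ℕ.+ (e ℕ.+ (suc q ℕ.+ (suc q ℕ.+ z)))
          rearrange = ℕ-Solver.solve-∀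
        ring : ∀ x y w t a k → + 4 * w + t * (+ 4 * 0ℤ) - (+ 4 * x + t * (+ 6 * a + + 3 * k))
          ≡ (y - (+ 4 * x + t * (+ 6 * a))) + (+ 4 * w - (y + t * (+ 3 * k)))
        ring = solve-∀

  -- Random signs

  𝕊 : ∀ {n} → (Vec Bool n → ℤ) → ℤ
  𝕊 {zero} f = f []
  𝕊 {suc n} f = 𝕊 (λ S → f (true ∷ S)) + 𝕊 (λ S → f (false ∷ S))

  𝕊-cong : ∀ {n} {f g : Vec Bool n → ℤ} → (∀ S → f S ≡ g S) → 𝕊 f ≡ 𝕊 g
  𝕊-cong {zero} e = e []
  𝕊-cong {suc n} e = cong₂ _+_ (𝕊-cong (λ S → e (true ∷ S))) (𝕊-cong (λ S → e (false ∷ S)))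

  𝕊-mono : ∀ {n} {f g : Vec Bool n → ℤ} → (∀ S → f S ≤ g S) → 𝕊 f ≤ 𝕊 g
  𝕊-mono {zero} e = e []
  𝕊-mono {suc n} e = ℤ.+-mono-≤ (𝕊-mono (λ S → e (true ∷ S))) (𝕊-mono (λ S → e (false ∷ S)))

  𝕊-+ : ∀ {n} (f g : Vec Bool n → ℤ) → 𝕊 (λ S → f S + g S) ≡ 𝕊 f + 𝕊 g
  𝕊-+ {zero} f g = refl
  𝕊-+ {suc n} f g = trans (cong₂ _+_ (𝕊-+ (f ∘ (true ∷_)) (g ∘ (true ∷_))) (𝕊-+ (f ∘ (false ∷_)) (g ∘ (false ∷_))))
    (interchange (𝕊 (f ∘ (true ∷_))) (𝕊 (g ∘ (true ∷_))) (𝕊 (f ∘ (false ∷_))) (𝕊 (g ∘ (false ∷_))))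
    where
    interchange : ∀ x y z w → x + y + (z + w) ≡ x + z + (y + w)
    interchange = solve-∀

  𝕊-*ˡ : ∀ {n} c (f : Vec Bool n → ℤ) → 𝕊 (λ S → c * f S) ≡ c * 𝕊 f
  𝕊-*ˡ {zero} c f = refl
  𝕊-*ˡ {suc n} c f = trans (cong₂ _+_ (𝕊-*ˡ c (f ∘ (true ∷_))) (𝕊-*ˡ c (f ∘ (false ∷_))))
    (sym (ℤ.*-distribˡ-+ c (𝕊 (f ∘ (true ∷_))) (𝕊 (f ∘ (false ∷_)))))

  𝕊-const : ∀ {n} c → 𝕊 {n} (λ _ → c) ≡ (+ 2) ^ n * c
  𝕊-const {zero} c = sym (ℤ.*-identityˡ c)
  𝕊-const {suc n} c = trans (cong₂ _+_ (𝕊-const {n} c) (𝕊-const {n} c)) (ring ((+ 2) ^ n) c)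
    where
    ring : ∀ t c → t * c + t * c ≡ + 2 * t * c
    ring = solve-∀

  𝕊-sum : ∀ {n m} (f : Fin m → Vec Bool n → ℤ) → 𝕊 (λ S → sum (λ i → f i S)) ≡ sum (λ i → 𝕊 (f i))
  𝕊-sum {n} {zero} f = 𝕊-zero {n}
    where
    𝕊-zero : ∀ {n} → 𝕊 {n} (λ _ → 0ℤ) ≡ 0ℤ
    𝕊-zero {n} = trans (𝕊-const {n} 0ℤ) (ℤ.*-zeroʳ ((+ 2) ^ n))
  𝕊-sum {n} {suc m} f = trans (𝕊-+ (f zero) (λ S → sum (λ i → f (suc i) S))) (cong (λ t → 𝕊 (f zero) + t) (𝕊-sum (f ∘ suc)))

  dot : ∀ {n} → (Fin n → ℤ) → Vec Bool n → ℤ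
  dot w S = sum (λ i → w i * sgn S i)

  -- A single random sign moves both linear forms at once, so their joint law is that of a planar
  -- walk with one step per coordinate.
  𝕊-walk : ∀ {n} (w w′ : Fin n → ℤ) (Φ : Plane) →
    𝕊 (λ S → Φ (dot w S) (dot w′ S)) ≡ E (tabulate (λ i → w i , w′ i)) Φ
  𝕊-walk {zero} w w′ Φ = refl
  𝕊-walk {suc n} w w′ Φ = trans
    (sym (𝕊-+ (λ S → Φ (dot w (true ∷ S)) (dot w′ (true ∷ S))) (λ S → Φ (dot w (false ∷ S)) (dot w′ (false ∷ S)))))
    (trans (𝕊-cong (λ S → cong₂ _+_
        (cong₂ Φ (plus (w zero) (dot (w ∘ suc) S)) (plus (w′ zero) (dot (w′ ∘ suc) S)))
        (cong₂ Φ (minus (w zero) (dot (w ∘ suc) S)) (minus (w′ zero) (dot (w′ ∘ suc) S)))))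
      (𝕊-walk (w ∘ suc) (w′ ∘ suc) (walk (w zero , w′ zero) Φ)))
    where
    plus : ∀ a x → a * 1ℤ + x ≡ x + a
    plus = solve-∀
    minus : ∀ a x → a * -1ℤ + x ≡ x - a
    minus = solve-∀

  -- The walk of a pair of vertices, sorted by adjacency

  module Counting where

    open import Data.List.Relation.Unary.All using (All; []; _∷_)
    open import Data.List.Relation.Unary.AllPairs using (AllPairs; _∷_)

    pair-first : ∀ {n} {i j : Fin n} → i ≢ j → ∃[ ks ] (allFin n ↭ i ∷ j ∷ ks) × All (λ k → i ≢ k × j ≢ k) ks
    pair-first {n} {i} {j} i≢j with ∈-∃++ (∈-allFin i)
    ... | xs , ys , e₁ with ∈-resp-↭ all↭ (∈-allFin j)
      where
      all↭ : allFin n ↭ i ∷ xs ++ ys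
      all↭ = Perm.↭-trans (Perm.↭-reflexive e₁) (shift i xs ys)
    ... | here j≡i = contradiction (sym j≡i) i≢j
    ... | there j∈ with ∈-∃++ j∈
    ... | xs′ , ys′ , e₂ = xs′ ++ ys′ , p , distinct (Setoid.Unique-resp-↭ (setoid (Fin n)) (↭⇒↭ₛ p) (allFin⁺ n))
      where
      p : allFin n ↭ i ∷ j ∷ xs′ ++ ys′
      p = Perm.↭-trans (Perm.↭-reflexive e₁) (Perm.↭-trans (shift i xs ys) (prep i (Perm.↭-trans (Perm.↭-reflexive e₂) (shift j xs′ ys′))))
      zipAll : ∀ {P Q : Fin n → Set} {ks} → All P ks → All Q ks → All (λ k → P k × Q k) ks
      zipAll [] [] = []
      zipAll (p ∷ ps) (q ∷ qs) = (p , q) ∷ zipAll ps qs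
      distinct : ∀ {ks} → AllPairs _≢_ (i ∷ j ∷ ks) → All (λ k → i ≢ k × j ≢ k) ks
      distinct ((_ ∷ i≢) ∷ j≢ ∷ _) = zipAll i≢ j≢

    record Census (l : List Step) (common₁₂ deg₁ deg₂ size : ℕ) : Set where
      constructor census
      field
        {p q r z} : ℕ
        l↭steps : l ↭ steps p q r z
        common≡ : common₁₂ ≡ p
        deg₁≡ : deg₁ ≡ p ℕ.+ q
        deg₂≡ : deg₂ ≡ p ℕ.+ r
        size≡ : size ≡ p ℕ.+ (q ℕ.+ (r ℕ.+ z))

    add-step : ∀ x y {l c d₁ d₂ n} → Census l c d₁ d₂ n →
      Census ((𝟙 x , 𝟙 y) ∷ l) (b2n (x ∧ y) ℕ.+ c) (b2n x ℕ.+ d₁) (b2n y ℕ.+ d₂) (suc n)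
    add-step true true (census e refl refl refl refl) = census (prep both e) refl refl refl refl
    add-step true false (census {p} {q} {r} {z} e refl refl refl refl) =
      census (Perm.↭-trans (prep first e) (Perm.↭-sym (steps-first p q r z))) refl (sym (ℕ.+-suc p q)) refl
        (sym (ℕ.+-suc p (q ℕ.+ (r ℕ.+ z))))
    add-step false true (census {p} {q} {r} {z} e refl refl refl refl) =
      census (Perm.↭-trans (prep second e) (Perm.↭-sym (steps-second p q r z))) refl refl (sym (ℕ.+-suc p r)) (arith p q r z)
      where
      arith : ∀ p q r z → suc (p ℕ.+ (q ℕ.+ (r ℕ.+ z))) ≡ p ℕ.+ (q ℕ.+ (suc r ℕ.+ z))
      arith = ℕ-Solver.solve-∀
    add-step false false (census {p} {q} {r} {z} e refl refl refl refl) =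
      census (Perm.↭-trans (prep neither e) (Perm.↭-sym (steps-neither p q r z))) refl refl refl (arith p q r z)
      where
      arith : ∀ p q r z → suc (p ℕ.+ (q ℕ.+ (r ℕ.+ z))) ≡ p ℕ.+ (q ℕ.+ (r ℕ.+ suc z))
      arith = ℕ-Solver.solve-∀

    take-census : ∀ {A : Set} {f : A → Step} {x y : A → Bool} ks → All (λ k → f k ≡ (𝟙 (x k) , 𝟙 (y k))) ks →
      Census (map f ks) (ℕL.sum (map (λ k → b2n (x k ∧ y k)) ks)) (ℕL.sum (map (b2n ∘ x) ks)) (ℕL.sum (map (b2n ∘ y) ks)) (length ks)
    take-census [] [] = census {p = 0} {0} {0} {0} Perm.refl refl refl refl refl
    take-census {f = f} {x} {y} (k ∷ ks) (e ∷ es) =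
      subst (λ s → Census (s ∷ map f ks) _ _ _ _) (sym e) (add-step (x k) (y k) (take-census ks es))

    module Pairs {n : ℕ} (G : Graph n) (α : ℕ) where

      open GraphFacts G

      weight : Fin n → Fin n → ℤ
      weight i k = if does (i Fin.≟ k) then - + α else A i k

      weight-diag : ∀ i → weight i i ≡ - + α
      weight-diag i with i Fin.≟ i
      ... | yes _ = refl
      ... | no i≢i = contradiction refl i≢i

      weight-off : ∀ {i k} → i ≢ k → weight i k ≡ A i k
      weight-off {i} {k} i≢k with i Fin.≟ k
      ... | yes i≡k = contradiction i≡k i≢k
      ... | no _ = refl

      pair-steps : Fin n → Fin n → List Step
      pair-steps i j = tabulate (λ k → weight i k , weight j k)

      -- Regularity gives both vertices equally many private neighbours. The order of the steps
      -- aside, the walk then depends only on the adjacency and the number of common neighbours of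
      -- the pair, which strong regularity ties to each other.
      pair-census : ∀ {d i j} → Regular G d → i ≢ j → ∃[ q ] ∃[ z ]
        (pair-steps i j ↭ (- + α , A i j) ∷ (A i j , - + α) ∷ steps (commonNbrs G i j) q q z)
        × commonNbrs G i j ℕ.+ (b2n (adj G i j) ℕ.+ q) ≡ d
        × 2 ℕ.+ (commonNbrs G i j ℕ.+ (q ℕ.+ (q ℕ.+ z))) ≡ n
      pair-census {d} {i} {j} regular i≢j with pair-first i≢j
      ... | ks , all↭ , apart with take-census {f = λ k → weight i k , weight j k} {adj G i} {adj G j} ks (off-diagonal apart)
        where
        off-diagonal : ∀ {ks} → All (λ k → i ≢ k × j ≢ k) ks → All (λ k → (weight i k , weight j k) ≡ (A i k , A j k)) ks
        off-diagonal [] = []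
        off-diagonal ((p , q) ∷ ps) = cong₂ _,_ (weight-off p) (weight-off q) ∷ off-diagonal ps
      ... | census {p} {q} {r} {z} l↭ c≡ d₁≡ d₂≡ n≡ = q , z , list , degrees , size
        where
        total : ∀ (f : Fin n → ℕ) → Σ[ f ] ≡ f i ℕ.+ (f j ℕ.+ ℕL.sum (map f ks))
        total f = ℕL.sum-↭ (map⁺ f all↭)
        shared = ℕL.sum (map (λ k → b2n (adj G i k ∧ adj G j k)) ks)
        others = ℕL.sum (map (b2n ∘ adj G j) ks)
        common-eq : commonNbrs G i j ≡ p
        common-eq = trans (total (λ k → b2n (adj G i k ∧ adj G j k)))
          (trans (cong₂ (λ x y → b2n (x ∧ adj G j i) ℕ.+ (b2n y ℕ.+ shared)) (irrefl G i) (trans (cong (adj G i j ∧_) (irrefl G j)) (Bool.∧-zeroʳ (adj G i j)))) c≡)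
        degree₁ : b2n (adj G i j) ℕ.+ (p ℕ.+ q) ≡ d
        degree₁ = trans (sym (trans (total (b2n ∘ adj G i)) (cong₂ (λ x y → b2n x ℕ.+ (b2n (adj G i j) ℕ.+ y)) (irrefl G i) d₁≡))) (regular i)
        degree₂ : b2n (adj G i j) ℕ.+ (p ℕ.+ r) ≡ d
        degree₂ = trans (sym (trans (total (b2n ∘ adj G j)) (trans (cong₂ (λ x y → b2n x ℕ.+ (b2n y ℕ.+ others)) (adj-sym G j i) (irrefl G j))
          (cong (b2n (adj G i j) ℕ.+_) d₂≡)))) (regular j)
        r≡q : r ≡ q
        r≡q = ℕ.+-cancelˡ-≡ p r q (ℕ.+-cancelˡ-≡ (b2n (adj G i j)) _ _ (trans degree₂ (sym degree₁)))
        list : pair-steps i j ↭ (- + α , A i j) ∷ (A i j , - + α) ∷ steps (commonNbrs G i j) q q z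
        list = Perm.↭-trans (Perm.↭-reflexive (sym (map-tabulate id (λ k → weight i k , weight j k))))
          (Perm.↭-trans (map⁺ (λ k → weight i k , weight j k) all↭)
          (Perm.↭-trans (Perm.↭-reflexive (cong₂ (λ s t → s ∷ t ∷ map (λ k → weight i k , weight j k) ks)
              (cong₂ _,_ (weight-diag i) (trans (weight-off (i≢j ∘ sym)) (A-sym j i)))
              (cong₂ _,_ (weight-off i≢j) (weight-diag j))))
          (prep _ (prep _ (Perm.↭-trans l↭ (Perm.↭-reflexive (cong₂ (λ m k → steps m q k z) (sym common-eq) r≡q)))))))
        degrees : commonNbrs G i j ℕ.+ (b2n (adj G i j) ℕ.+ q) ≡ d
        degrees = trans (cong (λ m → m ℕ.+ (b2n (adj G i j) ℕ.+ q)) common-eq) (trans (arith p (b2n (adj G i j)) q) degree₁)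
          where
          arith : ∀ p b q → p ℕ.+ (b ℕ.+ q) ≡ b ℕ.+ (p ℕ.+ q)
          arith = ℕ-Solver.solve-∀
        size : 2 ℕ.+ (commonNbrs G i j ℕ.+ (q ℕ.+ (q ℕ.+ z))) ≡ n
        size = trans (cong₂ (λ m k → 2 ℕ.+ (m ℕ.+ (q ℕ.+ (k ℕ.+ z)))) common-eq (sym r≡q))
          (trans (cong (2 ℕ.+_) (sym n≡)) (trans (sym (↭-length all↭)) (length-tabulate {n = n} id)))

  open Counting

  -- The adjacency form and the least eigenvalue

  δ : ∀ {n} → Fin n → Fin n → ℤ
  δ i j = 𝟙 (does (i Fin.≟ j))

  sum-δ : ∀ {n} (i : Fin n) (f : Fin n → ℤ) → sum (λ j → δ i j * f j) ≡ f i
  sum-δ {suc n} zero f = trans (cong₂ _+_ (ℤ.*-identityˡ (f zero))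
    (trans (sum-cong-≗ (λ j → ℤ.*-zeroˡ (f (suc j)))) (trans (sum-const {n} 0ℤ) (ℤ.*-zeroʳ (+ n)))))
    (ℤ.+-identityʳ (f zero))
  sum-δ {suc n} (suc i) f = trans (cong₂ _+_ (ℤ.*-zeroˡ (f zero)) (sum-δ i (f ∘ suc))) (ℤ.+-identityˡ (f (suc i)))

  sum-δ-one : ∀ {n} (i : Fin n) → sum (δ i) ≡ 1ℤ
  sum-δ-one i = trans (sum-cong-≗ (λ j → sym (ℤ.*-identityʳ (δ i j)))) (sum-δ i (λ _ → 1ℤ))

  sum-mono : ∀ {n} {f g : Fin n → ℤ} → (∀ i → f i ≤ g i) → sum f ≤ sum g
  sum-mono {zero} p = ℤ.≤-refl
  sum-mono {suc n} p = ℤ.+-mono-≤ (p zero) (sum-mono (p ∘ suc))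

  sum₂-mono : ∀ {n} {f g : Fin n → Fin n → ℤ} → (∀ i j → f i j ≤ g i j) → sum₂ f ≤ sum₂ g
  sum₂-mono p = sum-mono (λ i → sum-mono (p i))

  module Surplus {n : ℕ} (G : Graph n) where

    open GraphFacts G public

    -- Four times sp G.
    σ : ℤ
    σ = + 4 * + mc G - + 2 * + edges G

    form-lower : ∀ S → - σ ≤ form (sgn S)
    form-lower S = subst (- σ ≤_) (sym (form-sgn S)) (≤-by (ring (+ edges G) (+ cut G S) (+ mc G))
      (0≤* {+ 4} 0≤n (0≤- (+≤+ (cut≤mc G S)))))
      where
      ring : ∀ e c m → + 2 * e - + 4 * c - - (+ 4 * m - + 2 * e) ≡ + 4 * (m - c)
      ring = solve-∀

    form-scale : ∀ b x → form (λ i → b * x i) ≡ b * b * form x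
    form-scale b x = trans (sum₂-cong (λ i j → ring (A i j) b (x i) (x j))) (sum₂-*ˡ (b * b) (λ i j → A i j * (x i * x j)))
      where
      ring : ∀ a b x y → a * (b * x * (b * y)) ≡ b * b * (a * (x * y))
      ring = solve-∀

    form-box : ∀ {B} → 0ℤ < B → ∀ x → (∀ i → - B ≤ x i × x i ≤ B) → - (B * B * σ) ≤ form x
    form-box {B} 0<B x box = subst (- (B * B * σ) ≤_) (plain x)
      (quadratic-box-min B 0ℤ (λ _ → 0ℤ) A (- (B * B * σ)) 0<B A-irrefl
        (λ S → subst (- (B * B * σ) ≤_) (sym (trans (plain (λ i → B * sgn S i)) (form-scale B (sgn S))))
          (≤-by (ring (B * B) (form (sgn S)) σ) (0≤* (0≤² B) (0≤- (form-lower S))))) x box)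
      where
      plain : ∀ x → quadratic 0ℤ (λ _ → 0ℤ) A x ≡ form x
      plain x = trans (cong (λ t → 0ℤ + t + form x) (trans (sum-cong-≗ (λ i → ℤ.*-zeroˡ (x i))) (trans (sum-const {n} 0ℤ) (ℤ.*-zeroʳ (+ n)))))
        (ℤ.+-identityˡ (form x))
      ring : ∀ b f s → b * f - - (b * s) ≡ b * (f - - s)
      ring = solve-∀

    mc-form : ∃[ S ] form (sgn S) ≡ - σ
    mc-form with mc-attained G
    ... | S , e = S , trans (form-sgn S) (trans (cong (λ m → + 2 * + edges G - + 4 * + m) e) (ring (+ edges G) (+ mc G)))
      where
      ring : ∀ e m → + 2 * e - + 4 * m ≡ - (+ 4 * m - + 2 * e)
      ring = solve-∀

    apply : (Fin n → ℤ) → Fin n → ℤ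
    apply y i = sum (λ k → A i k * y k)

    form-apply : ∀ y → sum (λ i → apply y i * y i) ≡ form y
    form-apply y = sum-cong-≗ (λ i → trans (ℤ.*-comm (apply y i) (y i)) (trans (sym (sum-*ˡ (y i) (λ k → A i k * y k)))
      (sum-cong-≗ (λ k → ring (y i) (A i k) (y k)))))
      where
      ring : ∀ y a z → y * (a * z) ≡ a * (y * z)
      ring = solve-∀

    -- The orthogonal projection onto the complement of the all-ones vector, multiplied by n to
    -- remain integral.
    centre : (Fin n → ℤ) → Fin n → ℤ
    centre x i = + n * x i - sum x

    sum-centre : ∀ x → sum (centre x) ≡ 0ℤ
    sum-centre x = trans (sum-cong-≗ (λ i → ring (+ n) (x i) (sum x)))
      (trans (∑-distrib-+ (λ i → + n * x i) (λ _ → - sum x)) (trans (cong₂ _+_ (sum-*ˡ (+ n) x) (sum-const {n} (- sum x)))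
        (ring′ (+ n) (sum x))))
      where
      ring : ∀ n x s → n * x - s ≡ n * x + - s
      ring = solve-∀
      ring′ : ∀ n s → n * s + n * - s ≡ 0ℤ
      ring′ = solve-∀

    norm² : (Fin n → ℤ) → ℤ
    norm² x = sum (λ i → x i * x i)

    norm²-centre : ∀ x → norm² (centre x) ≡ + n * + n * norm² x - + n * (sum x * sum x)
    norm²-centre x = trans (sum-cong-≗ (λ i → ring (+ n) (x i) (sum x)))
      (trans (∑-distrib-+ (λ i → + n * + n * (x i * x i)) (λ i → - (+ 2) * + n * sum x * x i + sum x * sum x * 1ℤ))
      (trans (cong₂ _+_ (sum-*ˡ (+ n * + n) (λ i → x i * x i)) (trans (sum-linear (- (+ 2) * + n * sum x) (sum x * sum x) x (λ _ → 1ℤ))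
        (cong (λ t → - (+ 2) * + n * sum x * sum x + sum x * sum x * t) (sum-const {n} 1ℤ)))) (ring′ (+ n) (norm² x) (sum x))))
      where
      ring : ∀ n x s → (n * x - s) * (n * x - s) ≡ n * n * (x * x) + (- (+ 2) * n * s * x + s * s * 1ℤ)
      ring = solve-∀
      ring′ : ∀ n q s → n * n * q + (- (+ 2) * n * s * s + s * s * (n * 1ℤ)) ≡ n * n * q - n * (s * s)
      ring′ = solve-∀

    norm²-sgn : ∀ S → norm² (sgn S) ≡ + n
    norm²-sgn S = trans (sum-cong-≗ (λ i → sgn² (lookup S i))) (trans (sum-const {n} 1ℤ) (ℤ.*-identityʳ (+ n)))
      where
      sgn² : ∀ b → (if b then 1ℤ else -1ℤ) * (if b then 1ℤ else -1ℤ) ≡ 1ℤ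
      sgn² true = refl
      sgn² false = refl

    module _ {d : ℕ} (regular : Regular G d) where

      sum-A : ∀ i → sum (A i) ≡ + d
      sum-A i = trans (sym (Σ[]≡sum (b2n ∘ adj G i))) (cong +_ (regular i))

      sum₂-A : sum₂ A ≡ + n * + d
      sum₂-A = trans (sum-cong-≗ sum-A) (sum-const {n} (+ d))

      sum₂-A-left : ∀ (x : Fin n → ℤ) → sum₂ (λ i j → A i j * x i) ≡ + d * sum x
      sum₂-A-left x = trans (sum-cong-≗ (λ i → trans (sum-cong-≗ (λ j → ℤ.*-comm (A i j) (x i)))
          (trans (sum-*ˡ (x i) (A i)) (trans (cong (x i *_) (sum-A i)) (ℤ.*-comm (x i) (+ d))))))
        (sum-*ˡ (+ d) x)

      sum₂-A-right : ∀ (x : Fin n → ℤ) → sum₂ (λ i j → A i j * x j) ≡ + d * sum x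
      sum₂-A-right x = trans (∑-comm (λ i j → A i j * x j)) (trans (sum₂-cong (λ j i → cong (_* x j) (A-sym i j))) (sum₂-A-left x))

      edges-eq : + 2 * + edges G ≡ + n * + d
      edges-eq = trans (sym sum-adj) sum₂-A

      -- The all-ones vector is an eigenvector for d, so the cross terms depend on x only through
      -- its sum, and the projection subtracts exactly the contribution of the constant component.
      form-centre : ∀ x → form (centre x) ≡ + n * + n * form x - + n * + d * (sum x * sum x)
      form-centre x = begin
        form (centre x)
          ≡⟨ sum₂-cong (λ i j → ring (A i j) (+ n) (x i) (x j) s) ⟩
        sum₂ (λ i j → 1ℤ * (+ n * + n * (A i j * (x i * x j)) + s * s * A i j) + - (+ n * s) * (1ℤ * (A i j * x i) + 1ℤ * (A i j * x j)))
          ≡⟨ sum₂-linear 1ℤ (- (+ n * s)) (λ i j → + n * + n * (A i j * (x i * x j)) + s * s * A i j) (λ i j → 1ℤ * (A i j * x i) + 1ℤ * (A i j * x j)) ⟩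
        1ℤ * sum₂ (λ i j → + n * + n * (A i j * (x i * x j)) + s * s * A i j) + - (+ n * s) * sum₂ (λ i j → 1ℤ * (A i j * x i) + 1ℤ * (A i j * x j))
          ≡⟨ cong₂ (λ u v → 1ℤ * u + - (+ n * s) * v)
               (trans (sum₂-linear (+ n * + n) (s * s) (λ i j → A i j * (x i * x j)) A) (cong (λ t → + n * + n * form x + s * s * t) sum₂-A))
               (trans (sum₂-linear 1ℤ 1ℤ (λ i j → A i j * x i) (λ i j → A i j * x j)) (cong₂ (λ u v → 1ℤ * u + 1ℤ * v) (sum₂-A-left x) (sum₂-A-right x))) ⟩
        1ℤ * (+ n * + n * form x + s * s * (+ n * + d)) + - (+ n * s) * (1ℤ * (+ d * s) + 1ℤ * (+ d * s))
          ≡⟨ ring′ (+ n) (+ d) (form x) s ⟩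
        + n * + n * form x - + n * + d * (s * s) ∎
        where
        open ≡-Reasoning
        s = sum x
        ring : ∀ a n x y s → a * ((n * x - s) * (n * y - s)) ≡ 1ℤ * (n * n * (a * (x * y)) + s * s * a) + - (n * s) * (1ℤ * (a * x) + 1ℤ * (a * y))
        ring = solve-∀
        ring′ : ∀ n d f s → 1ℤ * (n * n * f + s * s * (n * d)) + - (n * s) * (1ℤ * (d * s) + 1ℤ * (d * s)) ≡ n * n * f - n * d * (s * s)
        ring′ = solve-∀

      form-δ : ∀ i → form (δ i) ≡ 0ℤ
      form-δ i = trans (sum-cong-≗ (λ k → trans (sum-cong-≗ (λ l → ring (A k l) (δ i k) (δ i l)))
          (trans (sum-*ˡ (δ i k) (λ l → δ i l * A k l)) (cong (δ i k *_) (sum-δ i (A k))))))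
        (trans (sum-δ i (λ k → A k i)) (A-irrefl i))
        where
        ring : ∀ a x y → a * (x * y) ≡ x * (y * a)
        ring = solve-∀

      -- The vector `centre (δ i)` has entries of modulus at most n and form `- (n * d)`. Strict
      -- positivity is all that small complete graphs will need.
      σ-positive : Fin n → 1 ℕ.≤ d → 0ℤ < σ
      σ-positive i 1≤d = ℤ.*-cancelˡ-<-nonNeg (+ n * + n) {{ℤ.nonNegative (0≤² (+ n))}}
        (subst (_< + n * + n * σ) (sym (ℤ.*-zeroʳ (+ n * + n))) (ℤ.<-≤-trans nd-positive
          (≤-by (ring (+ n * + n * σ) (+ n * + d)) (0≤- {(- (+ n * + n * σ))} {(- (+ n * + d))}
            (subst (- (+ n * + n * σ) ≤_) form-eq (form-box 0<n (centre (δ i)) box))))))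
        where
        0<n : 0ℤ < + n
        0<n = +<+ (ℕ.≤-<-trans z≤n (Fin.toℕ<n i))
        nd-positive : 0ℤ < + n * + d
        nd-positive = subst (0ℤ <_) (ℤ.pos-* n d) (+<+ (ℕ.*-mono-≤ (ℕ.≤-<-trans z≤n (Fin.toℕ<n i)) 1≤d))
        ring : ∀ x y → x - y ≡ - y - - x
        ring = solve-∀
        form-eq : form (centre (δ i)) ≡ - (+ n * + d)
        form-eq = trans (form-centre (δ i)) (trans (cong₂ (λ f s → + n * + n * f - + n * + d * (s * s)) (form-δ i) (sum-δ-one i)) (ring′ (+ n) (+ d)))
          where
          ring′ : ∀ n d → n * n * 0ℤ - n * d * (1ℤ * 1ℤ) ≡ - (n * d)
          ring′ = solve-∀
        box : ∀ k → - + n ≤ centre (δ i) k × centre (δ i) k ≤ + n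
        box k = subst (λ s → - + n ≤ + n * δ i k - s × + n * δ i k - s ≤ + n) (sym (sum-δ-one i)) (box′ (does (i Fin.≟ k)))
          where
          ring₁ : ∀ n → n * 1ℤ - 1ℤ - - n ≡ n + (n - 1ℤ)
          ring₁ = solve-∀
          ring₂ : ∀ n → n - (n * 1ℤ - 1ℤ) ≡ 1ℤ
          ring₂ = solve-∀
          ring₃ : ∀ n → n * 0ℤ - 1ℤ - - n ≡ n - 1ℤ
          ring₃ = solve-∀
          ring₄ : ∀ n → n - (n * 0ℤ - 1ℤ) ≡ n + 1ℤ
          ring₄ = solve-∀
          0≤n-1 : 0ℤ ≤ + n - 1ℤ
          0≤n-1 = 0≤- (+≤+ (ℕ.≤-<-trans z≤n (Fin.toℕ<n i)))
          box′ : ∀ b → - + n ≤ + n * 𝟙 b - 1ℤ × + n * 𝟙 b - 1ℤ ≤ + n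
          box′ true = ≤-by (ring₁ (+ n)) (0≤+ {+ n} 0≤n 0≤n-1) , ≤-by (ring₂ (+ n)) 0≤n
          box′ false = ≤-by (ring₃ (+ n)) 0≤n-1 , ≤-by (ring₄ (+ n)) (0≤+ {+ n} 0≤n 0≤n)

    -- The adjacency matrix J - I - A of the complement.
    N : Fin n → Fin n → ℤ
    N i j = 1ℤ - δ i j - A i j

    N-cases : ∀ k l → N k l ≡ 0ℤ ⊎ (N k l ≡ 1ℤ × k ≢ l × adj G k l ≡ false)
    N-cases k l with k Fin.≟ l
    ... | yes refl = inj₁ (cong (λ b → 1ℤ - 1ℤ - 𝟙 b) (irrefl G k))
    ... | no k≢l = by-adjacency (adj G k l) refl
      where
      by-adjacency : ∀ b → adj G k l ≡ b → 1ℤ - 0ℤ - A k l ≡ 0ℤ ⊎ (1ℤ - 0ℤ - A k l ≡ 1ℤ × k ≢ l × adj G k l ≡ false)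
      by-adjacency true e = inj₁ (cong (λ b → 1ℤ - 0ℤ - 𝟙 b) e)
      by-adjacency false e = inj₂ (cong (λ b → 1ℤ - 0ℤ - 𝟙 b) e , k≢l , e)

    0≤N : ∀ k l → 0ℤ ≤ N k l
    0≤N k l with N-cases k l
    ... | inj₁ e = subst (0ℤ ≤_) (sym e) ℤ.≤-refl
    ... | inj₂ (e , _) = subst (0ℤ ≤_) (sym e) 0≤n

    -- Counting identities of strongly regular graphs and the spectral upper bound

    module StronglyRegularFacts {d η μ : ℕ} (regular : Regular G d)
      (η-common : ∀ i j → i ≢ j → adj G i j ≡ true → commonNbrs G i j ≡ η)
      (μ-common : ∀ i j → i ≢ j → adj G i j ≡ false → commonNbrs G i j ≡ μ) where

      common-eq : ∀ i j → sum (λ k → A i k * A j k) ≡ + d * δ i j + + η * A i j + + μ * N i j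
      common-eq i j with i Fin.≟ j
      ... | yes refl = trans (trans (sum-cong-≗ (λ k → 𝟙² (adj G i k))) (sum-A regular i)) (diagonal (+ d) (+ η) (+ μ) (A-irrefl i))
        where
        ring : ∀ d η μ → d ≡ d * 1ℤ + η * 0ℤ + μ * (1ℤ - 1ℤ - 0ℤ)
        ring = solve-∀
        diagonal : ∀ d η μ {a} → a ≡ 0ℤ → d ≡ d * 1ℤ + η * a + μ * (1ℤ - 1ℤ - a)
        diagonal d η μ refl = ring d η μ
      ... | no i≢j = trans (sum-cong-≗ (λ k → sym (𝟙-∧ (adj G i k) (adj G j k))))
        (trans (sym (Σ[]≡sum (λ k → b2n (adj G i k ∧ adj G j k)))) (count (adj G i j) refl))
        where
        ring : ∀ d η μ → η ≡ d * 0ℤ + η * 1ℤ + μ * (1ℤ - 0ℤ - 1ℤ)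
        ring = solve-∀
        ring′ : ∀ d η μ → μ ≡ d * 0ℤ + η * 0ℤ + μ * (1ℤ - 0ℤ - 0ℤ)
        ring′ = solve-∀
        count : ∀ b → adj G i j ≡ b → + commonNbrs G i j ≡ + d * 0ℤ + + η * A i j + + μ * (1ℤ - 0ℤ - A i j)
        count true e = trans (cong +_ (η-common i j i≢j e)) (trans (ring (+ d) (+ η) (+ μ)) (cong (λ b → + d * 0ℤ + + η * 𝟙 b + + μ * (1ℤ - 0ℤ - 𝟙 b)) (sym e)))
        count false e = trans (cong +_ (μ-common i j i≢j e)) (trans (ring′ (+ d) (+ η) (+ μ)) (cong (λ b → + d * 0ℤ + + η * 𝟙 b + + μ * (1ℤ - 0ℤ - 𝟙 b)) (sym e)))

      sum-N : ∀ i → sum (N i) ≡ + n - 1ℤ - + d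
      sum-N i = trans (sum-cong-≗ (λ j → ring (δ i j) (A i j))) (trans (∑-distrib-+ (λ _ → 1ℤ) (λ j → -1ℤ * δ i j + -1ℤ * A i j))
        (trans (cong₂ _+_ (sum-const {n} 1ℤ) (trans (sum-linear -1ℤ -1ℤ (δ i) (A i)) (cong₂ (λ u v → -1ℤ * u + -1ℤ * v) (sum-δ-one i) (sum-A regular i))))
          (ring′ (+ n) (+ d))))
        where
        ring : ∀ x y → 1ℤ - x - y ≡ 1ℤ + (-1ℤ * x + -1ℤ * y)
        ring = solve-∀
        ring′ : ∀ n d → n * 1ℤ + (-1ℤ * 1ℤ + -1ℤ * d) ≡ n - 1ℤ - d
        ring′ = solve-∀

      0≤m : Fin n → 0ℤ ≤ + n - 1ℤ - + d
      0≤m i = subst (0ℤ ≤_) (sum-N i) (sum-0≤ (0≤N i))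

      sum₂-N : sum₂ N ≡ + n * (+ n - 1ℤ - + d)
      sum₂-N = trans (sum-cong-≗ sum-N) (sum-const {n} (+ n - 1ℤ - + d))

      -- Paths of length two from a fixed vertex, counted in two ways.
      parameters : Fin n → + d * + d ≡ + d + + η * + d + + μ * (+ n - 1ℤ - + d)
      parameters i = begin
        + d * + d                                          ≡⟨ cong (+ d *_) (sum-A regular i) ⟨
        + d * sum (A i)                                    ≡⟨ sum-*ˡ (+ d) (A i) ⟨
        sum (λ k → + d * A i k)                            ≡⟨ sum-cong-≗ (λ k → trans (ℤ.*-comm (+ d) (A i k)) (trans (cong (A i k *_) (sym (trans (sum-cong-≗ (λ j → A-sym j k)) (sum-A regular k))))
                                                                (sym (sum-*ˡ (A i k) (λ j → A j k))))) ⟩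
        sum₂ (λ k j → A i k * A j k)                       ≡⟨ ∑-comm (λ k j → A i k * A j k) ⟩
        sum₂ (λ j k → A i k * A j k)                       ≡⟨ sum-cong-≗ (common-eq i) ⟩
        sum (λ j → + d * δ i j + + η * A i j + + μ * N i j) ≡⟨ ∑-distrib-+ (λ j → + d * δ i j + + η * A i j) (λ j → + μ * N i j) ⟩
        sum (λ j → + d * δ i j + + η * A i j) + sum (λ j → + μ * N i j)
          ≡⟨ cong₂ _+_ (trans (sum-linear (+ d) (+ η) (δ i) (A i)) (cong₂ (λ u v → + d * u + + η * v) (sum-δ-one i) (sum-A regular i)))
               (trans (sum-*ˡ (+ μ) (N i)) (cong (+ μ *_) (sum-N i))) ⟩
        + d * 1ℤ + + η * + d + + μ * (+ n - 1ℤ - + d)      ≡⟨ cong (λ t → t + + η * + d + + μ * (+ n - 1ℤ - + d)) (ℤ.*-identityʳ (+ d)) ⟩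
        + d + + η * + d + + μ * (+ n - 1ℤ - + d) ∎
        where open ≡-Reasoning

      -- Each of the nd ordered edges is completed to a triangle by its η common neighbours.
      triangles-eq : + 6 * + triangles G ≡ + n * + d * + η
      triangles-eq = begin
        + 6 * + triangles G                              ≡⟨ six-triangles ⟨
        sum₃ (λ i j k → A i j * A j k * A i k)           ≡⟨ sum₂-cong (λ i j → trans (sum-cong-≗ (λ k → ring (A i j) (A j k) (A i k)))
                                                              (trans (sum-*ˡ (A i j) (λ k → A i k * A j k)) (on-edge i j (adj G i j) refl))) ⟩
        sum₂ (λ i j → + η * A i j)                       ≡⟨ sum₂-*ˡ (+ η) A ⟩
        + η * sum₂ A                                     ≡⟨ cong (+ η *_) (sum₂-A regular) ⟩
        + η * (+ n * + d)                                ≡⟨ ℤ.*-comm (+ η) (+ n * + d) ⟩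
        + n * + d * + η ∎
        where
        open ≡-Reasoning
        ring : ∀ a b c → a * b * c ≡ a * (c * b)
        ring = solve-∀
        on-edge : ∀ i j b → adj G i j ≡ b → A i j * sum (λ k → A i k * A j k) ≡ + η * A i j
        on-edge i j false e = trans (cong (λ b → 𝟙 b * sum (λ k → A i k * A j k)) e) (trans (ℤ.*-zeroˡ (sum (λ k → A i k * A j k)))
          (sym (trans (cong (λ b → + η * 𝟙 b) e) (ℤ.*-zeroʳ (+ η)))))
        on-edge i j true e = trans (cong₂ (λ b s → 𝟙 b * s) e (trans (sum-cong-≗ (λ k → sym (𝟙-∧ (adj G i k) (adj G j k))))
            (trans (sym (Σ[]≡sum (λ k → b2n (adj G i k ∧ adj G j k)))) (cong +_ (η-common i j i≢j e)))))
          (trans (ℤ.*-comm 1ℤ (+ η)) (cong (λ b → + η * 𝟙 b) (sym e)))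
          where
          i≢j : i ≢ j
          i≢j refl with trans (sym e) (irrefl G i)
          ... | ()

      -- ‖Ay‖² = yᵀA²y with A² = dI + ηA + μ(J - I - A); the last bracket is yᵀ(J - I - A)y.
      norm²-apply : ∀ y → norm² (apply y) ≡ + d * norm² y + + η * form y + + μ * (sum y * sum y - norm² y - form y)
      norm²-apply y = begin
        sum (λ i → apply y i * apply y i)
          ≡⟨ sum-cong-≗ (λ i → sum-sum (λ j → A i j * y j) (λ k → A i k * y k)) ⟨
        sum₃ (λ i j k → A i j * y j * (A i k * y k))
          ≡⟨ sum₃-cong (λ i j k → rearrange (y j) (y k) (A-sym i j) (A-sym i k)) ⟩
        sum₃ (λ i j k → y j * y k * (A j i * A k i))
          ≡⟨ trans (sum₃-swap₁₂ (λ j i k → y j * y k * (A j i * A k i))) (sum₃-swap₂₃ (λ j k i → y j * y k * (A j i * A k i))) ⟩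
        sum₃ (λ j k i → y j * y k * (A j i * A k i))
          ≡⟨ sum₂-cong (λ j k → trans (sum-*ˡ (y j * y k) (λ i → A j i * A k i)) (cong (y j * y k *_) (common-eq j k))) ⟩
        sum₂ (λ j k → y j * y k * (+ d * δ j k + + η * A j k + + μ * N j k))
          ≡⟨ sum₂-cong (λ j k → ring (y j) (y k) (+ d) (+ η) (+ μ) (δ j k) (A j k)) ⟩
        sum₂ (λ j k → 1ℤ * ((+ d - + μ) * (δ j k * (y j * y k)) + (+ η - + μ) * (A j k * (y j * y k))) + + μ * (y j * y k))
          ≡⟨ trans (sum₂-linear 1ℤ (+ μ) (λ j k → (+ d - + μ) * (δ j k * (y j * y k)) + (+ η - + μ) * (A j k * (y j * y k))) (λ j k → y j * y k))
               (cong₂ (λ u v → 1ℤ * u + + μ * v) (trans (sum₂-linear (+ d - + μ) (+ η - + μ) (λ j k → δ j k * (y j * y k)) (λ j k → A j k * (y j * y k)))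
                   (cong (λ t → (+ d - + μ) * t + (+ η - + μ) * form y) (sum-cong-≗ (λ j → sum-δ j (λ k → y j * y k)))))
                 (sum-sum y y)) ⟩
        1ℤ * ((+ d - + μ) * norm² y + (+ η - + μ) * form y) + + μ * (sum y * sum y)
          ≡⟨ ring′ (+ d) (+ η) (+ μ) (norm² y) (form y) (sum y) ⟩
        + d * norm² y + + η * form y + + μ * (sum y * sum y - norm² y - form y) ∎
        where
        open ≡-Reasoning
        ring₀ : ∀ a b y z → a * y * (b * z) ≡ y * z * (a * b)
        ring₀ = solve-∀
        rearrange : ∀ {a a′ b b′} y z → a ≡ a′ → b ≡ b′ → a * y * (b * z) ≡ y * z * (a′ * b′)
        rearrange {a} {_} {b} y z refl refl = ring₀ a b y z
        ring : ∀ y z d η μ δ a → y * z * (d * δ + η * a + μ * (1ℤ - δ - a)) ≡ 1ℤ * ((d - μ) * (δ * (y * z)) + (η - μ) * (a * (y * z))) + μ * (y * z)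
        ring = solve-∀
        ring′ : ∀ d η μ q f s → 1ℤ * ((d - μ) * q + (η - μ) * f) + μ * (s * s) ≡ d * q + η * f + μ * (s * s - q - f)
        ring′ = solve-∀

      -- p / q bounds the modulus of the least eigenvalue when (p / q) ^ 2 + (η - μ) (p / q) ≥ d - μ.
      upper-bound : Fin n → ∀ p q → 0ℤ ≤ p → 0ℤ ≤ q → 0ℤ < q * (+ η - + μ) + + 2 * p →
        q * q * (+ d - + μ) ≤ p * p + p * q * (+ η - + μ) → q * σ ≤ p * + n
      upper-bound i p q 0≤p 0≤q 0<g h with mc-form
      -- Replacing the signs by their projection lowers both the form and the squared norm, by
      -- multiples of the square of their sum s. Both terms in s have the favourable sign and are
      -- dropped.
      ... | S , form-S = *-cancelˡ-≤ (+ n * + n) 0<n² (≤-by (ring₃ p q (+ n) σ (+ d) s)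
          (0≤+ positive (0≤* (0≤* {+ n} 0≤n (0≤² s)) (0≤+ (0≤* 0≤q (0≤n {d})) 0≤p))))
        where
        g = q * (+ η - + μ) + + 2 * p
        s = sum (sgn S)
        y = centre (sgn S)
        F = form y
        Q = norm² y
        0<n² : 0ℤ < + n * + n
        0<n² = subst (0ℤ <_) (ℤ.pos-* n n) (+<+ (ℕ.*-mono-≤ 1≤n 1≤n))
          where 1≤n = ℕ.≤-<-trans z≤n (Fin.toℕ<n i)
        norm²-combination : norm² (λ i → q * apply y i + p * y i) ≡ q * q * norm² (apply y) + (+ 2 * p * q * F + p * p * Q)
        norm²-combination = trans (sum-cong-≗ (λ i → ring (apply y i) (y i) p q))
          (trans (∑-distrib-+ (λ i → q * q * (apply y i * apply y i)) (λ i → + 2 * p * q * (apply y i * y i) + p * p * (y i * y i)))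
            (cong₂ _+_ (sum-*ˡ (q * q) (λ i → apply y i * apply y i))
              (trans (sum-linear (+ 2 * p * q) (p * p) (λ i → apply y i * y i) (λ i → y i * y i)) (cong (λ t → + 2 * p * q * t + p * p * Q) (form-apply y)))))
          where
          ring : ∀ a y p q → (q * a + p * y) * (q * a + p * y) ≡ q * q * (a * a) + (+ 2 * p * q * (a * y) + p * p * (y * y))
          ring = solve-∀
        nonneg : 0ℤ ≤ q * g * F + (q * q * (+ d - + μ) + p * p) * Q
        nonneg = subst (0ℤ ≤_) (trans norm²-combination (trans (cong (λ t → q * q * t + (+ 2 * p * q * F + p * p * Q))
            (trans (norm²-apply y) (cong (λ t → + d * Q + + η * F + + μ * (t * t - Q - F)) (sum-centre (sgn S)))))
            (ring p q (+ d) (+ η) (+ μ) F Q)))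
          (sum-0≤ (λ i → 0≤² (q * apply y i + p * y i)))
          where
          ring : ∀ p q d η μ F Q → q * q * (d * Q + η * F + μ * (0ℤ * 0ℤ - Q - F)) + (+ 2 * p * q * F + p * p * Q)
            ≡ q * (q * (η - μ) + + 2 * p) * F + (q * q * (d - μ) + p * p) * Q
          ring = solve-∀
        0≤Q : 0ℤ ≤ Q
        0≤Q = sum-0≤ (λ i → 0≤² (y i))
        0≤qF+pQ : 0ℤ ≤ q * F + p * Q
        -- Adding the hypothesis `h`, multiplied by Q, to `nonneg` turns the coefficient of Q into
        -- `p * g`. The positive factor g then cancels.
        0≤qF+pQ = *-cancelˡ-≤ g 0<g (≤-by (ring p q (+ η - + μ) (+ d - + μ) F Q) (0≤+ nonneg (0≤* (0≤- h) 0≤Q)))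
          where
          ring : ∀ p q t u F Q → (q * t + + 2 * p) * (q * F + p * Q) - (q * t + + 2 * p) * 0ℤ
            ≡ q * (q * t + + 2 * p) * F + (q * q * u + p * p) * Q + (p * p + p * q * t - q * q * u) * Q
          ring = solve-∀
        positive : 0ℤ ≤ q * (+ n * + n * - σ - + n * + d * (s * s)) + p * (+ n * + n * + n - + n * (s * s))
        positive = subst (0ℤ ≤_) (cong₂ (λ u v → q * u + p * v)
            (trans (form-centre regular (sgn S)) (cong (λ t → + n * + n * t - + n * + d * (s * s)) form-S))
            (trans (norm²-centre (sgn S)) (cong (λ t → + n * + n * t - + n * (s * s)) (norm²-sgn S))))
          0≤qF+pQ
        ring₃ : ∀ p q n σ d s → n * n * (p * n) - n * n * (q * σ)
          ≡ q * (n * n * - σ - n * d * (s * s)) + p * (n * n * n - n * (s * s)) + n * (s * s) * (q * d + p)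
        ring₃ = solve-∀

  -- Truncated random vectors

  module LowerBound {n d η μ : ℕ} (G : Graph n) (regular : Regular G d)
    (η-common : ∀ i j → i ≢ j → adj G i j ≡ true → commonNbrs G i j ≡ η)
    (μ-common : ∀ i j → i ≢ j → adj G i j ≡ false → commonNbrs G i j ≡ μ)
    (α : ℕ) {R : ℤ} (0<R : 0ℤ < R) (wide : + 16 * (+ α * + α + + d) ≤ R * R) where

    open Surplus G
    open StronglyRegularFacts regular η-common μ-common
    open Pairs G α using (weight; pair-steps; pair-census)
    open Comparison α d 0<R wide
    open Correlation (ℤ.<⇒≤ 0<R) using (clip²)

    -- A random point of the box: row i of (A - α I) applied to random signs, truncated.
    point : Vec Bool n → Fin n → ℤ
    point S i = clip R (dot (weight i) S)

    K : Fin n → Fin n → ℤ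
    K i j = 𝕊 (λ S → point S i * point S j)

    K-walk : ∀ i j → K i j ≡ κ (pair-steps i j)
    K-walk i j = 𝕊-walk (weight i) (weight j) clip²

    private
      t m gain loss : ℤ
      t = (+ 2) ^ n
      m = + n - 1ℤ - + d
      gain = + 6 * + α + + 3 * + (μ ℕ.∸ η)
      loss = + 4 * + (η ℕ.∸ μ)

    private
      shape : ℤ → ℕ → ℕ → ℕ → List Step
      shape b s q z = (- + α , b) ∷ (b , - + α) ∷ steps s q q z

      K-shape : ∀ {i j b s q z} → pair-steps i j ↭ shape (A i j) (commonNbrs G i j) q z → adj G i j ≡ b → commonNbrs G i j ≡ s →
        K i j ≡ κ (shape (𝟙 b) s q z)
      K-shape {i} {j} {q = q} {z} list e common = trans (K-walk i j) (trans (E-↭ list clip²) (cong₂ (λ b s → κ (shape (𝟙 b) s q z)) e common))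

    pair-gap : ∀ {i j k l} → i ≢ j → adj G i j ≡ true → k ≢ l → adj G k l ≡ false →
      + 4 * K i j + t * gain ≤ + 4 * K k l + t * loss
    pair-gap {i} {j} {k} {l} i≢j e k≢l e′ = from-census (pair-census regular i≢j) (pair-census regular k≢l)
      where
      η≡ = η-common i j i≢j e
      μ≡ = μ-common k l k≢l e′
      Shape : Fin n → Fin n → Set
      Shape i j = ∃[ q ] ∃[ z ] (pair-steps i j ↭ shape (A i j) (commonNbrs G i j) q z)
        × commonNbrs G i j ℕ.+ (b2n (adj G i j) ℕ.+ q) ≡ d
        × 2 ℕ.+ (commonNbrs G i j ℕ.+ (q ℕ.+ (q ℕ.+ z))) ≡ n
      from-census : Shape i j → Shape k l → + 4 * K i j + t * gain ≤ + 4 * K k l + t * loss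
      from-census (q , z , list , d₁ , n₁) (q′ , z′ , list′ , d₂ , n₂) =
        subst₂ (λ x y → + 4 * x + t * gain ≤ + 4 * y + t * loss)
          (sym (K-shape {b = true} {η} {q} {z} list e η≡)) (sym (K-shape {b = false} {μ} {q′} {z′} list′ e′ μ≡))
          (correlation-gap n {η} {q} {z} {μ} {q′} {z′} (trans (cong₂ (λ s b → s ℕ.+ (b2n b ℕ.+ q)) (sym η≡) (sym e)) d₁)
            (trans (cong₂ (λ s b → s ℕ.+ (b2n b ℕ.+ q′)) (sym μ≡) (sym e′)) d₂)
            (trans (cong (λ s → 2 ℕ.+ (s ℕ.+ (q ℕ.+ (q ℕ.+ z)))) (sym η≡)) n₁)
            (trans (cong (λ s → 2 ℕ.+ (s ℕ.+ (q′ ℕ.+ (q′ ℕ.+ z′)))) (sym μ≡)) n₂))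

    X Y K₀ : ℤ
    X = sum₂ (λ i j → A i j * K i j)
    Y = sum₂ (λ i j → N i j * K i j)
    K₀ = sum (λ i → K i i)

    -- Half of a double average: the comparison of single pairs is summed over all edges here and
    -- over all non-edges in `average-gap`, after which only the totals X and Y remain.
    nonadjacent-bound : ∀ {k l} → k ≢ l → adj G k l ≡ false →
      + 4 * X + t * (gain - loss) * (+ n * + d) ≤ + 4 * K k l * (+ n * + d)
    nonadjacent-bound {k} {l} k≢l e′ = subst₂ _≤_
      (trans (sum₂-linear (+ 4) (t * (gain - loss)) (λ i j → A i j * K i j) A) (cong (λ a → + 4 * X + t * (gain - loss) * a) (sum₂-A regular)))
      (trans (sum₂-*ˡ (+ 4 * K k l) A) (cong (+ 4 * K k l *_) (sum₂-A regular)))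
      (sum₂-mono (λ i j → on-pair i j (adj G i j) refl))
      where
      ring : ∀ x y t g l → + 4 * y * 1ℤ - (+ 4 * (1ℤ * x) + t * (g - l) * 1ℤ) ≡ + 4 * y + t * l - (+ 4 * x + t * g)
      ring = solve-∀
      ring′ : ∀ x y t g l → + 4 * y * 0ℤ - (+ 4 * (0ℤ * x) + t * (g - l) * 0ℤ) ≡ 0ℤ
      ring′ = solve-∀
      on-pair : ∀ i j b → adj G i j ≡ b → + 4 * (A i j * K i j) + t * (gain - loss) * A i j ≤ + 4 * K k l * A i j
      on-pair i j true e = subst (λ b → + 4 * (𝟙 b * K i j) + t * (gain - loss) * 𝟙 b ≤ + 4 * K k l * 𝟙 b) (sym e)
        (≤-by (ring (K i j) (K k l) t gain loss) (0≤- (pair-gap i≢j e k≢l e′)))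
        where
        i≢j : i ≢ j
        i≢j refl with trans (sym e) (irrefl G i)
        ... | ()
      on-pair i j false e = subst (λ b → + 4 * (𝟙 b * K i j) + t * (gain - loss) * 𝟙 b ≤ + 4 * K k l * 𝟙 b) (sym e)
        (≤-by (ring′ (K i j) (K k l) t gain loss) ℤ.≤-refl)

    average-gap : + n * m * (+ 4 * X + t * (gain - loss) * (+ n * + d)) ≤ + 4 * (+ n * + d) * Y
    average-gap = subst₂ _≤_
      (trans (sum₂-*ˡ P N) (trans (cong (P *_) sum₂-N) (ℤ.*-comm P (+ n * m))))
      (sum₂-*ˡ (+ 4 * (+ n * + d)) (λ k l → N k l * K k l))
      (sum₂-mono on-pair)
      where
      P = + 4 * X + t * (gain - loss) * (+ n * + d)
      ring : ∀ p a k → + 4 * a * (1ℤ * k) - p * 1ℤ ≡ + 4 * k * a - p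
      ring = solve-∀
      ring′ : ∀ p a k → + 4 * a * (0ℤ * k) - p * 0ℤ ≡ 0ℤ
      ring′ = solve-∀
      on-pair : ∀ k l → P * N k l ≤ + 4 * (+ n * + d) * (N k l * K k l)
      on-pair k l with N-cases k l
      ... | inj₁ e = subst (λ ν → P * ν ≤ + 4 * (+ n * + d) * (ν * K k l)) (sym e) (≤-by (ring′ P (+ n * + d) (K k l)) ℤ.≤-refl)
      ... | inj₂ (e , k≢l , e′) = subst (λ ν → P * ν ≤ + 4 * (+ n * + d) * (ν * K k l)) (sym e)
        (≤-by (ring P (+ n * + d) (K k l)) (0≤- (nonadjacent-bound k≢l e′)))

    2K≤ : ∀ i j → + 2 * K i j ≤ K i i + K j j
    2K≤ i j = subst₂ _≤_ (𝕊-*ˡ (+ 2) (λ S → point S i * point S j)) (𝕊-+ (λ S → point S i * point S i) (λ S → point S j * point S j))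
      (𝕊-mono (λ S → ≤-by (ring (point S i) (point S j)) (0≤² (point S i - point S j))))
      where
      ring : ∀ x y → x * x + y * y - + 2 * (x * y) ≡ (x - y) * (x - y)
      ring = solve-∀

    -- By `2xy ≤ x² + y²` on every edge. It pays for a surplus copy of X: as n - d is m + 1, `Z`
    -- contains X once more than the comparison with Y can use, but also contains `- d K₀`.
    X≤dK₀ : X ≤ + d * K₀
    X≤dK₀ = *-cancelˡ-≤ (+ 2) (+<+ (s≤s z≤n)) (subst₂ _≤_ (sum₂-*ˡ (+ 2) (λ i j → A i j * K i j))
      (trans (sum₂-+ (λ i j → A i j * K i i) (λ i j → A i j * K j j))
        (trans (cong₂ _+_ (sum₂-A-left regular (λ i → K i i)) (sum₂-A-right regular (λ i → K i i))) (ring (+ d * K₀))))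
      (sum₂-mono (λ i j → ≤-by (ring′ (A i j) (K i j) (K i i) (K j j)) (0≤* (0≤n {b2n (adj G i j)}) (0≤- (2K≤ i j))))))
      where
      ring : ∀ x → x + x ≡ + 2 * x
      ring = solve-∀
      ring′ : ∀ a k x y → a * x + a * y - + 2 * (a * k) ≡ a * (x + y - + 2 * k)
      ring′ = solve-∀

    -- The matrix nA - dJ is n times the part of A acting on the complement of the all-ones vector,
    -- so Z is the sum of `form (centre x)` over the random points x, divided by n.
    Z : ℤ
    Z = sum₂ (λ i j → (+ n * A i j - + d) * K i j)

    Z-eq : Z ≡ + n * X - + d * (K₀ + X + Y)
    Z-eq = trans (sum₂-cong (λ i j → ring (+ n) (+ d) (A i j) (δ i j) (K i j)))
      (trans (sum₂-linear (+ n) (- + d) (λ i j → A i j * K i j) (λ i j → δ i j * K i j + A i j * K i j + N i j * K i j))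
      (trans (cong (λ s → + n * X + - + d * s) (trans (sum₂-+ (λ i j → δ i j * K i j + A i j * K i j) (λ i j → N i j * K i j))
        (cong (_+ Y) (trans (sum₂-+ (λ i j → δ i j * K i j) (λ i j → A i j * K i j)) (cong (_+ X) (sum-cong-≗ (λ i → sum-δ i (K i))))))))
        (ring′ (+ n) (+ d) X (K₀ + X + Y))))
      where
      ring : ∀ n d a δ k → (n * a - d) * k ≡ n * (a * k) + - d * (δ * k + a * k + (1ℤ - δ - a) * k)
      ring = solve-∀
      ring′ : ∀ n d x y → n * x + - d * y ≡ n * x - d * y
      ring′ = solve-∀

    point-bound : Fin n → ∀ S → 0ℤ ≤ sum₂ (λ i j → (+ n * A i j - + d) * (point S i * point S j)) + + 4 * + n * (R * R) * σ
    point-bound i₀ S = subst (λ f → 0ℤ ≤ f + + 4 * + n * (R * R) * σ) (sym expand) (*-cancelˡ-≤ (+ n) 0<n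
      (≤-by (ring (+ n) (+ d) R σ (form x) s) (0≤- (subst (- (B * B * σ) ≤_) (form-centre regular x) (form-box 0<B (centre x) box)))))
      where
      x = point S
      s = sum x
      -- Both `n * x i` and the sum of the coordinates have modulus at most nR.
      B = + 2 * (+ n * R)
      0<n : 0ℤ < + n
      0<n = +<+ (ℕ.≤-<-trans z≤n (Fin.toℕ<n i₀))
      0<B : 0ℤ < B
      0<B = 0<* {+ 2} (+<+ (s≤s z≤n)) (0<* 0<n 0<R)
      bounds : ∀ i → - R ≤ x i × x i ≤ R
      bounds i = clip-bounds (ℤ.<⇒≤ 0<R) (dot (weight i) S)
      s-lower : + n * - R ≤ s
      s-lower = subst (_≤ s) (sum-const {n} (- R)) (sum-mono (λ i → proj₁ (bounds i)))
      s-upper : s ≤ + n * R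
      s-upper = subst (s ≤_) (sum-const {n} R) (sum-mono (λ i → proj₂ (bounds i)))
      box : ∀ i → - B ≤ centre x i × centre x i ≤ B
      box i = ≤-by (ring₁ (+ n) R (x i) s) (0≤+ (0≤* {+ n} 0≤n (0≤- (proj₁ (bounds i)))) (0≤- s-upper))
            , ≤-by (ring₂ (+ n) R (x i) s) (0≤+ (0≤* {+ n} 0≤n (0≤- (proj₂ (bounds i)))) (0≤- s-lower))
        where
        ring₁ : ∀ n R x s → n * x - s - - (+ 2 * (n * R)) ≡ n * (x - - R) + (n * R - s)
        ring₁ = solve-∀
        ring₂ : ∀ n R x s → + 2 * (n * R) - (n * x - s) ≡ n * (R - x) + (s - n * - R)
        ring₂ = solve-∀
      expand : sum₂ (λ i j → (+ n * A i j - + d) * (x i * x j)) ≡ + n * form x - + d * (s * s)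
      expand = trans (sum₂-cong (λ i j → ring (+ n) (+ d) (A i j) (x i * x j)))
        (trans (sum₂-linear (+ n) (- + d) (λ i j → A i j * (x i * x j)) (λ i j → x i * x j))
        (trans (cong (λ t → + n * form x + - + d * t) (sum-sum x x)) (ring′ (+ n) (+ d) (form x) (s * s))))
        where
        ring : ∀ n d a p → (n * a - d) * p ≡ n * (a * p) + - d * p
        ring = solve-∀
        ring′ : ∀ n d f s → n * f + - d * s ≡ n * f - d * s
        ring′ = solve-∀
      ring : ∀ n d R σ f s → n * (n * f - d * (s * s) + + 4 * n * (R * R) * σ) - n * 0ℤ
        ≡ n * n * f - n * d * (s * s) - - (+ 2 * (n * R) * (+ 2 * (n * R)) * σ)
      ring = solve-∀

    Z-bound : Fin n → 0ℤ ≤ Z + t * (+ 4 * + n * (R * R) * σ)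
    Z-bound i₀ = subst (0ℤ ≤_)
      (trans (𝕊-+ (λ S → sum₂ (λ i j → (+ n * A i j - + d) * (point S i * point S j))) (λ _ → + 4 * + n * (R * R) * σ))
        (cong₂ _+_
          (trans (𝕊-sum (λ i S → sum (λ j → (+ n * A i j - + d) * (point S i * point S j))))
            (sum-cong-≗ (λ i → trans (𝕊-sum (λ j S → (+ n * A i j - + d) * (point S i * point S j)))
              (sum-cong-≗ (λ j → 𝕊-*ˡ (+ n * A i j - + d) (λ S → point S i * point S j))))))
          (𝕊-const {n} (+ 4 * + n * (R * R) * σ))))
      (subst (_≤ 𝕊 (λ S → sum₂ (λ i j → (+ n * A i j - + d) * (point S i * point S j)) + + 4 * + n * (R * R) * σ))
        (trans (𝕊-const {n} 0ℤ) (ℤ.*-zeroʳ t)) (𝕊-mono (point-bound i₀)))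

    -- By `Z-eq`, Z is `mX - dY` plus `X - dK₀ ≤ 0`. `average-gap` puts `mX - dY` at or below
    -- `- n d m t (gain - loss) / 4`, while `Z-bound` keeps Z at or above `- 4 n R² σ t`.
    lower-bound : Fin n → + d * m * (gain - loss) ≤ + 16 * (R * R) * σ
    lower-bound i₀ = *-cancelˡ-≤ (+ n * + n * t) 0<n²t
      (≤-by (trans (ring (+ n) (+ d) t R σ (gain - loss) X Y K₀)
          (cong (λ z → + 4 * + n * (z + t * (+ 4 * + n * (R * R) * σ)) + (+ 4 * (+ n * + d) * Y - + n * m * (+ 4 * X + t * (gain - loss) * (+ n * + d))) + + 4 * + n * (+ d * K₀ - X)) (sym Z-eq)))
        (0≤+ (0≤+ (0≤* 0≤4n (Z-bound i₀)) (0≤- average-gap)) (0≤* 0≤4n (0≤- X≤dK₀))))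
      where
      ring : ∀ n d t R σ e X Y K →
        n * n * t * (+ 16 * (R * R) * σ) - n * n * t * (d * (n - 1ℤ - d) * e)
        ≡ + 4 * n * ((n * X - d * (K + X + Y)) + t * (+ 4 * n * (R * R) * σ)) + (+ 4 * (n * d) * Y - n * (n - 1ℤ - d) * (+ 4 * X + t * e * (n * d))) + + 4 * n * (d * K - X)
      ring = solve-∀
      0<n²t : 0ℤ < + n * + n * t
      0<n²t = 0<* (0<* 0<n 0<n) (0<2^ n)
        where
        0<n : 0ℤ < + n
        0<n = +<+ (ℕ.≤-<-trans z≤n (Fin.toℕ<n i₀))
      0≤4n : 0ℤ ≤ + 4 * + n
      0≤4n = 0≤* {+ 4} {+ n} 0≤n 0≤n

  -- An integer substitute for √d. The root is increased only when its square is exactly the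
  -- preceding number, and then the new root is at most twice the old one.
  sqrt-between : ∀ d → 1 ℕ.≤ d → ∃[ r ] (1 ℕ.≤ r × d ℕ.≤ r ℕ.* r × r ℕ.* r ℕ.≤ 4 ℕ.* d)
  sqrt-between (suc zero) _ = 1 , s≤s z≤n , s≤s z≤n , s≤s z≤n
  sqrt-between (suc (suc d)) _ with sqrt-between (suc d) (s≤s z≤n)
  ... | r , 1≤r , lo , hi with suc (suc d) ℕ.≤? r ℕ.* r
  ... | yes p = r , 1≤r , p , ℕ.≤-trans hi (ℕ.*-monoʳ-≤ 4 (ℕ.n≤1+n (suc d)))
  ... | no ¬p = suc r , s≤s z≤n , lo′ , hi′
    where
    r²≡ : r ℕ.* r ≡ suc d
    r²≡ = ℕ.≤-antisym (ℕ.s≤s⁻¹ (ℕ.≰⇒> ¬p)) lo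
    lo′ : suc (suc d) ℕ.≤ suc r ℕ.* suc r
    lo′ = subst (λ x → suc x ℕ.≤ suc r ℕ.* suc r) r²≡ (subst (suc (r ℕ.* r) ℕ.≤_) (sym (arith r)) (s≤s (ℕ.m≤m+n (r ℕ.* r) (r ℕ.+ r))))
      where
      arith : ∀ r → suc r ℕ.* suc r ≡ suc (r ℕ.* r ℕ.+ (r ℕ.+ r))
      arith = ℕ-Solver.solve-∀
    hi′ : suc r ℕ.* suc r ℕ.≤ 4 ℕ.* suc (suc d)
    hi′ = ℕ.≤-trans (ℕ.≤-trans (ℕ.*-mono-≤ (ℕ.+-monoˡ-≤ r 1≤r) (ℕ.+-monoˡ-≤ r 1≤r)) (ℕ.≤-reflexive (arith r)))
      (ℕ.*-monoʳ-≤ 4 (ℕ.≤-trans (ℕ.≤-reflexive r²≡) (ℕ.n≤1+n (suc d))))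
      where
      arith : ∀ r → (r ℕ.+ r) ℕ.* (r ℕ.+ r) ≡ 4 ℕ.* (r ℕ.* r)
      arith = ℕ-Solver.solve-∀

  sqrt-mono : ∀ {a b} → 0ℤ ≤ b → a * a ≤ b * b → a ≤ b
  sqrt-mono {a} {b} 0≤b h with a ℤ.≤? b
  ... | yes p = p
  ... | no ¬p = contradiction (ℤ.<-≤-trans (0<* a-b a+b) (subst (_≤ 0ℤ) (ring a b) (ℤ.i≤j⇒i-j≤0 h))) (ℤ.<-irrefl refl)
    where
    b<a = ℤ.≰⇒> ¬p
    a-b : 0ℤ < a - b
    a-b = subst (_< a - b) (ℤ.+-inverseʳ b) (ℤ.+-monoˡ-< (- b) b<a)
    a+b : 0ℤ < a + b
    a+b = ℤ.+-mono-<-≤ (ℤ.≤-<-trans 0≤b b<a) 0≤b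
    ring : ∀ a b → a * a - b * b ≡ (a - b) * (a + b)
    ring = solve-∀

  -- The excess of triangles and the parameters

  module IntegerBounds {n d η μ : ℕ} (G : Graph n) (regular : Regular G d)
    (η-common : ∀ i j → i ≢ j → adj G i j ≡ true → commonNbrs G i j ≡ η)
    (μ-common : ∀ i j → i ≢ j → adj G i j ≡ false → commonNbrs G i j ≡ μ)
    (1≤d : 1 ℕ.≤ d) (sparse : 100 ℕ.* d ℕ.≤ 99 ℕ.* n) (i₀ : Fin n) where

    open Surplus G
    open StronglyRegularFacts regular η-common μ-common

    -- d / 6 times T is the excess of triangles over d³/6.
    T m : ℤ
    T = + n * + η - + d * + d
    m = + n - 1ℤ - + d

    0<n : 0ℤ < + n
    0<n = +<+ (ℕ.≤-<-trans z≤n (Fin.toℕ<n i₀))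
    0<d : 0ℤ < + d
    0<d = +<+ 1≤d
    1≤n : 0ℤ ≤ + n - 1ℤ
    1≤n = 0≤- (+≤+ (ℕ.≤-<-trans z≤n (Fin.toℕ<n i₀)))
    0≤d-1 : 0ℤ ≤ + d - 1ℤ
    0≤d-1 = 0≤- (+≤+ 1≤d)
    pos : ∀ {x} → 0ℤ < x → 0ℤ ≤ x
    pos = ℤ.<⇒≤

    0<σ : 0ℤ < σ
    0<σ = σ-positive regular i₀ 1≤d

    -- The parameter equation solved for η - μ. It makes `m * (η - μ)` equal to T up to the error d
    -- - η, which lies between 0 and d; this is how the number of triangles controls the spectrum.
    m[η-μ] : m * (+ η - + μ) ≡ T - + η + + d
    m[η-μ] = trans (ring (+ n) (+ d) (+ η) (+ μ)) (trans (cong (λ t → + n * + η - + η - + d * + η - (t - + d - + η * + d)) (sym (parameters i₀))) (ring′ (+ n) (+ d) (+ η)))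
      where
      ring : ∀ n d η μ → (n - 1ℤ - d) * (η - μ) ≡ n * η - η - d * η - (d + η * d + μ * (n - 1ℤ - d) - d - η * d)
      ring = solve-∀
      ring′ : ∀ n d η → n * η - η - d * η - (d * d - d - η * d) ≡ n * η - d * d - η + d
      ring′ = solve-∀

    -- The parameter equation reads `d * (d - η - 1) = μ * m`, and the right side is nonnegative.
    η<d : + η + 1ℤ ≤ + d
    η<d = *-cancelˡ-≤ (+ d) 0<d (≤-by (trans (ring (+ d) (+ η)) (trans (cong (λ t → t - + d - + η * + d) (parameters i₀)) (ring′ (+ d) (+ η) (+ μ * m))))
      (0≤* (0≤n {μ}) (0≤m i₀)))
      where
      ring : ∀ d η → d * d - d * (η + 1ℤ) ≡ d * d - d - η * d
      ring = solve-∀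
      ring′ : ∀ d η x → d + η * d + x - d - η * d ≡ x
      ring′ = solve-∀

    0≤d-η : 0ℤ ≤ + d - + η
    0≤d-η = ≤-by (ring (+ d) (+ η)) (0≤+ (0≤- η<d) (0≤n {1}))
      where
      ring : ∀ d η → d - η - 0ℤ ≡ d - (η + 1ℤ) + 1ℤ
      ring = solve-∀

    -- Removes truncated subtraction from gain minus loss: `3 (μ ∸ η) - 4 (η ∸ μ)` is
    -- `- 3 (η - μ) - (η ∸ μ)`, and the last term costs at most one α because η - μ ≤ α. Hence 6 α
    -- becomes 5 α.
    lower : ∀ α r → 1 ℕ.≤ r → d ℕ.≤ r ℕ.* r → + η - + μ ≤ + α →
      + d * m * (+ 5 * + α - + 3 * (+ η - + μ)) ≤ + 256 * ((+ α + + r) * (+ α + + r)) * σ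
    lower α r 1≤r d≤r² η≤μ+α = ℤ.≤-trans
      (≤-by (ring (+ d * m) (+ α) (+ η) (+ μ) (+ (μ ℕ.∸ η)) (+ (η ℕ.∸ μ)))
        (0≤+ (0≤* (0≤* (pos 0<d) (0≤m i₀)) (0≤- ∸≤α)) (0≤* (0≤* (pos 0<d) (0≤m i₀)) (0≤* {+ 3} 0≤n (subst (0ℤ ≤_) (sym ∸-eq) ℤ.≤-refl)))))
      (ℤ.≤-trans (LowerBound.lower-bound G regular η-common μ-common α 0<R wide i₀) (ℤ.≤-reflexive (ring′ (+ α) (+ r) σ)))
      where
      -- As d ≤ r², the square of R is at least 16 (α² + d); and 16 R² is the 256 (α + r)² of the
      -- statement.
      R = + 4 * (+ α + + r)
      0<R : 0ℤ < R
      0<R = 0<* {+ 4} (+<+ (s≤s z≤n)) (ℤ.+-mono-≤-< (0≤n {α}) (+<+ 1≤r))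
      wide : + 16 * (+ α * + α + + d) ≤ R * R
      wide = ≤-by (ring″ (+ α) (+ r) (+ d)) (0≤+ (0≤* {+ 16} 0≤n (0≤- d≤)) (0≤* {+ 32} 0≤n (0≤* (0≤n {α}) (0≤n {r}))))
        where
        d≤ : + d ≤ + r * + r
        d≤ = subst (+ d ≤_) (ℤ.pos-* r r) (+≤+ d≤r²)
        ring″ : ∀ a r d → + 4 * (a + r) * (+ 4 * (a + r)) - + 16 * (a * a + d) ≡ + 16 * (r * r - d) + + 32 * (a * r)
        ring″ = solve-∀
      ∸≤α : + (η ℕ.∸ μ) ≤ + α
      ∸≤α with ℕ.≤-total μ η
      ... | inj₁ μ≤η = subst (_≤ + α) (sym (trans (sym (ℤ.⊖-≥ μ≤η)) (sym (ℤ.m-n≡m⊖n η μ)))) η≤μ+α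
      ... | inj₂ η≤μ = subst (λ t → + t ≤ + α) (sym (ℕ.m≤n⇒m∸n≡0 η≤μ)) 0≤n
      ∸-eq : + (μ ℕ.∸ η) - + (η ℕ.∸ μ) + (+ η - + μ) ≡ 0ℤ
      ∸-eq with ℕ.≤-total μ η
      ... | inj₁ μ≤η = trans (cong₂ (λ a b → + a - b + (+ η - + μ)) (ℕ.m≤n⇒m∸n≡0 μ≤η) (trans (sym (ℤ.⊖-≥ μ≤η)) (sym (ℤ.m-n≡m⊖n η μ)))) (cancel (+ η) (+ μ))
        where
        cancel : ∀ x y → 0ℤ - (x - y) + (x - y) ≡ 0ℤ
        cancel = solve-∀
      ... | inj₂ η≤μ = trans (cong₂ (λ a b → a - + b + (+ η - + μ)) (trans (sym (ℤ.⊖-≥ η≤μ)) (sym (ℤ.m-n≡m⊖n μ η))) (ℕ.m≤n⇒m∸n≡0 η≤μ)) (cancel (+ η) (+ μ))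
        where
        cancel : ∀ x y → y - x - 0ℤ + (x - y) ≡ 0ℤ
        cancel = solve-∀
      ring : ∀ c a η μ u v → c * (+ 6 * a + + 3 * u - + 4 * v) - c * (+ 5 * a - + 3 * (η - μ))
        ≡ c * (a - v) + c * (+ 3 * (u - v + (η - μ)))
      ring = solve-∀
      ring′ : ∀ a r σ → + 16 * (+ 4 * (a + r) * (+ 4 * (a + r))) * σ ≡ + 256 * ((a + r) * (a + r)) * σ
      ring′ = solve-∀

  -- The three regimes

  -- The choice α = 0. Then `- 3 d m h ≤ u r² σ ≤ 4 u d σ`, and `- m h ≥ - T - d ≥ - T / 2`, so the
  -- factor d cancels.
  negative-lower : ∀ {d m h T η r σ u v} → 0ℤ < d → 0ℤ ≤ σ → 0ℤ ≤ η → 0ℤ ≤ - T → 0ℤ ≤ u → v ≡ 0ℤ →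
    d * m * (+ 5 * v - + 3 * h) ≤ u * ((v + r) * (v + r)) * σ → r * r ≤ + 4 * d →
    m * h ≤ T - η + d → + 2 * d ≤ - T → - T ≤ + 4 * u * σ
  negative-lower {d} {m} {h} {T} {η} {r} {σ} {u} 0<d 0≤σ 0≤η 0≤τ 0≤u refl corr r²≤4d mh≤ 2d≤τ =
    *-cancelˡ-≤ (d * + 2) (0<* {d} {+ 2} 0<d (+<+ (s≤s z≤n))) (≤-by (ring d m h T η r σ u)
      (0≤+ (0≤+ (0≤* {+ 2} 0≤n (0≤- corr)) (0≤* (0≤* (0≤* {+ 2} 0≤n 0≤u) 0≤σ) (0≤- r²≤4d)))
        (0≤+ (0≤* (0≤* {+ 6} 0≤n (ℤ.<⇒≤ 0<d)) (0≤- mh≤))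
             (0≤* (ℤ.<⇒≤ 0<d) (0≤+ (0≤+ (0≤* {+ 3} 0≤n (0≤- 2d≤τ)) 0≤τ) (0≤* {+ 6} 0≤n 0≤η))))))
    where
    ring : ∀ d m h T η r σ u → d * + 2 * (+ 4 * u * σ) - d * + 2 * - T
      ≡ + 2 * (u * ((0ℤ + r) * (0ℤ + r)) * σ - d * m * (+ 5 * 0ℤ - + 3 * h)) + + 2 * u * σ * (+ 4 * d - r * r)
        + (+ 6 * d * (T - η + d - m * h) + d * (+ 3 * (- T - + 2 * d) + - T + + 6 * η))
    ring = solve-∀

  -- The choice α = h. Since r ≤ h, `(h + r)² ≤ 4 h²`, so one factor h cancels and `2 d m ≤ 4 v h σ`
  -- remains. The other h is turned into T / n by `n h ≤ w T`.
  positive-lower : ∀ {n d m h T r σ u v w} → 0ℤ ≤ n → 0ℤ ≤ d → 0ℤ < h → 0ℤ ≤ r → 0ℤ ≤ σ → r ≤ h → 0ℤ ≤ u → 0ℤ ≤ v →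
    d * m * (+ 5 * h - + 3 * h) ≤ v * ((h + r) * (h + r)) * σ → n * h ≤ w * T → 0ℤ ≤ + 2 * u * m - n →
    n * n * d ≤ u * (+ 4 * v * w) * (T * σ)
  positive-lower {n} {d} {m} {h} {T} {r} {σ} {u} {v} {w} 0≤n′ 0≤d 0<h 0≤r 0≤σ r≤h 0≤u 0≤v corr nh≤wT n≤2um =
    ≤-by (ring′ n d m h T σ u v w) (0≤+ (0≤* (0≤* (0≤* 0≤u (0≤* {+ 4} 0≤n 0≤v)) 0≤σ) (0≤- nh≤wT))
      (0≤+ (0≤* (0≤* 0≤u 0≤n′) (0≤- 2dm≤)) (0≤* (0≤* 0≤n′ 0≤d) n≤2um)))
    where
    ring : ∀ d m h r σ v → h * (+ 4 * v * h * σ) - h * (+ 2 * d * m)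
      ≡ v * ((h + r) * (h + r)) * σ - d * m * (+ 5 * h - + 3 * h) + v * σ * ((h - r) * (+ 3 * h + r))
    ring = solve-∀
    ring′ : ∀ n d m h T σ u v w → u * (+ 4 * v * w) * (T * σ) - n * n * d
      ≡ u * (+ 4 * v) * σ * (w * T - n * h) + (u * n * (+ 4 * v * h * σ - + 2 * d * m) + n * d * (+ 2 * u * m - n))
    ring′ = solve-∀
    2dm≤ : + 2 * d * m ≤ + 4 * v * h * σ
    2dm≤ = *-cancelˡ-≤ h 0<h (≤-by (ring d m h r σ v)
      (0≤+ (0≤- corr) (0≤* (0≤* 0≤v 0≤σ) (0≤* (0≤- r≤h) (0≤+ (0≤* {+ 3} 0≤n (ℤ.<⇒≤ 0<h)) 0≤r)))))

  -- The choice α = a r. Here `5 α - 3 h ≥ 2 α`, so `2 a d m r ≤ v (a + 1)² r² σ`; on the left m is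
  -- comparable to n and d to r², so r² cancels.
  small-lower : ∀ {n d m h r σ a u v} → 0ℤ ≤ n → 0ℤ ≤ d → 0ℤ ≤ m → 0ℤ < r → 0ℤ ≤ a - 1ℤ → 0ℤ ≤ u → h ≤ a * r →
    d * m * (+ 5 * (a * r) - + 3 * h) ≤ v * ((a * r + r) * (a * r + r)) * σ →
    0ℤ ≤ u * m - n → 0ℤ ≤ + 4 * d - r * r → n * r ≤ + 4 * u * (v * ((a + 1ℤ) * (a + 1ℤ))) * σ
  small-lower {n} {d} {m} {h} {r} {σ} {a} {u} {v} 0≤n′ 0≤d 0≤m 0<r 1≤a 0≤u h≤ corr n≤um r²≤4d =
    *-cancelˡ-≤ (r * r) (0<* 0<r 0<r) (≤-by (ring n d m h r σ a u v)
      (0≤+ (0≤+ (0≤* 0≤4u (0≤- corr)) (0≤* (0≤* (0≤* (0≤* {+ 3} 0≤n 0≤4u) 0≤d) 0≤m) (0≤- h≤)))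
        (0≤+ (0≤* (0≤* (0≤* (0≤* 0≤4u (0≤+ (0≤* {+ 2} 0≤n 1≤a) (0≤n {1}))) 0≤d) 0≤m) 0≤r)
             (0≤* 0≤r (0≤+ (0≤* (0≤* {+ 4} 0≤n 0≤d) n≤um) (0≤* 0≤n′ r²≤4d))))))
    where
    0≤r = ℤ.<⇒≤ 0<r
    0≤4u = 0≤* {+ 4} {u} 0≤n 0≤u
    ring : ∀ n d m h r σ a u v → r * r * (+ 4 * u * (v * ((a + 1ℤ) * (a + 1ℤ))) * σ) - r * r * (n * r)
      ≡ + 4 * u * (v * ((a * r + r) * (a * r + r)) * σ - d * m * (+ 5 * (a * r) - + 3 * h)) + + 3 * (+ 4 * u) * d * m * (a * r - h)
        + (+ 4 * u * (+ 2 * (a - 1ℤ) + 1ℤ) * d * m * r + r * (+ 4 * d * (u * m - n) + n * (+ 4 * d - r * r)))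
    ring = solve-∀

  -- With boundedly many vertices any σ ≥ 1 suffices: `n r ≤ n r² ≤ 4 n d ≤ 4 u²`.
  complete-lower : ∀ {n d r σ u C} → 0ℤ ≤ n → 0ℤ ≤ C → 0ℤ ≤ C - + 4 * u * u → 1ℤ ≤ σ → 0ℤ ≤ u → 0ℤ ≤ u - n → 0ℤ ≤ n - d → 0ℤ ≤ r → 0ℤ ≤ r - 1ℤ →
    0ℤ ≤ + 4 * d - r * r → n * r ≤ C * σ
  complete-lower {n} {d} {r} {σ} {u} {C} 0≤n′ 0≤C C≥ 1≤σ 0≤u n≤u d≤n 0≤r 1≤r r²≤4d =
    ≤-by (ring n d r σ u C) (0≤+ (0≤+ (0≤* 0≤C (0≤- 1≤σ)) C≥)
      (0≤+ (0≤* (0≤* {+ 4} 0≤n 0≤u) n≤u) (0≤* 0≤n′ (0≤+ (0≤* 0≤r 1≤r) (0≤+ r²≤4d (0≤* {+ 4} 0≤n (0≤+ n≤u d≤n)))))))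
    where
    ring : ∀ n d r σ u C → C * σ - n * r
      ≡ C * (σ - 1ℤ) + (C - + 4 * u * u) + (+ 4 * u * (u - n) + n * (r * (r - 1ℤ) + (+ 4 * d - r * r + + 4 * (u - n + (n - d)))))
    ring = solve-∀

  complete-upper : ∀ {n d r} → 0ℤ ≤ n → 0ℤ ≤ + 100 - n → 0ℤ ≤ n - d → 0ℤ ≤ r - 1ℤ → n * d ≤ + 1401 * r * n
  complete-upper {n} {d} {r} 0≤n′ n≤100 d≤n 1≤r = ≤-by (ring n d r)
    (0≤* 0≤n′ (0≤+ (0≤* {+ 1401} 0≤n 1≤r) (0≤+ (0≤+ n≤100 d≤n) (0≤n {1301}))))
    where
    ring : ∀ n d r → + 1401 * r * n - n * d ≡ n * (+ 1401 * (r - 1ℤ) + (+ 100 - n + (n - d) + + 1301))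
    ring = solve-∀

  squared-lower : ∀ {C n d r σ} → 0ℤ ≤ C → 0ℤ ≤ n → 0ℤ ≤ r → 0ℤ ≤ σ → n * r ≤ C * σ → 0ℤ ≤ r * r - d → n * n * d ≤ C * C * (σ * σ)
  squared-lower {C} {n} {d} {r} {σ} 0≤C 0≤n′ 0≤r 0≤σ nr≤ d≤r² = ≤-by (ring n d r σ C)
    (0≤+ (0≤* (0≤- nr≤) (0≤+ (0≤* 0≤C 0≤σ) (0≤* 0≤n′ 0≤r))) (0≤* (0≤* 0≤n′ 0≤n′) d≤r²))
    where
    ring : ∀ n d r σ C → C * C * (σ * σ) - n * n * d ≡ (C * σ - n * r) * (C * σ + n * r) + n * n * (r * r - d)
    ring = solve-∀

  squared-upper : ∀ {n d r σ k} → 0ℤ ≤ n → 0ℤ ≤ r → 0ℤ ≤ σ → 0ℤ ≤ k → σ ≤ k * r * n → 0ℤ ≤ + 4 * d - r * r → σ * σ ≤ + 4 * (k * k) * (n * n * d)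
  squared-upper {n} {d} {r} {σ} {k} 0≤n′ 0≤r 0≤σ 0≤k σ≤ r²≤4d = ≤-by (ring n d r σ k)
    (0≤+ (0≤* (0≤- σ≤) (0≤+ (0≤* (0≤* 0≤k 0≤r) 0≤n′) 0≤σ)) (0≤* (0≤* (0≤* (0≤* 0≤k 0≤k) 0≤n′) 0≤n′) r²≤4d))
    where
    ring : ∀ n d r σ k → + 4 * (k * k) * (n * n * d) - σ * σ
      ≡ (k * r * n - σ) * (k * r * n + σ) + k * k * n * n * (+ 4 * d - r * r)
    ring = solve-∀

  -- The hypothesis of `upper-bound` for the fraction k r / 1:
  -- `k r (k r + h) ≥ k (k - j) r² ≥ r² ≥ d`.
  small-condition : ∀ {r h d μ j k} → 0ℤ ≤ r → 0ℤ ≤ k → 0ℤ ≤ (k - j) * k - 1ℤ → 0ℤ ≤ h + j * r → 0ℤ ≤ r * r - d → 0ℤ ≤ μ →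
    1ℤ * 1ℤ * (d - μ) ≤ k * r * (k * r) + k * r * 1ℤ * h
  small-condition {r} {h} {d} {μ} {j} {k} 0≤r 0≤k j<k 0≤h d≤r² 0≤μ = ≤-by (ring r h d μ j k)
    (0≤+ (0≤* (0≤* 0≤k 0≤r) 0≤h) (0≤+ (0≤* j<k (0≤² r)) (0≤+ d≤r² 0≤μ)))
    where
    ring : ∀ r h d μ j k → k * r * (k * r) + k * r * 1ℤ * h - 1ℤ * 1ℤ * (d - μ)
      ≡ k * r * (h + j * r) + (((k - j) * k - 1ℤ) * (r * r) + (r * r - d + μ))
    ring = solve-∀

  -- Here 1200 is 6 · 200: `m h ≥ T ≥ - 6 n r`, and n ≤ 200 m.
  small-h-lower : ∀ {n d η m h T r} → 0ℤ < m → T - η + d ≤ m * h → - T ≤ + 6 * n * r → 0ℤ ≤ d - η → 0ℤ ≤ r → 0ℤ ≤ + 200 * m - n → 0ℤ ≤ h + + 1200 * r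
  small-h-lower {n} {d} {η} {m} {h} {T} {r} 0<m ≤mh T≥ η≤d 0≤r n≤200m = *-cancelˡ-≤ m 0<m (≤-by (ring n d η m h T r)
    (0≤+ (0≤- ≤mh) (0≤+ (0≤- T≥) (0≤+ η≤d (0≤* (0≤* {+ 6} 0≤n 0≤r) n≤200m)))))
    where
    ring : ∀ n d η m h T r → m * (h + + 1200 * r) - m * 0ℤ ≡ m * h - (T - η + d) + (+ 6 * n * r - - T + (d - η + + 6 * r * (+ 200 * m - n)))
    ring = solve-∀

  -- Here 1400 is 7 · 200: the error d - η in `m h` is at most n r, which raises the 6 n r bounding
  -- T to 7 n r.
  small-h-upper : ∀ {n d η h T r} → 0ℤ ≤ n → 0ℤ ≤ η → 0ℤ < n - 1ℤ - d → (n - 1ℤ - d) * h ≤ T - η + d → T ≤ + 6 * n * r → 0ℤ ≤ r → 0ℤ ≤ r - 1ℤ →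
    0ℤ ≤ + 200 * (n - 1ℤ - d) - n → h ≤ + 1400 * r
  small-h-upper {n} {d} {η} {h} {T} {r} 0≤n′ 0≤η 0<m mh≤ T≤ 0≤r 1≤r n≤200m = *-cancelˡ-≤ (n - 1ℤ - d) 0<m (≤-by (ring n d η h T r)
    (0≤+ (0≤+ (0≤- mh≤) (0≤* (0≤* {+ 7} 0≤n n≤200m) 0≤r)) (0≤+ (0≤- T≤) (0≤+ (0≤+ (0≤* 0≤n′ 1≤r) (ℤ.<⇒≤ 0<m)) (0≤+ (0≤n {1}) 0≤η)))))
    where
    ring : ∀ n d η h T r → (n - 1ℤ - d) * (+ 1400 * r) - (n - 1ℤ - d) * h
      ≡ T - η + d - (n - 1ℤ - d) * h + + 7 * (+ 200 * (n - 1ℤ - d) - n) * r + (+ 6 * n * r - T + (n * (r - 1ℤ) + (n - 1ℤ - d) + (1ℤ + η)))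
    ring = solve-∀

  -- The constants

  abstract
    -- `C₁` comes from `small-lower` with u = 200, v = 256, a = 1400, `C₂` from `squared-upper` with
    -- k = 1401, and `C₃` from `positive-lower` with u = 100, v = 256, w = 400. The definitions are
    -- opaque, so that later goals keep the names instead of large numerals.
    C₁ C₂ C₃ : ℤ
    C₁ = + 4 * + 200 * (+ 256 * ((+ 1400 + 1ℤ) * (+ 1400 + 1ℤ)))
    C₂ = + 4 * (+ 1401 * + 1401)
    C₃ = + 100 * (+ 4 * + 256 * + 400)

    C₁≡ : C₁ ≡ + 4 * + 200 * (+ 256 * ((+ 1400 + 1ℤ) * (+ 1400 + 1ℤ)))
    C₁≡ = refl

    C₂≡ : C₂ ≡ + 4 * (+ 1401 * + 1401)
    C₂≡ = refl

    C₃≡ : C₃ ≡ + 100 * (+ 4 * + 256 * + 400)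
    C₃≡ = refl

    0≤C₁ : 0ℤ ≤ C₁
    0≤C₁ = 0≤n

    40000≤C₁ : 0ℤ ≤ C₁ - + 4 * + 100 * + 100
    40000≤C₁ = 0≤n

    -- The theorem holds with C = K and c = 1 / K. The factor 4 is 24 / 6, the ratio needed in
    -- regime (ii), where 24 sp is 6 σ; this multiple of `C₁` also dominates the constants of the
    -- other regimes.
    K : ℤ
    K = + 4 * C₁

    K≡ : K ≡ + 4 * C₁
    K≡ = refl

    1≤K : 1ℤ ≤ K
    1≤K = ℤ.0≤i-j⇒j≤i 0≤n

    1024≤K : 0ℤ ≤ K - + 4 * + 256
    1024≤K = 0≤n

    402≤K : 0ℤ ≤ K - + 2 * + 201
    402≤K = 0≤n

    C₂≤16K² : 0ℤ ≤ + 16 * (K * K) - C₂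
    C₂≤16K² = 0≤n

    24C₃≤K : 0ℤ ≤ K - + 24 * C₃
    24C₃≤K = 0≤n

  -- The bounds in the form in which the rational statement needs them: 4 d T = 24 s and 6 σ = 24 sp G.

  rescale-negative-lower : ∀ {d T σ v k} → 0ℤ ≤ d → 0ℤ ≤ σ → 0ℤ ≤ k → 0ℤ ≤ k - v → - T ≤ v * σ → + 4 * d * - T ≤ k * (d * (+ 6 * σ))
  rescale-negative-lower {d} {T} {σ} {v} {k} 0≤d 0≤σ 0≤k v≤k h = ≤-by (ring d T σ v k)
    (0≤+ (0≤* (0≤* {+ 4} 0≤n 0≤d) (0≤- h)) (0≤* (0≤* 0≤d 0≤σ) (0≤+ (0≤* {+ 4} 0≤n v≤k) (0≤* {+ 2} 0≤n 0≤k))))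
    where
    ring : ∀ d T σ v k → k * (d * (+ 6 * σ)) - + 4 * d * - T ≡ + 4 * d * (v * σ - - T) + d * σ * (+ 4 * (k - v) + + 2 * k)
    ring = solve-∀

  rescale-negative-upper : ∀ {d T σ v k} → 0ℤ ≤ d → 0ℤ ≤ - T → 0ℤ ≤ v → 0ℤ ≤ k - + 2 * v → σ ≤ v * - T → d * (+ 6 * σ) ≤ k * (+ 4 * d * - T)
  rescale-negative-upper {d} {T} {σ} {v} {k} 0≤d 0≤τ 0≤v v≤k h = ≤-by (ring d T σ v k)
    (0≤+ (0≤* (0≤* {+ 6} 0≤n 0≤d) (0≤- h)) (0≤* (0≤* 0≤d 0≤τ) (0≤+ (0≤* {+ 4} 0≤n v≤k) (0≤* {+ 2} 0≤n 0≤v))))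
    where
    ring : ∀ d T σ v k → k * (+ 4 * d * - T) - d * (+ 6 * σ) ≡ + 6 * d * (v * - T - σ) + d * - T * (+ 4 * (k - + 2 * v) + + 2 * v)
    ring = solve-∀

  rescale-small-lower : ∀ {x σ v k} → k ≡ + 4 * v → x ≤ v * v * (σ * σ) → + 576 * x ≤ k * k * (+ 6 * σ * (+ 6 * σ))
  rescale-small-lower {x} {σ} {v} refl h = ≤-by (ring x σ v) (0≤* {+ 576} 0≤n (0≤- h))
    where
    ring : ∀ x σ v → + 4 * v * (+ 4 * v) * (+ 6 * σ * (+ 6 * σ)) - + 576 * x ≡ + 576 * (v * v * (σ * σ) - x)
    ring = solve-∀

  rescale-small-upper : ∀ {x σ v k} → 0ℤ ≤ x → 0ℤ ≤ + 16 * (k * k) - v → σ * σ ≤ v * x → + 6 * σ * (+ 6 * σ) ≤ k * k * (+ 576 * x)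
  rescale-small-upper {x} {σ} {v} {k} 0≤x v≤k h = ≤-by (ring x σ v k)
    (0≤+ (0≤* {+ 36} 0≤n (0≤- h)) (0≤* (0≤* {+ 36} 0≤n 0≤x) v≤k))
    where
    ring : ∀ x σ v k → k * k * (+ 576 * x) - + 6 * σ * (+ 6 * σ) ≡ + 36 * (v * x - σ * σ) + + 36 * x * (+ 16 * (k * k) - v)
    ring = solve-∀

  rescale-positive-lower : ∀ {n d T σ v k} → 0ℤ ≤ d → 0ℤ ≤ T → 0ℤ ≤ σ → 0ℤ ≤ k - + 24 * v → n * n * d ≤ v * (T * σ) →
    + 576 * (n * n * (d * d)) ≤ k * (+ 4 * d * T * (+ 6 * σ))
  rescale-positive-lower {n} {d} {T} {σ} {v} {k} 0≤d 0≤T 0≤σ v≤k h = ≤-by (ring n d T σ v k)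
    (0≤+ (0≤* (0≤* {+ 576} 0≤n 0≤d) (0≤- h)) (0≤* (0≤* (0≤* (0≤* {+ 24} 0≤n 0≤d) 0≤T) 0≤σ) v≤k))
    where
    ring : ∀ n d T σ v k → k * (+ 4 * d * T * (+ 6 * σ)) - + 576 * (n * n * (d * d))
      ≡ + 576 * d * (v * (T * σ) - n * n * d) + + 24 * d * T * σ * (k - + 24 * v)
    ring = solve-∀

  rescale-positive-upper : ∀ {n d T σ k} → 0ℤ ≤ n → 0ℤ ≤ d → 1ℤ ≤ k → T * σ ≤ d * n * n → + 4 * d * T * (+ 6 * σ) ≤ k * (+ 576 * (n * n * (d * d)))
  rescale-positive-upper {n} {d} {T} {σ} {k} 0≤n′ 0≤d 1≤k h = ≤-by (ring n d T σ k)
    (0≤+ (0≤* (0≤* {+ 24} 0≤n 0≤d) (0≤- h)) (0≤* (0≤* (0≤* {+ 24} 0≤n (0≤² n)) (0≤² d)) (0≤+ (0≤* {+ 24} 0≤n (0≤- 1≤k)) (0≤n {23}))))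
    where
    ring : ∀ n d T σ k → k * (+ 576 * (n * n * (d * d))) - + 4 * d * T * (+ 6 * σ)
      ≡ + 24 * d * (d * n * n - T * σ) + + 24 * (n * n) * (d * d) * (+ 24 * (k - 1ℤ) + + 23)
    ring = solve-∀

  -- The bounds in each regime, in terms of T and σ

  module Cases {n d η μ : ℕ} (G : Graph n) (regular : Regular G d)
    (η-common : ∀ i j → i ≢ j → adj G i j ≡ true → commonNbrs G i j ≡ η)
    (μ-common : ∀ i j → i ≢ j → adj G i j ≡ false → commonNbrs G i j ≡ μ)
    (1≤d : 1 ℕ.≤ d) (sparse : 100 ℕ.* d ℕ.≤ 99 ℕ.* n) (i₀ : Fin n) where

    open Surplus G using (σ)
    open Surplus.StronglyRegularFacts G regular η-common μ-common using (upper-bound; 0≤m)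
    open IntegerBounds G regular η-common μ-common 1≤d sparse i₀

    private
      edges-eq = Surplus.edges-eq G regular
      h e : ℤ
      h = + η - + μ
      e = T - + η + + d
      mh≤e : m * h ≤ e
      mh≤e = ℤ.≤-reflexive m[η-μ]
      e≤mh : e ≤ m * h
      e≤mh = ℤ.≤-reflexive (sym m[η-μ])
      0≤σ : 0ℤ ≤ σ
      0≤σ = pos 0<σ
      0≤d : 0ℤ ≤ + d
      0≤d = 0≤n
      0≤η : 0ℤ ≤ + η
      0≤η = 0≤n
      0≤μ : 0ℤ ≤ + μ
      0≤μ = 0≤n
      0≤N : 0ℤ ≤ + n
      0≤N = 0≤n
      c≥0 : ∀ k → 0ℤ ≤ + k
      c≥0 k = 0≤n
      0≤99n-100d : 0ℤ ≤ + 99 * + n - + 100 * + d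
      0≤99n-100d = 0≤- (subst₂ _≤_ (ℤ.pos-* 100 d) (ℤ.pos-* 99 n) (+≤+ sparse))

    -- The density hypothesis gives `100 m ≥ n - 100`, and another `100 m ≥ 100` absorbs the
    -- constant; this fails without a non-neighbour.
    0≤200m-n : 1ℤ ≤ m → 0ℤ ≤ + 200 * m - + n
    0≤200m-n 1≤m = ≤-by (ring (+ n) (+ d)) (0≤+ 0≤99n-100d (0≤* (c≥0 100) (0≤- 1≤m)))
      where
      ring : ∀ n d → + 200 * (n - 1ℤ - d) - n - 0ℤ ≡ + 99 * n - + 100 * d + + 100 * (n - 1ℤ - d - 1ℤ)
      ring = solve-∀

    complete-or-not : m ≡ 0ℤ ⊎ 1ℤ ≤ m
    complete-or-not with 1ℤ ℤ.≤? m
    ... | yes p = inj₂ p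
    ... | no ¬p = inj₁ (ℤ.≤-antisym (ℤ.i<j⇒i≤pred[j] (ℤ.≰⇒> ¬p)) (0≤m i₀))

    -- A complete graph has n = d + 1 and η = d - 1, and `(d + 1)(d - 1) - d² = -1`. Such a graph
    -- therefore always falls into regime (ii).
    T-complete : m ≡ 0ℤ → T ≡ -1ℤ
    T-complete m≡0 = ℤ.≤-antisym (≤-by (ring (+ n) (+ d) (+ η)) (0≤+ (0≤* (0≤+ 0≤d (c≥0 1)) (0≤- η<d)) (0≤* 0≤η 0≤-m)))
      (≤-by (ring′ T (+ d) (+ η)) (0≤+ e≥ d≤η+1))
      where
      0≤-m : 0ℤ ≤ - m
      0≤-m = subst (λ x → 0ℤ ≤ - x) (sym m≡0) ℤ.≤-refl
      e≥ : 0ℤ ≤ e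
      e≥ = subst (_≤ e) (trans (cong (_* h) m≡0) (ℤ.*-zeroˡ h)) mh≤e
      d≤η+1 : 0ℤ ≤ + η + 1ℤ - + d
      d≤η+1 = *-cancelˡ-≤ (+ d) 0<d (≤-by (ring″ (+ n) (+ d) (+ η)) (0≤+ e≥ (0≤* 0≤η 0≤-m)))
        where
        ring″ : ∀ n d η → d * (η + 1ℤ - d) - d * 0ℤ ≡ n * η - d * d - η + d + η * - (n - 1ℤ - d)
        ring″ = solve-∀
      ring : ∀ n d η → -1ℤ - (n * η - d * d) ≡ (d + 1ℤ) * (d - (η + 1ℤ)) + η * - (n - 1ℤ - d)
      ring = solve-∀
      ring′ : ∀ T d η → T - -1ℤ ≡ T - η + d + (η + 1ℤ - d)
      ring′ = solve-∀

    σ≤nd : σ ≤ + n * + d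
    σ≤nd = ≤-by (trans (cong (λ t → + n * + d - (+ 4 * + mc G - t)) edges-eq) (trans (ring (+ n * + d) (+ mc G)) (cong (λ t → + 2 * t - + 4 * + mc G) (sym edges-eq))))
      (subst (0ℤ ≤_) (ring′ (+ edges G) (+ mc G)) (0≤* (c≥0 4) (0≤- mc≤edges)))
      where
      ring : ∀ x c → x - (+ 4 * c - x) ≡ + 2 * x - + 4 * c
      ring = solve-∀
      ring′ : ∀ e c → + 4 * (e - c) ≡ + 2 * (+ 2 * e) - + 4 * c
      ring′ = solve-∀
      mc≤edges : + mc G ≤ + edges G
      mc≤edges with mc-attained G
      ... | S , eq = subst₂ _≤_ (trans (sym (Σ[]₂≡sum₂ (λ i j → b2n ((i <F j) ∧ adj G i j ∧ (lookup S i xor lookup S j))))) (cong +_ eq))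
          (sym (Σ[]₂≡sum₂ (λ i j → b2n ((i <F j) ∧ adj G i j))))
          (sum₂-mono (λ i j → +≤+ (shrink (i <F j) (adj G i j) (lookup S i xor lookup S j))))
        where
        shrink : ∀ x y z → b2n (x ∧ y ∧ z) ℕ.≤ b2n (x ∧ y)
        shrink true true true = s≤s z≤n
        shrink true true false = z≤n
        shrink true false _ = z≤n
        shrink false _ _ = z≤n

    d≤n : + d ≤ + n
    d≤n = ≤-by (ring (+ n) (+ d)) (0≤+ (0≤m i₀) (c≥0 1))
      where
      ring : ∀ n d → n - d ≡ n - 1ℤ - d + 1ℤ
      ring = solve-∀

    n²d≥d² : + d * + d ≤ + n * + n * + d
    n²d≥d² = ≤-by (ring (+ n) (+ d)) (0≤* 0≤d (0≤+ (0≤- d≤n) (0≤* 0≤N 1≤n)))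
      where
      ring : ∀ n d → n * n * d - d * d ≡ d * (n - d + n * (n - 1ℤ))
      ring = solve-∀

    n²d≥1 : 1ℤ ≤ + n * + n * + d
    n²d≥1 = ℤ.≤-trans (≤-by (ring (+ d)) (0≤* 0≤d-1 (0≤+ 0≤d (c≥0 1)))) n²d≥d²
      where
      ring : ∀ d → d * d - 1ℤ ≡ (d - 1ℤ) * (d + 1ℤ)
      ring = solve-∀

    not-complete : + 36 * (+ n * + n * + d) < T * T → 1ℤ ≤ m
    not-complete big with complete-or-not
    ... | inj₂ p = p
    ... | inj₁ m≡0 = ⊥-elim (ℤ.<-irrefl refl (ℤ.<-≤-trans (subst (λ t → + 36 * (+ n * + n * + d) < t * t) (T-complete m≡0) big)
      (≤-by (ring (+ n * + n * + d)) (0≤+ (0≤* (c≥0 36) (0≤- n²d≥1)) (c≥0 35)))))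
      where
      ring : ∀ x → + 36 * x - 1ℤ ≡ + 36 * (x - 1ℤ) + + 35
      ring = solve-∀

    module Large (big : + 36 * (+ n * + n * + d) < T * T) where

      1≤m : 1ℤ ≤ m
      1≤m = not-complete big

      0<m : 0ℤ < m
      0<m = ℤ.<-≤-trans (+<+ (s≤s z≤n)) 1≤m

      0≤T²-36n²d : 0ℤ ≤ T * T - + 36 * (+ n * + n * + d)
      0≤T²-36n²d = 0≤- (ℤ.<⇒≤ big)

    module Negative (T<0 : T < 0ℤ) (big : + 36 * (+ n * + n * + d) < T * T) where

      open Large big

      0<τ : 0ℤ < - T
      0<τ = ℤ.neg-mono-< T<0

      -- Makes the error d - η in `m[η-μ]` at most half of - T, so that h takes the sign of T and
      -- has the expected size.
      2d≤τ : + 2 * + d ≤ - T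
      2d≤τ = sqrt-mono (pos 0<τ) (≤-by (ring T (+ d) (+ n)) (0≤+ 0≤T²-36n²d (0≤+ (0≤* (c≥0 4) (0≤- n²d≥d²)) (0≤* (c≥0 32) (ℤ.≤-trans (c≥0 1) n²d≥1)))))
        where
        ring : ∀ T d n → - T * - T - + 2 * d * (+ 2 * d) ≡ T * T - + 36 * (n * n * d) + (+ 4 * (n * n * d - d * d) + + 32 * (n * n * d))
        ring = solve-∀

      h≤0 : h ≤ 0ℤ
      h≤0 = *-cancelˡ-≤ m 0<m (≤-by (ring m h T (+ η) (+ d)) (0≤+ (0≤+ (0≤- mh≤e) (0≤- 2d≤τ)) (0≤+ 0≤d 0≤η)))
        where
        ring : ∀ m h T η d → m * 0ℤ - m * h ≡ T - η + d - m * h + (- T - + 2 * d) + (d + η)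
        ring = solve-∀

      lower-bound : - T ≤ + 4 * + 256 * σ
      lower-bound with sqrt-between d 1≤d
      ... | r , 1≤r , d≤r² , r²≤4d = negative-lower {+ d} {m} {h} {T} {+ η} {+ r} {σ} {+ 256} {+ 0} 0<d 0≤σ 0≤η (pos 0<τ) 0≤n refl
          (lower 0 r 1≤r d≤r² h≤0) (subst₂ _≤_ (ℤ.pos-* r r) (ℤ.pos-* 4 d) (+≤+ r²≤4d)) mh≤e 2d≤τ

      nh-lower : 0ℤ ≤ + 200 * - T + + n * h
      nh-lower = ≤-by (ring (+ n) (+ d) m h T (+ η)) (0≤+ (0≤+ (0≤* (0≤200m-n 1≤m) (0≤- h≤0)) (0≤* (c≥0 200) (0≤- e≤mh))) (0≤* (c≥0 200) 0≤d-η))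
        where
        ring : ∀ n d m h T η → + 200 * - T + n * h - 0ℤ ≡ (+ 200 * m - n) * (0ℤ - h) + + 200 * (m * h - (T - η + d)) + + 200 * (d - η)
        ring = solve-∀

      upper-bound′ : σ ≤ + 201 * - T
      -- The least eigenvalue is compared with 201 T / n. As 201 exceeds the 200 of `nh-lower` by
      -- one, p = - 201 T satisfies `p + n h ≥ - T`, so `p (p + n h) ≥ 201 T²`, more than the
      -- required `n² (d - μ)`.
      upper-bound′ = *-cancelˡ-≤ (+ n) 0<n (ℤ.≤-trans (upper-bound i₀ (+ 201 * - T) (+ n) (0≤* (c≥0 201) (pos 0<τ)) 0≤N
          (subst (0ℤ <_) (ring₁ (+ n) h T) (ℤ.+-mono-≤-< nh-lower (0<* {+ 202} (+<+ (s≤s z≤n)) 0<τ)))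
          (≤-by (ring₂ (+ n) (+ d) (+ μ) h T)
            (0≤+ (0≤+ (0≤* (0≤* (c≥0 201) (pos 0<τ)) nh-lower) (0≤* (c≥0 200) (0≤² T))) (0≤+ 0≤T²-36n²d
              (0≤+ (0≤* (c≥0 35) (ℤ.≤-trans (c≥0 1) n²d≥1)) (0≤* (0≤* 0≤N 0≤N) 0≤μ))))))
        (ℤ.≤-reflexive (ℤ.*-comm (+ 201 * - T) (+ n))))
        where
        ring₁ : ∀ n h T → + 200 * - T + n * h + + 202 * - T ≡ n * h + + 2 * (+ 201 * - T)
        ring₁ = solve-∀
        ring₂ : ∀ n d μ h T → + 201 * - T * (+ 201 * - T) + + 201 * - T * n * h - n * n * (d - μ)
          ≡ + 201 * - T * (+ 200 * - T + n * h) + + 200 * (T * T) + ((T * T - + 36 * (n * n * d)) + (+ 35 * (n * n * d) + n * n * μ))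
        ring₂ = solve-∀

    module Positive (0<T : 0ℤ < T) (big : + 36 * (+ n * + n * + d) < T * T) where

      open Large big

      0≤h : 0ℤ ≤ h
      0≤h = *-cancelˡ-≤ m 0<m (≤-by (ring m h T (+ η) (+ d)) (0≤+ (0≤- e≤mh) (0≤+ (pos 0<T) 0≤d-η)))
        where
        ring : ∀ m h T η d → m * h - m * 0ℤ ≡ m * h - (T - η + d) + (T + (d - η))
        ring = solve-∀

      T≤nh : T ≤ + n * h
      T≤nh = ≤-by (ring (+ n) (+ d) h T (+ η)) (0≤+ (0≤* (0≤+ 0≤d (c≥0 1)) 0≤h) (0≤+ (0≤- e≤mh) 0≤d-η))
        where
        ring : ∀ n d h T η → n * h - T ≡ (d + 1ℤ) * h + ((n - 1ℤ - d) * h - (T - η + d) + (d - η))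
        ring = solve-∀

      d≤T : + d ≤ T
      d≤T = sqrt-mono (pos 0<T) (≤-by (ring T (+ d) (+ n)) (0≤+ 0≤T²-36n²d (0≤+ (0≤- n²d≥d²) (0≤* (c≥0 35) (ℤ.≤-trans (c≥0 1) n²d≥1)))))
        where
        ring : ∀ T d n → T * T - d * d ≡ T * T - + 36 * (n * n * d) + (n * n * d - d * d + + 35 * (n * n * d))
        ring = solve-∀

      0<h : 0ℤ < h
      0<h = ℤ.≤∧≢⇒< 0≤h (λ 0≡h → ℤ.<⇒≱ 0<T (subst (λ x → T ≤ x) (ℤ.*-zeroʳ (+ n)) (subst (λ x → T ≤ + n * x) (sym 0≡h) T≤nh)))

      -- `n h ≤ 200 m h ≤ 200 (T + d)`, and d is at most T in this regime.
      nh≤400T : + n * h ≤ + 400 * T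
      nh≤400T = ≤-by (ring (+ n) (+ d) m h T (+ η)) (0≤+ (0≤* (0≤200m-n 1≤m) 0≤h) (0≤+ (0≤* (c≥0 200) (0≤- mh≤e)) (0≤+ (0≤* (c≥0 200) (0≤- d≤T)) (0≤* (c≥0 200) 0≤η))))
        where
        ring : ∀ n d m h T η → + 400 * T - n * h ≡ (+ 200 * m - n) * h + (+ 200 * (T - η + d - m * h) + (+ 200 * (T - d) + + 200 * η))
        ring = solve-∀

      lower-bound : + n * + n * + d ≤ C₃ * (T * σ)
      lower-bound with sqrt-between d 1≤d
      ... | r , 1≤r , d≤r² , r²≤4d = subst (λ c → + n * + n * + d ≤ c * (T * σ)) (sym C₃≡)
          (positive-lower {+ n} {+ d} {m} {h} {T} {+ r} {σ} {+ 100} {+ 256} {+ 400} 0≤N 0≤d 0<h (0≤n {r}) 0≤σ r≤h 0≤n 0≤n base nh≤400T (0≤200m-n 1≤m))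
        where
        r²≤ : + r * + r ≤ + 4 * + d
        r²≤ = subst₂ _≤_ (ℤ.pos-* r r) (ℤ.pos-* 4 d) (+≤+ r²≤4d)
        -- The threshold is T > 6 n √d, and r ≤ 2 √d. Together with `T ≤ n h` this gives the r ≤ h
        -- that `positive-lower` needs.
        3nr≤T : + n * (+ 3 * + r) ≤ T
        3nr≤T = sqrt-mono (pos 0<T) (≤-by (ring′ (+ n) (+ d) (+ r) T) (0≤+ 0≤T²-36n²d (0≤* (0≤* (0≤* (c≥0 9) 0≤N) 0≤N) (0≤- r²≤))))
          where
          ring′ : ∀ n d r T → T * T - n * (+ 3 * r) * (n * (+ 3 * r)) ≡ T * T - + 36 * (n * n * d) + + 9 * n * n * (+ 4 * d - r * r)
          ring′ = solve-∀
        r≤h : + r ≤ h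
        r≤h = ℤ.≤-trans (≤-by (ring′ (+ r)) (0≤* (c≥0 2) (0≤n {r}))) (*-cancelˡ-≤ (+ n) 0<n (ℤ.≤-trans 3nr≤T T≤nh))
          where
          ring′ : ∀ r → + 3 * r - r ≡ + 2 * r
          ring′ = solve-∀
        α = ℤ.∣ h ∣
        α≡h : + α ≡ h
        α≡h = ℤ.0≤i⇒+∣i∣≡i 0≤h
        base : + d * m * (+ 5 * h - + 3 * h) ≤ + 256 * ((h + + r) * (h + + r)) * σ
        base = subst (λ x → + d * m * (+ 5 * x - + 3 * h) ≤ + 256 * ((x + + r) * (x + + r)) * σ) α≡h
          (lower α r 1≤r d≤r² (ℤ.≤-reflexive (sym α≡h)))

      upper-bound′ : T * σ ≤ + d * + n * + n
      -- If -θ is the least eigenvalue, `θ (θ + h) = d - μ` gives θ ≤ d / h, and `T ≤ n h` replaces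
      -- this by the larger d n / T.
      upper-bound′ = upper-bound i₀ (+ d * + n) T (0≤* 0≤d 0≤N) (pos 0<T)
          (ℤ.+-mono-≤-< (0≤* (pos 0<T) 0≤h) (0<* {+ 2} (+<+ (s≤s z≤n)) (0<* 0<d 0<n)))
          (≤-by (ring (+ n) (+ d) (+ μ) h T) (0≤+ (0≤² (+ d * + n)) (0≤+ (0≤* (0≤* 0≤d (pos 0<T)) (0≤- T≤nh)) (0≤* (0≤² T) 0≤μ))))
        where
        ring : ∀ n d μ h T → d * n * (d * n) + d * n * T * h - T * T * (d - μ) ≡ d * n * (d * n) + (d * T * (n * h - T) + T * T * μ)
        ring = solve-∀

    module Small (small : T * T ≤ + 36 * (+ n * + n * + d)) where

      private
        root = sqrt-between d 1≤d
        r = proj₁ root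
        1≤r = proj₁ (proj₂ root)
        d≤r² = proj₁ (proj₂ (proj₂ root))
        ρ : ℤ
        ρ = + r
        0≤ρ : 0ℤ ≤ ρ
        0≤ρ = 0≤n
        0≤ρ-1 : 0ℤ ≤ ρ - 1ℤ
        0≤ρ-1 = 0≤- (+≤+ 1≤r)
        0<ρ : 0ℤ < ρ
        0<ρ = +<+ 1≤r
        0≤ρ²-d : 0ℤ ≤ ρ * ρ - + d
        0≤ρ²-d = 0≤- (subst (+ d ≤_) (ℤ.pos-* r r) (+≤+ d≤r²))
        0≤4d-ρ² : 0ℤ ≤ + 4 * + d - ρ * ρ
        0≤4d-ρ² = 0≤- (subst₂ _≤_ (ℤ.pos-* r r) (ℤ.pos-* 4 d) (+≤+ (proj₂ (proj₂ (proj₂ root)))))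
        0≤6nρ : 0ℤ ≤ + 6 * + n * ρ
        0≤6nρ = 0≤* (0≤* (c≥0 6) 0≤N) 0≤ρ
        T≤6nρ : T ≤ + 6 * + n * ρ
        T≤6nρ = sqrt-mono 0≤6nρ (≤-by (ring T (+ n) (+ d) ρ) (0≤+ (0≤- small) (0≤* (0≤* (0≤* (c≥0 36) 0≤N) 0≤N) 0≤ρ²-d)))
          where
          ring : ∀ T n d r → + 6 * n * r * (+ 6 * n * r) - T * T ≡ + 36 * (n * n * d) - T * T + + 36 * n * n * (r * r - d)
          ring = solve-∀
        -T≤6nρ : - T ≤ + 6 * + n * ρ
        -T≤6nρ = sqrt-mono 0≤6nρ (≤-by (ring T (+ n) (+ d) ρ) (0≤+ (0≤- small) (0≤* (0≤* (0≤* (c≥0 36) 0≤N) 0≤N) 0≤ρ²-d)))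
          where
          ring : ∀ T n d r → + 6 * n * r * (+ 6 * n * r) - - T * - T ≡ + 36 * (n * n * d) - T * T + + 36 * n * n * (r * r - d)
          ring = solve-∀

      -- Both bounds with the integer ρ for √d; they are squared afterwards, which removes ρ. With a
      -- non-neighbour present, h has modulus O(ρ), so α = 1400 ρ is admissible below and 1401 ρ
      -- bounds the modulus of the least eigenvalue above.
      nρ-bounds : + n * ρ ≤ C₁ * σ × σ ≤ + 1401 * ρ * + n
      nρ-bounds with complete-or-not
      ... | inj₁ m≡0 = complete-lower {+ n} {+ d} {ρ} {σ} {+ 100} {C₁} 0≤N 0≤C₁ 40000≤C₁ (ℤ.i<j⇒suc[i]≤j 0<σ) 0≤n 0≤100-n (0≤- d≤n) 0≤ρ 0≤ρ-1 0≤4d-ρ²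
                     , ℤ.≤-trans σ≤nd (complete-upper {+ n} {+ d} {ρ} 0≤N 0≤100-n (0≤- d≤n) 0≤ρ-1)
        where
        -- With n = d + 1, `100 d ≤ 99 n` becomes n ≤ 100.
        0≤100-n : 0ℤ ≤ + 100 - + n
        0≤100-n = ≤-by (ring (+ n) (+ d)) (0≤+ 0≤99n-100d (0≤* (c≥0 100) (subst (λ x → 0ℤ ≤ - x) (sym m≡0) ℤ.≤-refl)))
          where
          ring : ∀ n d → + 100 - n - 0ℤ ≡ + 99 * n - + 100 * d + + 100 * - (n - 1ℤ - d)
          ring = solve-∀
      ... | inj₂ 1≤m = subst (λ c → + n * ρ ≤ c * σ) (sym C₁≡)
                         (small-lower {+ n} {+ d} {m} {h} {ρ} {σ} {+ 1400} {+ 200} {+ 256} 0≤N 0≤d (0≤m i₀) 0<ρ 0≤n 0≤n h-upper base (0≤200m-n 1≤m) 0≤4d-ρ²)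
                     , subst (_≤ + 1401 * ρ * + n) (ℤ.*-identityˡ σ) (upper-bound i₀ (+ 1401 * ρ) 1ℤ (0≤* {+ 1401} 0≤n 0≤ρ) 0≤n
                         (subst (0ℤ <_) (ring ρ h) (ℤ.+-mono-≤-< h-lower (0<* {+ 1602} {ρ} (+<+ (s≤s z≤n)) 0<ρ)))
                         (small-condition {ρ} {h} {+ d} {+ μ} {+ 1200} {+ 1401} 0≤ρ 0≤n 0≤n h-lower 0≤ρ²-d 0≤μ))
        where
        0<m = ℤ.<-≤-trans (+<+ (s≤s z≤n)) 1≤m
        h-lower : 0ℤ ≤ h + + 1200 * ρ
        h-lower = small-h-lower {+ n} {+ d} {+ η} {m} {h} {T} {ρ} 0<m e≤mh -T≤6nρ 0≤d-η 0≤ρ (0≤200m-n 1≤m)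
        h-upper : h ≤ + 1400 * ρ
        h-upper = small-h-upper {+ n} {+ d} {+ η} {h} {T} {ρ} 0≤N 0≤η 0<m mh≤e T≤6nρ 0≤ρ 0≤ρ-1 (0≤200m-n 1≤m)
        ring : ∀ r h → h + + 1200 * r + + 1602 * r ≡ 1ℤ * h + + 2 * (+ 1401 * r)
        ring = solve-∀
        base : + d * m * (+ 5 * (+ 1400 * ρ) - + 3 * h) ≤ + 256 * ((+ 1400 * ρ + ρ) * (+ 1400 * ρ + ρ)) * σ
        base = subst (λ x → + d * m * (+ 5 * x - + 3 * h) ≤ + 256 * ((x + ρ) * (x + ρ)) * σ) (ℤ.pos-* 1400 r)
          (lower (1400 ℕ.* r) r 1≤r d≤r² (subst (h ≤_) (sym (ℤ.pos-* 1400 r)) h-upper))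

      lower-bound : + n * + n * + d ≤ C₁ * C₁ * (σ * σ)
      lower-bound = squared-lower {C₁} {+ n} {+ d} {ρ} {σ} 0≤C₁ 0≤N 0≤ρ 0≤σ (proj₁ nρ-bounds) 0≤ρ²-d

      upper-bound′ : σ * σ ≤ C₂ * (+ n * + n * + d)
      upper-bound′ = subst (λ c → σ * σ ≤ c * (+ n * + n * + d)) (sym C₂≡)
        (squared-upper {+ n} {+ d} {ρ} {σ} {+ 1401} 0≤N 0≤ρ 0≤σ 0≤n (proj₂ nρ-bounds) 0≤4d-ρ²)

-- Passage to the rationals

open import Data.Rational using (_≤_; _<_; _*_; _-_; ∣_∣; -_)

ι : ℤ → ℚ
ι z = z / 1

-- Reduced fractions with variable numerators do not compute. Identities are moved to unreduced
-- fractions, where they are cross-multiplications over the integers.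
toℚᵘ-/ : ∀ z k → toℚᵘ (z / ℕ.suc k) ℚᵘ.≃ mkℚᵘ z k
toℚᵘ-/ z k = ℚ.toℚᵘ-fromℚᵘ (mkℚᵘ z k)

ι-* : ∀ a b → ι (a ℤ.* b) ≡ ι a * ι b
ι-* a b = ℚ.toℚᵘ-injective (ℚᵘ.≃-trans (toℚᵘ-/ (a ℤ.* b) 0) (ℚᵘ.≃-sym
  (ℚᵘ.≃-trans (ℚ.toℚᵘ-homo-* (ι a) (ι b)) (ℚᵘ.*-cong (toℚᵘ-/ a 0) (toℚᵘ-/ b 0)))))

ι-neg : ∀ a → ι (ℤ.- a) ≡ - ι a
ι-neg a = ℚ.toℚᵘ-injective (ℚᵘ.≃-trans (toℚᵘ-/ (ℤ.- a) 0) (ℚᵘ.≃-sym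
  (ℚᵘ.≃-trans (ℚ.toℚᵘ-homo‿- (ι a)) (ℚᵘ.-‿cong (toℚᵘ-/ a 0)))))

ι-mono-≤ : ∀ {a b} → a ℤ.≤ b → ι a ≤ ι b
ι-mono-≤ {a} {b} a≤b = ℚ.toℚᵘ-cancel-≤ (ℚᵘ.≤-respˡ-≃ (ℚᵘ.≃-sym (toℚᵘ-/ a 0)) (ℚᵘ.≤-respʳ-≃ (ℚᵘ.≃-sym (toℚᵘ-/ b 0))
  (*≤* (ℤ.*-monoʳ-≤-nonNeg (+ 1) a≤b))))

ι-mono-< : ∀ {a b} → a ℤ.< b → ι a < ι b
ι-mono-< {a} {b} a<b = ℚ.toℚᵘ-cancel-< (ℚᵘ.<-respˡ-≃ (ℚᵘ.≃-sym (toℚᵘ-/ a 0)) (ℚᵘ.<-respʳ-≃ (ℚᵘ.≃-sym (toℚᵘ-/ b 0))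
  (*<* (ℤ.*-monoʳ-<-pos (+ 1) a<b))))

ι-cancel-≤ : ∀ {a b} → ι a ≤ ι b → a ℤ.≤ b
ι-cancel-≤ {a} {b} h with a ℤ.≤? b
... | yes p = p
... | no ¬p = contradiction (ℚ.<-≤-trans (ι-mono-< (ℤ.≰⇒> ¬p)) h) (ℚ.<-irrefl refl)

ι-cancel-< : ∀ {a b} → ι a < ι b → a ℤ.< b
ι-cancel-< {a} {b} h with a ℤ.<? b
... | yes p = p
... | no ¬p = contradiction (ℚ.<-≤-trans h (ι-mono-≤ (ℤ.≮⇒≥ ¬p))) (ℚ.<-irrefl refl)

-- All the rationals in the theorem are integer multiples of u or of u²; u = 1/24 clears the denominators 2, 4 and 6.
u : ℚ
u = + 1 / 24

ι*u : ∀ a → toℚᵘ (ι a * u) ℚᵘ.≃ mkℚᵘ a 0 ℚᵘ.* mkℚᵘ (+ 1) 23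
ι*u a = ℚᵘ.≃-trans (ℚ.toℚᵘ-homo-* (ι a) u) (ℚᵘ.*-cong (toℚᵘ-/ a 0) (toℚᵘ-/ (+ 1) 23))

difference : ∀ a b k → toℚᵘ (ι a - (b / suc k)) ℚᵘ.≃ mkℚᵘ a 0 ℚᵘ.+ (ℚᵘ.- mkℚᵘ b k)
difference a b k = ℚᵘ.≃-trans (ℚ.toℚᵘ-homo-+ (ι a) (- (b / suc k))) (ℚᵘ.+-cong (toℚᵘ-/ a 0)
  (ℚᵘ.≃-trans (ℚ.toℚᵘ-homo‿- (b / suc k)) (ℚᵘ.-‿cong (toℚᵘ-/ b k))))

half-difference : ∀ a b → ι a - (b / 2) ≡ ι (+ 12 ℤ.* (+ 2 ℤ.* a ℤ.- b)) * u
half-difference a b = ℚ.toℚᵘ-injective (ℚᵘ.≃-trans (difference a b 1) (ℚᵘ.≃-trans (*≡* (ring a b))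
    (ℚᵘ.≃-sym (ι*u (+ 12 ℤ.* (+ 2 ℤ.* a ℤ.- b))))))
  where
  ring : ∀ a b → (a ℤ.* + 2 ℤ.+ ℤ.- b ℤ.* + 1) ℤ.* + 24 ≡ + 12 ℤ.* (+ 2 ℤ.* a ℤ.- b) ℤ.* + 1 ℤ.* + 2
  ring = solve-∀

sixth-difference : ∀ a b → ι a - (b / 6) ≡ ι (+ 4 ℤ.* (+ 6 ℤ.* a ℤ.- b)) * u
sixth-difference a b = ℚ.toℚᵘ-injective (ℚᵘ.≃-trans (difference a b 5) (ℚᵘ.≃-trans (*≡* (ring a b))
    (ℚᵘ.≃-sym (ι*u (+ 4 ℤ.* (+ 6 ℤ.* a ℤ.- b))))))
  where
  ring : ∀ a b → (a ℤ.* + 6 ℤ.+ ℤ.- b ℤ.* + 1) ℤ.* + 24 ≡ + 4 ℤ.* (+ 6 ℤ.* a ℤ.- b) ℤ.* + 1 ℤ.* + 6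
  ring = solve-∀

interchange : ∀ a b c d → (a * b) * (c * d) ≡ (a * c) * (b * d)
interchange a b c d = trans (ℚ.*-assoc a b (c * d)) (trans (cong (a *_) (trans (sym (ℚ.*-assoc b c d))
  (trans (cong (_* d) (ℚ.*-comm b c)) (ℚ.*-assoc c b d)))) (sym (ℚ.*-assoc a c (b * d))))

ι-product : ∀ a b → (ι a * u) * (ι b * u) ≡ ι (a ℤ.* b) * (u * u)
ι-product a b = trans (interchange (ι a) u (ι b) u) (cong (_* (u * u)) (sym (ι-* a b)))

ι-scale : ∀ a b w → ι a * (ι b * w) ≡ ι (a ℤ.* b) * w
ι-scale a b w = trans (sym (ℚ.*-assoc (ι a) (ι b) w)) (cong (_* w) (sym (ι-* a b)))

ι-over-u² : ∀ a → ι a ≡ ι (+ 576 ℤ.* a) * (u * u)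
ι-over-u² a = sym (trans (cong (λ z → ι z * (u * u)) (ℤ.*-comm (+ 576) a)) (trans (cong (_* (u * u)) (ι-* a (+ 576)))
  (trans (ℚ.*-assoc (ι a) (ι (+ 576)) (u * u)) (ℚ.*-identityʳ (ι a)))))

scaled-mono : ∀ {a b} w .{{_ : ℚ.Positive w}} → a ℤ.≤ b → ι a * w ≤ ι b * w
scaled-mono w a≤b = ℚ.*-monoʳ-≤-nonNeg w {{ℚ.pos⇒nonNeg w}} (ι-mono-≤ a≤b)

scaled-cancel-< : ∀ {a b} w .{{_ : ℚ.Positive w}} → ι a * w < ι b * w → a ℤ.< b
scaled-cancel-< w h = ι-cancel-< (ℚ.*-cancelʳ-<-nonNeg w {{ℚ.pos⇒nonNeg w}} h)

scaled-cancel-≤ : ∀ {a b} w .{{_ : ℚ.Positive w}} → ι a * w ≤ ι b * w → a ℤ.≤ b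
scaled-cancel-≤ w h = ι-cancel-≤ (ℚ.*-cancelʳ-≤-pos w h)

module Reciprocal {K : ℤ} (1≤K : 1ℤ ℤ.≤ K) where

  C : ℚ
  C = ι K

  instance
    C-positive : ℚ.Positive C
    C-positive = ℚ.positive (ι-mono-< (ℤ.<-≤-trans (ℤ.+<+ (s≤s z≤n)) 1≤K))
    C-nonZero : ℚ.NonZero C
    C-nonZero = ℚ.pos⇒nonZero C

  c : ℚ
  c = ℚ.1/ C

  instance
    c-positive : ℚ.Positive c
    c-positive = ℚ.1/pos⇒pos C

  0<c : 0ℚ < c
  0<c = ℚ.positive⁻¹ c

  c≤C : c ≤ C
  c≤C = ℚ.≤-trans (subst₂ _≤_ (ℚ.*-identityʳ c) (ℚ.*-inverseˡ C) (ℚ.*-monoˡ-≤-nonNeg c {{ℚ.pos⇒nonNeg c}} (ι-mono-≤ 1≤K))) (ι-mono-≤ 1≤K)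

  -- Since c is the reciprocal of C, lower bounds too can be proved as integer inequalities with the
  -- single constant K.
  divide : ∀ {x y} → x ≤ C * y → c * x ≤ y
  divide {x} {y} h = subst (c * x ≤_) (trans (sym (ℚ.*-assoc c C y)) (trans (cong (_* y) (ℚ.*-inverseˡ C)) (ℚ.*-identityˡ y)))
    (ℚ.*-monoˡ-≤-nonNeg c {{ℚ.pos⇒nonNeg c}} h)

  divide² : ∀ {x y} → x ≤ C * C * y → c * c * x ≤ y
  divide² {x} {y} h = subst (_≤ y) (sym (ℚ.*-assoc c c x)) (divide (divide (subst (x ≤_) (ℚ.*-assoc C C y) h)))

open Integral using (K)
open Reciprocal {K} Integral.1≤K

-- The three regimes in terms of `surplus` and `sp`

module Rational {n d η μ : ℕ} (G : Graph n) (regular : Regular G d)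
  (η-common : ∀ i j → i ≢ j → adj G i j ≡ true → commonNbrs G i j ≡ η)
  (μ-common : ∀ i j → i ≢ j → adj G i j ≡ false → commonNbrs G i j ≡ μ)
  (1≤d : 1 ℕ.≤ d) (sparse : 100 ℕ.* d ℕ.≤ 99 ℕ.* n) (i₀ : Fin n) where

  open Integral.Surplus G using (σ)
  open Integral.Surplus.StronglyRegularFacts G regular η-common μ-common using (triangles-eq)
  open Integral.IntegerBounds G regular η-common μ-common 1≤d sparse i₀ using (T; 0<σ; 0<d)
  open Integral.Cases G regular η-common μ-common 1≤d sparse i₀

  D N 4d : ℤ
  D = + d
  N = + n
  4d = + 4 ℤ.* D

  sp-eq : sp G ≡ ι (+ 6 ℤ.* σ) * u
  sp-eq = trans (half-difference (+ mc G) (+ edges G)) (cong (λ z → ι z * u) (ring (+ mc G) (+ edges G)))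
    where
    ring : ∀ a b → + 12 ℤ.* (+ 2 ℤ.* a ℤ.- b) ≡ + 6 ℤ.* (+ 4 ℤ.* a ℤ.- + 2 ℤ.* b)
    ring = solve-∀

  cube : + (d ℕ.^ 3) ≡ D ℤ.* D ℤ.* D
  cube = trans (cong (λ m → + (d ℕ.* (d ℕ.* m))) (ℕ.*-identityʳ d)) (trans (ℤ.pos-* d (d ℕ.* d)) (trans (cong (D ℤ.*_) (ℤ.pos-* d d)) (sym (ℤ.*-assoc D D D))))

  n² : + (n ℕ.^ 2) ≡ N ℤ.* N
  n² = trans (cong (λ m → + (n ℕ.* m)) (ℕ.*-identityʳ n)) (ℤ.pos-* n n)

  d² : + (d ℕ.^ 2) ≡ D ℤ.* D
  d² = trans (cong (λ m → + (d ℕ.* m)) (ℕ.*-identityʳ d)) (ℤ.pos-* d d)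

  n²d³ : + (n ℕ.^ 2 ℕ.* d ℕ.^ 3) ≡ N ℤ.* N ℤ.* (D ℤ.* D ℤ.* D)
  n²d³ = trans (ℤ.pos-* (n ℕ.^ 2) (d ℕ.^ 3)) (cong₂ ℤ._*_ n² cube)

  n²d² : + (n ℕ.^ 2 ℕ.* d ℕ.^ 2) ≡ N ℤ.* N ℤ.* (D ℤ.* D)
  n²d² = trans (ℤ.pos-* (n ℕ.^ 2) (d ℕ.^ 2)) (cong₂ ℤ._*_ n² d²)

  n²d : + (n ℕ.^ 2 ℕ.* d) ≡ N ℤ.* N ℤ.* D
  n²d = trans (ℤ.pos-* (n ℕ.^ 2) d) (cong (ℤ._* D) n²)

  surplus-eq : surplus G d ≡ ι (4d ℤ.* T) * u
  surplus-eq = trans (sixth-difference (+ triangles G) (+ (d ℕ.^ 3))) (cong (λ z → ι z * u)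
    (trans (cong₂ (λ x y → + 4 ℤ.* (x ℤ.- y)) triangles-eq cube) (ring N D (+ η))))
    where
    ring : ∀ n d η → + 4 ℤ.* (n ℤ.* d ℤ.* η ℤ.- d ℤ.* d ℤ.* d) ≡ + 4 ℤ.* d ℤ.* (n ℤ.* η ℤ.- d ℤ.* d)
    ring = solve-∀

  0≤D : 0ℤ ℤ.≤ D
  0≤D = ℤ.<⇒≤ 0<d

  0≤N : 0ℤ ℤ.≤ N
  0≤N = ℤ.+≤+ z≤n

  0≤4d : 0ℤ ℤ.≤ 4d
  0≤4d = Integral.0≤* {+ 4} (ℤ.+≤+ z≤n) 0≤D

  0≤σ : 0ℤ ℤ.≤ σ
  0≤σ = ℤ.<⇒≤ 0<σ

  0≤K : 0ℤ ℤ.≤ K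
  0≤K = ℤ.≤-trans (ℤ.+≤+ z≤n) Integral.1≤K

  T-negative : surplus G d < 0ℚ → T ℤ.< 0ℤ
  T-negative s<0 = ℤ.*-cancelˡ-<-nonNeg 4d {{ℤ.nonNegative 0≤4d}} (subst (4d ℤ.* T ℤ.<_) (sym (ℤ.*-zeroʳ 4d))
    (scaled-cancel-< u (subst₂ _<_ surplus-eq (sym (ℚ.*-zeroˡ u)) s<0)))

  T-positive : 0ℚ < surplus G d → 0ℤ ℤ.< T
  T-positive 0<s = ℤ.*-cancelˡ-<-nonNeg 4d {{ℤ.nonNegative 0≤4d}} (subst (ℤ._< 4d ℤ.* T) (sym (ℤ.*-zeroʳ 4d))
    (scaled-cancel-< u (subst₂ _<_ (sym (ℚ.*-zeroˡ u)) surplus-eq 0<s)))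

  surplus² : surplus G d * surplus G d ≡ ι (4d ℤ.* 4d ℤ.* (T ℤ.* T)) * (u * u)
  surplus² = trans (cong₂ _*_ surplus-eq surplus-eq) (trans (ι-product (4d ℤ.* T) (4d ℤ.* T)) (cong (λ z → ι z * (u * u)) (ring 4d T)))
    where
    ring : ∀ x t → x ℤ.* t ℤ.* (x ℤ.* t) ≡ x ℤ.* x ℤ.* (t ℤ.* t)
    ring = solve-∀

  -- Brings out the factor `4d * 4d` of `surplus²`. Cancelling it turns the comparison of s² with
  -- n²d³ into one of T² with 36 n²d.
  threshold : ℕ→ℚ (n ℕ.^ 2 ℕ.* d ℕ.^ 3) ≡ ι (4d ℤ.* 4d ℤ.* (+ 36 ℤ.* (N ℤ.* N ℤ.* D))) * (u * u)
  threshold = trans (ι-over-u² (+ (n ℕ.^ 2 ℕ.* d ℕ.^ 3))) (cong (λ z → ι z * (u * u)) (trans (cong (+ 576 ℤ.*_) n²d³) (ring N D)))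
    where
    ring : ∀ n d → + 576 ℤ.* (n ℤ.* n ℤ.* (d ℤ.* d ℤ.* d)) ≡ + 4 ℤ.* d ℤ.* (+ 4 ℤ.* d) ℤ.* (+ 36 ℤ.* (n ℤ.* n ℤ.* d))
    ring = solve-∀

  T-large : ℕ→ℚ (n ℕ.^ 2 ℕ.* d ℕ.^ 3) < surplus G d * surplus G d → + 36 ℤ.* (N ℤ.* N ℤ.* D) ℤ.< T ℤ.* T
  T-large h = ℤ.*-cancelˡ-<-nonNeg (4d ℤ.* 4d) {{ℤ.nonNegative (Integral.0≤² 4d)}} (scaled-cancel-< (u * u) (subst₂ _<_ threshold surplus² h))

  T-small : surplus G d * surplus G d ≤ ℕ→ℚ (n ℕ.^ 2 ℕ.* d ℕ.^ 3) → T ℤ.* T ℤ.≤ + 36 ℤ.* (N ℤ.* N ℤ.* D)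
  T-small h = Integral.*-cancelˡ-≤ (4d ℤ.* 4d) (Integral.0<* 0<4d 0<4d) (scaled-cancel-≤ (u * u) (subst₂ _≤_ surplus² threshold h))
    where
    0<4d : 0ℤ ℤ.< 4d
    0<4d = Integral.0<* {+ 4} (ℤ.+<+ (s≤s z≤n)) 0<d

  d*sp : ℕ→ℚ d * sp G ≡ ι (D ℤ.* (+ 6 ℤ.* σ)) * u
  d*sp = trans (cong (ι D *_) sp-eq) (ι-scale D (+ 6 ℤ.* σ) u)

  surplus*sp : surplus G d * sp G ≡ ι (4d ℤ.* T ℤ.* (+ 6 ℤ.* σ)) * (u * u)
  surplus*sp = trans (cong₂ _*_ surplus-eq sp-eq) (ι-product (4d ℤ.* T) (+ 6 ℤ.* σ))

  sp² : sp G * sp G ≡ ι (+ 6 ℤ.* σ ℤ.* (+ 6 ℤ.* σ)) * (u * u)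
  sp² = trans (cong₂ _*_ sp-eq sp-eq) (ι-product (+ 6 ℤ.* σ) (+ 6 ℤ.* σ))

  n²d-over-u² : ℕ→ℚ (n ℕ.^ 2 ℕ.* d) ≡ ι (+ 576 ℤ.* (N ℤ.* N ℤ.* D)) * (u * u)
  n²d-over-u² = trans (ι-over-u² (+ (n ℕ.^ 2 ℕ.* d))) (cong (λ z → ι (+ 576 ℤ.* z) * (u * u)) n²d)

  n²d²-over-u² : ℕ→ℚ (n ℕ.^ 2 ℕ.* d ℕ.^ 2) ≡ ι (+ 576 ℤ.* (N ℤ.* N ℤ.* (D ℤ.* D))) * (u * u)
  n²d²-over-u² = trans (ι-over-u² (+ (n ℕ.^ 2 ℕ.* d ℕ.^ 2))) (cong (λ z → ι (+ 576 ℤ.* z) * (u * u)) n²d²)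

  scale² : ∀ a → C * C * (ι a * (u * u)) ≡ ι (K ℤ.* K ℤ.* a) * (u * u)
  scale² a = trans (cong (_* (ι a * (u * u))) (sym (ι-* K K))) (ι-scale (K ℤ.* K) a (u * u))

  negative-case : surplus G d < 0ℚ → ℕ→ℚ (n ℕ.^ 2 ℕ.* d ℕ.^ 3) < surplus G d * surplus G d →
    (c * ∣ surplus G d ∣ ≤ ℕ→ℚ d * sp G) × (ℕ→ℚ d * sp G ≤ C * ∣ surplus G d ∣)
  negative-case s<0 h =
      divide (subst₂ _≤_ (sym modulus) (sym (trans (cong (C *_) d*sp) (ι-scale K (D ℤ.* (+ 6 ℤ.* σ)) u)))
        (scaled-mono u (Integral.rescale-negative-lower {D} {T} {σ} {+ 4 ℤ.* + 256} {K} 0≤D 0≤σ 0≤K Integral.1024≤K lower-bound)))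
    , subst₂ _≤_ (sym d*sp) (sym (trans (cong (C *_) modulus) (ι-scale K (4d ℤ.* ℤ.- T) u)))
        (scaled-mono u (Integral.rescale-negative-upper {D} {T} {σ} {+ 201} {K} 0≤D 0≤-T (ℤ.+≤+ z≤n) Integral.402≤K upper-bound′))
    where
    open Negative (T-negative s<0) (T-large h)
    0≤-T : 0ℤ ℤ.≤ ℤ.- T
    0≤-T = ℤ.<⇒≤ (ℤ.neg-mono-< (T-negative s<0))
    modulus : ∣ surplus G d ∣ ≡ ι (4d ℤ.* ℤ.- T) * u
    modulus = trans (cong ∣_∣ (trans surplus-eq (trans (cong (λ z → ι z * u) (ring 4d T))
        (trans (cong (_* u) (ι-neg (4d ℤ.* ℤ.- T))) (sym (ℚ.neg-distribˡ-* (ι (4d ℤ.* ℤ.- T)) u))))))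
      (trans (ℚ.∣-p∣≡∣p∣ (ι (4d ℤ.* ℤ.- T) * u)) (ℚ.0≤p⇒∣p∣≡p (subst (_≤ ι (4d ℤ.* ℤ.- T) * u) (ℚ.*-zeroˡ u) (scaled-mono u (Integral.0≤* 0≤4d 0≤-T)))))
      where
      ring : ∀ x t → x ℤ.* t ≡ ℤ.- (x ℤ.* ℤ.- t)
      ring = solve-∀

  small-case : surplus G d * surplus G d ≤ ℕ→ℚ (n ℕ.^ 2 ℕ.* d ℕ.^ 3) →
    (0ℚ ≤ sp G) × (c * c * ℕ→ℚ (n ℕ.^ 2 ℕ.* d) ≤ sp G * sp G) × (sp G * sp G ≤ C * C * ℕ→ℚ (n ℕ.^ 2 ℕ.* d))
  small-case h =
      subst₂ _≤_ (ℚ.*-zeroˡ u) (sym sp-eq) (scaled-mono u (Integral.0≤* {+ 6} (ℤ.+≤+ z≤n) 0≤σ))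
    , divide² (subst₂ _≤_ (sym n²d-over-u²) (sym (trans (cong (C * C *_) sp²) (scale² (+ 6 ℤ.* σ ℤ.* (+ 6 ℤ.* σ)))))
        (scaled-mono (u * u) (Integral.rescale-small-lower {N ℤ.* N ℤ.* D} {σ} {Integral.C₁} {K} Integral.K≡ lower-bound)))
    , subst₂ _≤_ (sym sp²) (sym (trans (cong (C * C *_) n²d-over-u²) (scale² (+ 576 ℤ.* (N ℤ.* N ℤ.* D)))))
        (scaled-mono (u * u) (Integral.rescale-small-upper {N ℤ.* N ℤ.* D} {σ} {Integral.C₂} {K} (Integral.0≤* (Integral.0≤² N) 0≤D) Integral.C₂≤16K² upper-bound′))
    where open Small (T-small h)

  positive-case : 0ℚ < surplus G d → ℕ→ℚ (n ℕ.^ 2 ℕ.* d ℕ.^ 3) < surplus G d * surplus G d →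
    (c * ℕ→ℚ (n ℕ.^ 2 ℕ.* d ℕ.^ 2) ≤ surplus G d * sp G) × (surplus G d * sp G ≤ C * ℕ→ℚ (n ℕ.^ 2 ℕ.* d ℕ.^ 2))
  positive-case 0<s h =
      divide (subst₂ _≤_ (sym n²d²-over-u²) (sym (trans (cong (C *_) surplus*sp) (ι-scale K (4d ℤ.* T ℤ.* (+ 6 ℤ.* σ)) (u * u))))
        (scaled-mono (u * u) (Integral.rescale-positive-lower {N} {D} {T} {σ} {Integral.C₃} {K} 0≤D (ℤ.<⇒≤ 0<T) 0≤σ Integral.24C₃≤K lower-bound)))
    , subst₂ _≤_ (sym surplus*sp) (sym (trans (cong (C *_) n²d²-over-u²) (ι-scale K (+ 576 ℤ.* (N ℤ.* N ℤ.* (D ℤ.* D))) (u * u))))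
        (scaled-mono (u * u) (Integral.rescale-positive-upper {N} {D} {T} {σ} {K} 0≤N 0≤D Integral.1≤K upper-bound′))
    where
    0<T = T-positive 0<s
    open Positive 0<T (T-large h)

theorem2p4 : Σ ℚ λ c → Σ ℚ λ C → (0ℚ < c) × (c ≤ C) ×
    (∀ (n : ℕ) (G : Graph n) (d : ℕ) → StronglyRegular G d →
    1 ℕ.≤ d → 100 ℕ.* d ℕ.≤ 99 ℕ.* n →
    ((surplus G d < 0ℚ →
    ℕ→ℚ (n ℕ.^ 2 ℕ.* d ℕ.^ 3) < surplus G d * surplus G d →
    (c * ∣ surplus G d ∣ ≤ ℕ→ℚ d * sp G) × (ℕ→ℚ d * sp G ≤ C * ∣ surplus G d ∣))
    × (surplus G d * surplus G d ≤ ℕ→ℚ (n ℕ.^ 2 ℕ.* d ℕ.^ 3) →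
    (0ℚ ≤ sp G) ×
    (c * c * ℕ→ℚ (n ℕ.^ 2 ℕ.* d) ≤ sp G * sp G) ×
    (sp G * sp G ≤ C * C * ℕ→ℚ (n ℕ.^ 2 ℕ.* d)))
    × (0ℚ < surplus G d →
    ℕ→ℚ (n ℕ.^ 2 ℕ.* d ℕ.^ 3) < surplus G d * surplus G d →
    (c * ℕ→ℚ (n ℕ.^ 2 ℕ.* d ℕ.^ 2) ≤ surplus G d * sp G) ×
    (surplus G d * sp G ≤ C * ℕ→ℚ (n ℕ.^ 2 ℕ.* d ℕ.^ 2)))))
theorem2p4 = c , C , 0<c , c≤C , bounds
  where
  bounds : ∀ n (G : Graph n) d → StronglyRegular G d → 1 ℕ.≤ d → 100 ℕ.* d ℕ.≤ 99 ℕ.* n → _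
  -- The hypotheses on d exclude the empty graph. Otherwise the vertex `zero` serves as the i₀ that
  -- witnesses n > 0 and at which paths of length two are counted.
  bounds ℕ.zero G (suc d) _ _ ()
  bounds (suc n) G d (regular , η , μ , η-common , μ-common) 1≤d sparse = negative-case , small-case , positive-case
    where open Rational G regular η-common μ-common 1≤d sparse zero
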